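{- For any integer $n\ge 0$, we have \[\mathrm{pod}_{ -3}(11n+10)\equiv 4(-1)^{n}r_7(8n+7) \pmod{11}.\]
   Context: $\mathrm{pod}_{ -3}(n)$ denotes the number of partition triples of $n$ in which the odd parts in each of the three partitions are distinct. Equivalently, as formal power series, \[\sum_{n=0}^{\infty}\mathrm{pod}_{ -3}(n)q^n=\frac{(-q;q^2)_\infty^3}{(q^2;q^2)_\infty^3}=\frac{1}{\psi(-q)^3},\] where $\psi(q)=\sum_{n=0}^{\infty}q^{n(n+1)/2}$ and $(a;q)_\infty=\prod_{k\ge 0}(1-aq^k)$. $r_k(n)$ denotes the number of representations of $n$ as a sum of $k$ squares, i.e. the number of $(x_1,\dots,x_k)\in\mathbb{Z}^k$ with $x_1^2+\cdots+x_k^2=n$. -}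

module Defs where

open import Data.Nat.Base using (ℕ; zero; suc; _+_; _*_; _≤_; _<_; _≥_; z≤n; s≤s)
open import Data.Nat.Properties
  using (_≟_; _≤?_; _<?_; _≥?_; ≤-trans; ≤-reflexive; m≤m+n; m≤n+m; m≤m*n; +-mono-≤)
open import Data.Nat.Divisibility using (_∣_; _∣?_)
open import Data.Integer.Base as ℤ using (ℤ; +_; -[1+_]; 0ℤ; ∣_∣)
import Data.Integer.Divisibility as ℤ
import Data.Integer.Properties as ℤ
open import Data.List.Base
  using (List; []; _∷_; _++_; [_]; length; map; filter; upTo; cartesianProduct; cartesianProductWith)
open import Data.Nat.ListAction using (sum)
open import Data.List.Properties using (∷-injective)
open import Data.List.Membership.Propositional using (_∈_)
open import Data.List.Membership.Propositional.Properties
open import Data.List.Relation.Unary.All as All using (All; []; _∷_; all?)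
open import Data.List.Relation.Unary.Any using (here; there)
open import Data.List.Relation.Unary.Linked as Linked using (Linked; linked?)
open import Data.List.Relation.Unary.AllPairs using ([]; _∷_)
open import Data.List.Relation.Unary.Unique.Propositional using (Unique)
import Data.List.Relation.Unary.Unique.Propositional.Properties as Unique
open import Data.List.Relation.Unary.Unique.DecPropositional _≟_ using (unique?)
open import Data.Product.Base using (_×_; _,_; proj₁; proj₂; ∃)
open import Data.Vec.Base as Vec using (Vec; []; _∷_)
import Data.Vec.Properties as Vec
open import Function.Base using (_∘_)
open import Relation.Binary.PropositionalEquality.Core using (_≡_; _≢_; refl; sym; trans; cong₂)
open import Relation.Nullary.Decidable using (¬?; _×-dec_)
open import Relation.Nullary.Negation.Core using (¬_)
open import Relation.Unary using (Pred; Decidable)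
open import Level using (0ℓ)

-- A duplicate-free list of exactly the elements satisfying P; its length is
-- the number of such elements and does not depend on the list chosen.

record Enumeration {A : Set} (P : Pred A 0ℓ) : Set where
  field
    elements : List A
    unique   : Unique elements
    sound    : ∀ {x} → x ∈ elements → P x
    complete : ∀ {x} → P x → x ∈ elements

  count : ℕ
  count = length elements

filterEnum : {A : Set} {P : Pred A 0ℓ} → Decidable P → (xs : List A) →
             Unique xs → (∀ {x} → P x → x ∈ xs) → Enumeration P
filterEnum P? xs u c = record
  { elements = filter P? xs
  ; unique   = Unique.filter⁺ P? u
  ; sound    = λ x∈ → proj₂ (∈-filter⁻ P? {xs = xs} x∈)
  ; complete = λ p → ∈-filter⁺ P? (c p) p
  }

Odd : Pred ℕ 0ℓ
Odd m = ¬ (2 ∣ m)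

odd? : Decidable Odd
odd? m = ¬? (2 ∣? m)

IsPartition : Pred (List ℕ) 0ℓ
IsPartition ps = All (0 <_) ps × Linked _≥_ ps

OddPartsDistinct : Pred (List ℕ) 0ℓ
OddPartsDistinct ps = Unique (filter odd? ps)

IsPod : Pred (List ℕ) 0ℓ
IsPod ps = IsPartition ps × OddPartsDistinct ps

isPod? : Decidable IsPod
isPod? ps = (all? (0 <?_) ps ×-dec linked? _≥?_ ps) ×-dec unique? (filter odd? ps)

Triple : Set
Triple = List ℕ × List ℕ × List ℕ

IsPodTriple : ℕ → Pred Triple 0ℓ
IsPodTriple n (a , b , c) =
  (IsPod a × IsPod b × IsPod c) × sum a + (sum b + sum c) ≡ n

isPodTriple? : ∀ n → Decidable (IsPodTriple n)
isPodTriple? n (a , b , c) =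
  (isPod? a ×-dec (isPod? b ×-dec isPod? c)) ×-dec (sum a + (sum b + sum c) ≟ n)

sumOfSquares : ∀ {k} → Vec ℤ k → ℤ
sumOfSquares = Vec.foldr′ ℤ._+_ 0ℤ ∘ Vec.map (ℤ._^ 2)

IsRepresentation : (k n : ℕ) → Pred (Vec ℤ k) 0ℓ
IsRepresentation k n x = sumOfSquares x ≡ + n

isRepresentation? : ∀ k n → Decidable (IsRepresentation k n)
isRepresentation? k n x = sumOfSquares x ℤ.≟ + n

-- Lists of length at most l with entries at most m.

listsUpTo : (l m : ℕ) → List (List ℕ)
listsUpTo zero    m = [ [] ]
listsUpTo (suc l) m = [] ∷ cartesianProductWith _∷_ (upTo (suc m)) (listsUpTo l m)

listsUpTo-unique : ∀ l m → Unique (listsUpTo l m)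
listsUpTo-unique zero    m = [] ∷ []
listsUpTo-unique (suc l) m =
  All.tabulate nonempty ∷
  Unique.cartesianProductWith⁺ _∷_ ∷-injective (Unique.upTo⁺ (suc m)) (listsUpTo-unique l m)
  where
  nonempty : ∀ {xs} → xs ∈ cartesianProductWith _∷_ (upTo (suc m)) (listsUpTo l m) → [] ≢ xs
  nonempty xs∈ refl with ∈-cartesianProductWith⁻ _∷_ (upTo (suc m)) (listsUpTo l m) xs∈
  ... | _ , _ , _ , _ , ()

listsUpTo-complete : ∀ l m {xs} → length xs ≤ l → All (_≤ m) xs → xs ∈ listsUpTo l m
listsUpTo-complete zero    m {[]}     _        _          = here refl
listsUpTo-complete (suc l) m {[]}     _        _          = here refl
listsUpTo-complete (suc l) m {x ∷ xs} (s≤s le) (x≤ ∷ xs≤) =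
  there (∈-cartesianProductWith⁺ _∷_ (∈-upTo⁺ (s≤s x≤)) (listsUpTo-complete l m le xs≤))

length≤sum : ∀ {xs} → All (0 <_) xs → length xs ≤ sum xs
length≤sum []         = z≤n
length≤sum (0<x ∷ ps) = +-mono-≤ 0<x (length≤sum ps)

parts≤sum : ∀ xs → All (_≤ sum xs) xs
parts≤sum []       = []
parts≤sum (x ∷ xs) =
  m≤m+n x (sum xs) ∷ All.map (λ le → ≤-trans le (m≤n+m (sum xs) x)) (parts≤sum xs)

podTriples : ∀ n → Enumeration (IsPodTriple n)
podTriples n = filterEnum (isPodTriple? n)
  (cartesianProduct box (cartesianProduct box box))
  (Unique.cartesianProduct⁺ box-unique (Unique.cartesianProduct⁺ box-unique box-unique))
  complete
  where
  box : List (List ℕ)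
  box = listsUpTo n n

  box-unique : Unique box
  box-unique = listsUpTo-unique n n

  inBox : ∀ {xs} → IsPod xs → sum xs ≤ n → xs ∈ box
  inBox {xs} ((pos , _) , _) le = listsUpTo-complete n n
    (≤-trans (length≤sum pos) le) (All.map (λ x≤ → ≤-trans x≤ le) (parts≤sum xs))

  complete : ∀ {t} → IsPodTriple n t → t ∈ cartesianProduct box (cartesianProduct box box)
  complete {a , b , c} ((pa , pb , pc) , refl) = ∈-cartesianProduct⁺
    (inBox pa (m≤m+n (sum a) _))
    (∈-cartesianProduct⁺
      (inBox pb (≤-trans (m≤m+n (sum b) (sum c)) (m≤n+m _ (sum a))))
      (inBox pc (≤-trans (m≤n+m (sum c) (sum b)) (m≤n+m _ (sum a)))))

-- Integers of absolute value at most m.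

intsUpTo : ℕ → List ℤ
intsUpTo m = map +_ (upTo (suc m)) ++ map -[1+_] (upTo m)

intsUpTo-unique : ∀ m → Unique (intsUpTo m)
intsUpTo-unique m = Unique.++⁺
  (Unique.map⁺ ℤ.+-injective (Unique.upTo⁺ (suc m)))
  (Unique.map⁺ ℤ.-[1+-injective (Unique.upTo⁺ m))
  disjoint
  where
  disjoint : ∀ {x} → ¬ (x ∈ map +_ (upTo (suc m)) × x ∈ map -[1+_] (upTo m))
  disjoint (p , q) with ∈-map⁻ +_ p | ∈-map⁻ -[1+_] q
  ... | _ , _ , refl | _ , _ , ()

intsUpTo-complete : ∀ m {x} → ∣ x ∣ ≤ m → x ∈ intsUpTo m
intsUpTo-complete m {+ i}      le = ∈-++⁺ˡ (∈-map⁺ +_ (∈-upTo⁺ (s≤s le)))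
intsUpTo-complete m { -[1+ i ]} le = ∈-++⁺ʳ (map +_ (upTo (suc m))) (∈-map⁺ -[1+_] (∈-upTo⁺ le))

vecsOver : {A : Set} → List A → (k : ℕ) → List (Vec A k)
vecsOver xs zero    = [ [] ]
vecsOver xs (suc k) = cartesianProductWith _∷_ xs (vecsOver xs k)

vecsOver-unique : {A : Set} {xs : List A} → Unique xs → ∀ k → Unique (vecsOver xs k)
vecsOver-unique u zero    = [] ∷ []
vecsOver-unique u (suc k) =
  Unique.cartesianProductWith⁺ _∷_ Vec.∷-injective u (vecsOver-unique u k)

square : ∀ i → ∃ λ s → i ℤ.^ 2 ≡ + s × ∣ i ∣ ≤ s
square (+ zero)  = 0 , refl , z≤n
square (+ suc i) = _ , refl , m≤m*n (suc i) (suc i * 1)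
square -[1+ i ]  = _ , refl , m≤m*n (suc i) (suc i * 1)

sumOfSquares-complete : ∀ {k} (x : Vec ℤ k) →
  ∃ λ s → sumOfSquares x ≡ + s × (∀ {m} → s ≤ m → x ∈ vecsOver (intsUpTo m) k)
sumOfSquares-complete []      = 0 , refl , λ _ → here refl
sumOfSquares-complete (i ∷ x) with square i | sumOfSquares-complete x
... | s , i²≡s , i≤s | t , x≡t , x∈ =
  s + t , cong₂ ℤ._+_ i²≡s x≡t , λ {m} le →
  ∈-cartesianProductWith⁺ _∷_
    (intsUpTo-complete m (≤-trans i≤s (≤-trans (m≤m+n s t) le)))
    (x∈ (≤-trans (m≤n+m t s) le))

representations : ∀ k n → Enumeration (IsRepresentation k n)
representations k n = filterEnum (isRepresentation? k n)
  (vecsOver (intsUpTo n) k) (vecsOver-unique (intsUpTo-unique n) k) complete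
  where
  complete : ∀ {x} → IsRepresentation k n x → x ∈ vecsOver (intsUpTo n) k
  complete {x} x≡n with sumOfSquares-complete x
  ... | s , x≡s , x∈ = x∈ (≤-reflexive (ℤ.+-injective (trans (sym x≡s) x≡n)))

pod₋₃ : ℕ → ℕ
pod₋₃ n = Enumeration.count (podTriples n)

r : (k n : ℕ) → ℕ
r k n = Enumeration.count (representations k n)

infix 4 _≡_[mod_]

_≡_[mod_] : ℤ → ℤ → ℤ → Set
a ≡ b [mod m ] = m ℤ.∣ (a ℤ.- b)

{-# OPTIONS --safe #-}

-- Modulo 11 the generating function 1/ψ(−q)³ is ψ(−q)⁸/ψ(−q¹¹), so pod₋₃(11 n + 10) is governed by
-- the coefficients t₈(11 n + 10) of ψ⁸. By Jacobi's theorem t₈(n) is a sum of cubes of divisors of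
-- n + 1, hence t₈(11 n + 10) ≡ t₈(n), and pod₋₃(11 n + 10) ≡ (−1)ⁿ t₇(n). On the other side,
-- θ(q) = θ(q⁴) + 2 q ψ(q⁸) and θ(q) ψ(q²) = ψ(q)² give r₇(8 n + 7) = 2368 t₇(n), and
-- 4 · 2368 ≡ 1.
--
-- Jacobi's theorem is reached without modular forms. Both ψ⁴ and the series σ with coefficients
-- σ₁(2 n + 1) solve ψ · q f′ = 4 (q ψ′) f; for σ this is an identity for sums over the indefinite
-- binary quadratic forms of discriminant 8 n + 5, proved by an involution. Then t₈ is the
-- self-convolution of σ, which Liouville's rearrangement of the solutions of a x + b y = 2 (n + 1)
-- reduces to the solutions with x = y.

module Submission where

open import Defs
open import Algebra.Bundles using (CommutativeRing; module AbelianGroup)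
import Algebra.Properties.Group
open import Algebra.Solver.Ring.AlmostCommutativeRing using (fromCommutativeRing; _-Raw-AlmostCommutative⟶_)
open import Data.Empty using (⊥-elim)
open import Data.Integer.Base as ℤ using (ℤ; +_; -[1+_]; 0ℤ; 1ℤ; -1ℤ; ∣_∣)
import Data.Integer.Divisibility.Signed as Signed
import Data.Integer.Properties as ℤ
open import Data.Integer.Tactic.RingSolver using (solve-∀)
open import Data.List.Base using (List; []; _∷_; _++_; [_]; map; filter; cartesianProduct; length; upTo)
open import Data.List.Membership.Propositional using (_∈_)
open import Data.List.Membership.Propositional.Properties
open import Data.List.Membership.Propositional.Properties.WithK using (unique∧set⇒bag)
open import Data.List.Properties using (filter-accept; filter-reject; filter-++; upTo-∷ʳ; ∷-injectiveʳ)
open import Data.List.Relation.Binary.BagAndSetEquality using (∼bag⇒↭)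
open import Data.List.Relation.Binary.Permutation.Propositional using (_↭_; prep; swap)
open import Data.List.Relation.Unary.All as All using (All; []; _∷_; all?)
open import Data.List.Relation.Unary.AllPairs as AllPairs using ([]; _∷_)
open import Data.List.Relation.Unary.Any using (here; there)
open import Data.List.Relation.Unary.Linked as Linked using (Linked; []; [-]; _∷_)
open import Data.List.Relation.Unary.Linked.Properties using (Linked⇒AllPairs)
open import Data.List.Relation.Unary.Unique.Propositional using (Unique)
import Data.List.Relation.Unary.Unique.Propositional.Properties as Unique
open import Data.Maybe.Base using (Maybe; just; nothing)
open import Data.Nat.Base as ℕ using (ℕ; zero; suc; _+_; _*_; _≥_; z≤n; s≤s)
open import Data.Nat.Divisibility using (_∣_; divides; ∣1⇒≡1; ∣m+n∣m⇒∣n)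
open import Data.Nat.ListAction using (sum)
open import Data.Nat.Primality using (Prime; prime?; euclidsLemma)
import Data.Nat.Properties as ℕ
open import Data.Product.Base using (_×_; _,_; ∃; ∃₂; proj₁; proj₂)
open import Data.Product.Properties using (,-injective)
open import Data.Sum.Base using (_⊎_; inj₁; inj₂)
open import Data.Vec.Base using ([]; _∷_)
import Data.Vec.Properties as Vec
open import Function.Base using (_∘_; id)
open import Function.Bundles using (mk⇔)
open import Level using (0ℓ)
open import Relation.Binary.PropositionalEquality hiding ([_])
open import Relation.Nullary.Decidable using (Dec; yes; no; ¬?; map′; _×-dec_; from-yes)
open import Relation.Nullary.Negation.Core using (¬_)
open import Relation.Unary using (Pred; Decidable)

open Algebra.Properties.Group (AbelianGroup.group ℤ.+-0-abelianGroup)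
  using () renaming (∙-cancelˡ to +-cancelˡ; ∙-cancelʳ to +-cancelʳ)

-- Formal power series over ℤ

-- The partition triples lead to a product, whereas everything else concerns ψ. Gauss' identity at x
-- = - q is the bridge between the two; Shanks' finite form is used so that each coefficient needs
-- only a finite product, and no limit of products occurs. The power ψ⁸ appears because 3 + 8 = 11,
-- and the progression is 11 n + 10 because its successor is 11 (n + 1): multiplying n + 1 by 11
-- adds only cubes divisible by 11 to the divisor sum. The differential equation is the logarithmic
-- derivative of ψ⁴ with denominators cleared. It is linear of first order and so fixes a series by
-- its constant term. For σ it becomes a single convolution identity, the vanishing of the sum of a
-- (a c - b²) over odd a, b, c with a, c > 0 and b² + 4 a c = 8 n + 5. Finally 2368 = 35 · 2³ · 8 +
-- 2⁷: only the binomial terms of θ⁷ with the third and the seventh power of 2 q ψ(q⁸) reach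
-- exponents 7 modulo 8, and θ⁴ supplies the factor 8.

infixr 5 _⨾_
_⨾_ : ∀ {a} {A : Set a} {x y z : A} → x ≡ y → y ≡ z → x ≡ z
_⨾_ = trans

+-congˡ : ∀ a {x y} → x ≡ y → a ℤ.+ x ≡ a ℤ.+ y
+-congˡ a = cong (λ x → a ℤ.+ x)

Series : Set
Series = ℕ → ℤ

infix 4 _≋_
_≋_ : Series → Series → Set
f ≋ g = ∀ n → f n ≡ g n

tail : Series → Series
tail f n = f (suc n)

infixl 6 _⊕_
_⊕_ : Series → Series → Series
(f ⊕ g) n = f n ℤ.+ g n

infixl 8 _∙_
_∙_ : ℤ → Series → Series
(c ∙ f) n = c ℤ.* f n

neg : Series → Series
neg f n = ℤ.- f n

const : ℤ → Series
const c zero    = c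
const c (suc n) = 0ℤ

-- The Cauchy product, defined by peeling the constant term off the left factor. The recursion is
-- structural in the index, so ring laws and product formulas are inductions without sums over
-- antidiagonals.
infixl 7 _⊛_
_⊛_ : Series → Series → Series
(f ⊛ g) zero    = f 0 ℤ.* g 0
(f ⊛ g) (suc n) = f 0 ℤ.* g (suc n) ℤ.+ (tail f ⊛ g) n

⊛-cong : ∀ {f f′ g g′} → f ≋ f′ → g ≋ g′ → f ⊛ g ≋ f′ ⊛ g′
⊛-cong p q zero    = cong₂ ℤ._*_ (p 0) (q 0)
⊛-cong p q (suc n) =
  cong₂ ℤ._+_ (cong₂ ℤ._*_ (p 0) (q (suc n))) (⊛-cong (λ m → p (suc m)) q n)

⊛-vanishʳ : ∀ f {g} n → (∀ m → m ℕ.≤ n → g m ≡ 0ℤ) → (f ⊛ g) n ≡ 0ℤ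
⊛-vanishʳ f zero    z = trans (cong (f 0 ℤ.*_) (z 0 z≤n)) (ℤ.*-zeroʳ (f 0))
⊛-vanishʳ f (suc n) z =
  cong₂ ℤ._+_ (trans (cong (f 0 ℤ.*_) (z (suc n) (s≤s ≤-refl))) (ℤ.*-zeroʳ (f 0)))
              (⊛-vanishʳ (tail f) n (λ m m≤n → z m (m≤n⇒m≤1+n m≤n)))
  where open import Data.Nat.Properties

⊛-vanishˡ : ∀ {f} g → (∀ m → f m ≡ 0ℤ) → ∀ n → (f ⊛ g) n ≡ 0ℤ
⊛-vanishˡ g z zero    = cong (ℤ._* g 0) (z 0)
⊛-vanishˡ g z (suc n) =
  cong₂ ℤ._+_ (cong (ℤ._* g (suc n)) (z 0)) (⊛-vanishˡ g (λ m → z (suc m)) n)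

⊛-sucʳ : ∀ f g n → (f ⊛ g) (suc n) ≡ (f ⊛ tail g) n ℤ.+ f (suc n) ℤ.* g 0
⊛-sucʳ f g zero    = refl
⊛-sucʳ f g (suc n) =
  trans (+-congˡ (f 0 ℤ.* g (suc (suc n))) (⊛-sucʳ (tail f) g n))
        (sym (ℤ.+-assoc (f 0 ℤ.* g (suc (suc n))) _ _))

⊛-comm : ∀ f g → f ⊛ g ≋ g ⊛ f
⊛-comm f g zero    = ℤ.*-comm (f 0) (g 0)
⊛-comm f g (suc n) = begin
  f 0 ℤ.* g (suc n) ℤ.+ (tail f ⊛ g) n  ≡⟨ cong₂ ℤ._+_ (ℤ.*-comm (f 0) _) (⊛-comm (tail f) g n) ⟩
  g (suc n) ℤ.* f 0 ℤ.+ (g ⊛ tail f) n  ≡⟨ ℤ.+-comm (g (suc n) ℤ.* f 0) _ ⟩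
  (g ⊛ tail f) n ℤ.+ g (suc n) ℤ.* f 0  ≡⟨ ⊛-sucʳ g f n ⟨
  (g ⊛ f) (suc n)                       ∎
  where open ≡-Reasoning

⊛-distribʳ : ∀ h f g → (f ⊕ g) ⊛ h ≋ (f ⊛ h) ⊕ (g ⊛ h)
⊛-distribʳ h f g zero    = ℤ.*-distribʳ-+ (h 0) (f 0) (g 0)
⊛-distribʳ h f g (suc n) =
  trans (+-congˡ ((f 0 ℤ.+ g 0) ℤ.* h (suc n)) (⊛-distribʳ h (tail f) (tail g) n))
        (rearrange (f 0) (g 0) (h (suc n)) _ _)
  where
  rearrange : ∀ a b c x y → (a ℤ.+ b) ℤ.* c ℤ.+ (x ℤ.+ y) ≡ (a ℤ.* c ℤ.+ x) ℤ.+ (b ℤ.* c ℤ.+ y)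
  rearrange = solve-∀

∙-⊛ : ∀ c f g → (c ∙ f) ⊛ g ≋ c ∙ (f ⊛ g)
∙-⊛ c f g zero    = ℤ.*-assoc c (f 0) (g 0)
∙-⊛ c f g (suc n) = trans (+-congˡ ((c ℤ.* f 0) ℤ.* g (suc n)) (∙-⊛ c (tail f) g n))
                          (rearrange c (f 0) (g (suc n)) _)
  where
  rearrange : ∀ c a b x → (c ℤ.* a) ℤ.* b ℤ.+ c ℤ.* x ≡ c ℤ.* (a ℤ.* b ℤ.+ x)
  rearrange = solve-∀

⊛-assoc : ∀ f g h → (f ⊛ g) ⊛ h ≋ f ⊛ (g ⊛ h)
⊛-assoc f g h zero    = ℤ.*-assoc (f 0) (g 0) (h 0)
⊛-assoc f g h (suc n) = begin
  f 0 ℤ.* g 0 ℤ.* h (suc n) ℤ.+ ((f 0 ∙ tail g ⊕ tail f ⊛ g) ⊛ h) n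
    ≡⟨ +-congˡ (f 0 ℤ.* g 0 ℤ.* h (suc n)) (⊛-distribʳ h (f 0 ∙ tail g) (tail f ⊛ g) n) ⟩
  f 0 ℤ.* g 0 ℤ.* h (suc n) ℤ.+ (((f 0 ∙ tail g) ⊛ h) n ℤ.+ ((tail f ⊛ g) ⊛ h) n)
    ≡⟨ +-congˡ (f 0 ℤ.* g 0 ℤ.* h (suc n))
            (cong₂ ℤ._+_ (∙-⊛ (f 0) (tail g) h n) (⊛-assoc (tail f) g h n)) ⟩
  f 0 ℤ.* g 0 ℤ.* h (suc n) ℤ.+ (f 0 ℤ.* (tail g ⊛ h) n ℤ.+ (tail f ⊛ (g ⊛ h)) n)
    ≡⟨ rearrange (f 0) (g 0) (h (suc n)) _ _ ⟩
  f 0 ℤ.* (g 0 ℤ.* h (suc n) ℤ.+ (tail g ⊛ h) n) ℤ.+ (tail f ⊛ (g ⊛ h)) n ∎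
  where
  open ≡-Reasoning
  rearrange : ∀ a b c x y → a ℤ.* b ℤ.* c ℤ.+ (a ℤ.* x ℤ.+ y) ≡ a ℤ.* (b ℤ.* c ℤ.+ x) ℤ.+ y
  rearrange = solve-∀

const-⊛ : ∀ c f → const c ⊛ f ≋ c ∙ f
const-⊛ c f zero    = refl
const-⊛ c f (suc n) =
  trans (+-congˡ (c ℤ.* f (suc n)) (⊛-vanishˡ f (λ _ → refl) n)) (ℤ.+-identityʳ _)

⊛-identityˡ : ∀ f → const 1ℤ ⊛ f ≋ f
⊛-identityˡ f n = trans (const-⊛ 1ℤ f n) (ℤ.*-identityˡ (f n))

seriesRing : CommutativeRing 0ℓ 0ℓ
seriesRing = record
  { Carrier = Series
  ; _≈_ = _≋_
  ; _+_ = _⊕_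
  ; _*_ = _⊛_
  ; -_  = neg
  ; 0#  = λ _ → 0ℤ
  ; 1#  = const 1ℤ
  ; isCommutativeRing = record
    { isRing = record
      { +-isAbelianGroup = record
        { isGroup = record
          { isMonoid = record
            { isSemigroup = record
              { isMagma = record
                { isEquivalence = record
                  { refl = λ _ → refl ; sym = λ p n → sym (p n) ; trans = λ p q n → trans (p n) (q n) }
                ; ∙-cong = λ p q n → cong₂ ℤ._+_ (p n) (q n)
                }
              ; assoc = λ f g h n → ℤ.+-assoc (f n) (g n) (h n)
              }
            ; identity = (λ f n → ℤ.+-identityˡ (f n)) , (λ f n → ℤ.+-identityʳ (f n))
            }
          ; inverse = (λ f n → ℤ.+-inverseˡ (f n)) , (λ f n → ℤ.+-inverseʳ (f n))
          ; ⁻¹-cong = λ p n → cong (ℤ.-_) (p n)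
          }
        ; comm = λ f g n → ℤ.+-comm (f n) (g n)
        }
      ; *-cong = ⊛-cong
      ; *-assoc = ⊛-assoc
      ; *-identity = ⊛-identityˡ , (λ f n → trans (⊛-comm f (const 1ℤ) n) (⊛-identityˡ f n))
      ; distrib = (λ h f g n → trans (⊛-comm h (f ⊕ g) n)
                                (trans (⊛-distribʳ h f g n)
                                  (cong₂ ℤ._+_ (⊛-comm f h n) (⊛-comm g h n))))
                , ⊛-distribʳ
      }
    ; *-comm = ⊛-comm
    }
  }

-- Finite sums over enumerations and generating functions

private variable
  A B : Set
  P Q : Pred A 0ℓ

total : (A → ℤ) → List A → ℤ
total f []       = 0ℤ
total f (x ∷ xs) = f x ℤ.+ total f xs

total-++ : ∀ (f : A → ℤ) xs ys → total f (xs ++ ys) ≡ total f xs ℤ.+ total f ys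
total-++ f []       ys = sym (ℤ.+-identityˡ _)
total-++ f (x ∷ xs) ys =
  +-congˡ (f x) (total-++ f xs ys) ⨾ sym (ℤ.+-assoc (f x) (total f xs) (total f ys))

total-↭ : ∀ (f : A → ℤ) {xs ys} → xs ↭ ys → total f xs ≡ total f ys
total-↭ f _↭_.refl       = refl
total-↭ f (prep x p)   = +-congˡ (f x) (total-↭ f p)
total-↭ f (swap x y p) =
  +-congˡ (f x) (+-congˡ (f y) (total-↭ f p)) ⨾ exchange (f x) (f y) _
  where
  exchange : ∀ a b c → a ℤ.+ (b ℤ.+ c) ≡ b ℤ.+ (a ℤ.+ c)
  exchange = solve-∀
total-↭ f (_↭_.trans p q)  = total-↭ f p ⨾ total-↭ f q

total-map : ∀ (f : B → ℤ) (φ : A → B) xs → total f (map φ xs) ≡ total (f ∘ φ) xs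
total-map f φ []       = refl
total-map f φ (x ∷ xs) = +-congˡ (f (φ x)) (total-map f φ xs)

total-cong : ∀ {f g : A → ℤ} xs → (∀ {x} → x ∈ xs → f x ≡ g x) → total f xs ≡ total g xs
total-cong []       eq = refl
total-cong (x ∷ xs) eq = cong₂ ℤ._+_ (eq (here refl)) (total-cong xs (eq ∘ there))

total-+ : ∀ (f g : A → ℤ) xs → total (λ x → f x ℤ.+ g x) xs ≡ total f xs ℤ.+ total g xs
total-+ f g []       = refl
total-+ f g (x ∷ xs) = +-congˡ (f x ℤ.+ g x) (total-+ f g xs) ⨾ rearrange (f x) (g x) _ _
  where
  rearrange : ∀ a b c d → (a ℤ.+ b) ℤ.+ (c ℤ.+ d) ≡ (a ℤ.+ c) ℤ.+ (b ℤ.+ d)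
  rearrange = solve-∀

total-* : ∀ c (f : A → ℤ) xs → total (λ x → c ℤ.* f x) xs ≡ c ℤ.* total f xs
total-* c f []       = sym (ℤ.*-zeroʳ c)
total-* c f (x ∷ xs) = +-congˡ (c ℤ.* f x) (total-* c f xs) ⨾ sym (ℤ.*-distribˡ-+ c (f x) _)

total-1 : ∀ (xs : List A) → total (λ _ → 1ℤ) xs ≡ + length xs
total-1 []       = refl
total-1 (x ∷ xs) = +-congˡ 1ℤ (total-1 xs)

total-filter : ∀ (Q? : Decidable Q) f (xs : List A) →
  total f xs ≡ total f (filter Q? xs) ℤ.+ total f (filter (¬? ∘ Q?) xs)
total-filter Q? f []       = refl
total-filter Q? f (x ∷ xs) with Q? x
... | yes _ = +-congˡ (f x) (total-filter Q? f xs) ⨾ sym (ℤ.+-assoc (f x) _ _)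
... | no  _ = +-congˡ (f x) (total-filter Q? f xs) ⨾
    exchange (f x) (total f (filter Q? xs)) (total f (filter (¬? ∘ Q?) xs))
  where
  exchange : ∀ a b c → a ℤ.+ (b ℤ.+ c) ≡ b ℤ.+ (a ℤ.+ c)
  exchange = solve-∀

total-cartesianProduct : ∀ (f : A → ℤ) (g : B → ℤ) xs ys →
  total (λ p → f (proj₁ p) ℤ.* g (proj₂ p)) (cartesianProduct xs ys) ≡ total f xs ℤ.* total g ys
total-cartesianProduct f g []       ys = refl
total-cartesianProduct f g (x ∷ xs) ys =
  total-++ _ (map (x ,_) ys) (cartesianProduct xs ys) ⨾
  cong₂ ℤ._+_ (total-map _ (x ,_) ys ⨾ total-* (f x) g ys) (total-cartesianProduct f g xs ys) ⨾
  sym (ℤ.*-distribʳ-+ (total g ys) (f x) (total f xs))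

open Enumeration

∑ : Enumeration P → (_ → ℤ) → ℤ
∑ E f = total f (elements E)

∑-cong : (E : Enumeration P) → ∀ {f g} → (∀ {x} → P x → f x ≡ g x) → ∑ E f ≡ ∑ E g
∑-cong E eq = total-cong (elements E) (eq ∘ sound E)

∑-+ : (E : Enumeration P) → ∀ f g → ∑ E (λ x → f x ℤ.+ g x) ≡ ∑ E f ℤ.+ ∑ E g
∑-+ E f g = total-+ f g (elements E)

∑-* : ∀ c (E : Enumeration P) f → ∑ E (λ x → c ℤ.* f x) ≡ c ℤ.* ∑ E f
∑-* c E f = total-* c f (elements E)

∑-count : (E : Enumeration P) → ∑ E (λ _ → 1ℤ) ≡ + count E
∑-count E = total-1 (elements E)

∑-empty : (E : Enumeration P) → ∀ f → (∀ {x} → ¬ P x) → ∑ E f ≡ 0ℤ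
∑-empty E f ¬P with elements E | sound E
... | []    | _     = refl
... | _ ∷ _ | sound = ⊥-elim (¬P (sound (here refl)))

restrict : Decidable Q → Enumeration P → Enumeration (λ x → P x × Q x)
restrict Q? E = record
  { elements = filter Q? (elements E)
  ; unique   = Unique.filter⁺ Q? (unique E)
  ; sound    = λ x∈ → let x∈E , Qx = ∈-filter⁻ Q? x∈ in sound E x∈E , Qx
  ; complete = λ (Px , Qx) → ∈-filter⁺ Q? (complete E Px) Qx
  }

∑-split : (Q? : Decidable Q) (E : Enumeration P) → ∀ f →
  ∑ E f ≡ ∑ (restrict Q? E) f ℤ.+ ∑ (restrict (¬? ∘ Q?) E) f
∑-split Q? E f = total-filter Q? f (elements E)

reindex : (∀ {x} → P x → Q x) → (∀ {x} → Q x → P x) → Enumeration P → Enumeration Q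
reindex P⇒Q Q⇒P E = record
  { elements = elements E
  ; unique   = unique E
  ; sound    = P⇒Q ∘ sound E
  ; complete = complete E ∘ Q⇒P
  }

-- The image of the first list is duplicate-free and has the same members as the second, hence is a
-- permutation of it. In particular a sum depends on the predicate alone and not on the enumeration.
-- Injectivity is asked on `P` only.
∑-bijection : {P : Pred A 0ℓ} {Q : Pred B 0ℓ} (E : Enumeration P) (F : Enumeration Q) (φ : A → B) →
  (∀ {x} → P x → Q (φ x)) →
  (∀ {x y} → P x → P y → φ x ≡ φ y → x ≡ y) →
  (∀ {y} → Q y → ∃ λ x → P x × φ x ≡ y) →
  ∀ {f g} → (∀ {x} → P x → f x ≡ g (φ x)) → ∑ E f ≡ ∑ F g
∑-bijection E F φ into injective onto {f} {g} eq =
  ∑-cong E eq ⨾ sym (total-map g φ (elements E)) ⨾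
  total-↭ g (∼bag⇒↭ (unique∧set⇒bag (map-unique (elements E) (sound E) (unique E)) (unique F)
    (mk⇔ to from)))
  where
  map-unique : ∀ xs → (∀ {x} → x ∈ xs → _) → Unique xs → Unique (map φ xs)
  map-unique []       sound []       = []
  map-unique (x ∷ xs) sound (x∉ ∷ u) = All.tabulate fresh ∷ map-unique xs (sound ∘ there) u
    where
    fresh : ∀ {y} → y ∈ map φ xs → φ x ≢ y
    fresh y∈ eq with ∈-map⁻ φ y∈
    ... | x′ , x′∈ , y≡ =
      All.lookup x∉ x′∈ (injective (sound (here refl)) (sound (there x′∈)) (eq ⨾ y≡))
  to : ∀ {y} → y ∈ map φ (elements E) → y ∈ elements F
  to y∈ with ∈-map⁻ φ y∈
  ... | x , x∈ , refl = complete F (into (sound E x∈))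
  from : ∀ {y} → y ∈ elements F → y ∈ map φ (elements E)
  from y∈ with onto (sound F y∈)
  ... | x , Px , refl = ∈-map⁺ φ (complete E Px)

∑-inverse : {P : Pred A 0ℓ} {Q : Pred B 0ℓ} (E : Enumeration P) (F : Enumeration Q)
  (φ : A → B) (φ⁻¹ : B → A) →
  (∀ {x} → P x → Q (φ x)) → (∀ {y} → Q y → P (φ⁻¹ y)) →
  (∀ x → φ⁻¹ (φ x) ≡ x) → (∀ y → φ (φ⁻¹ y) ≡ y) →
  ∀ {f g} → (∀ {x} → P x → f x ≡ g (φ x)) → ∑ E f ≡ ∑ F g
∑-inverse E F φ φ⁻¹ into back left right =
  ∑-bijection E F φ into (λ {x} {y} _ _ eq → sym (left x) ⨾ cong φ⁻¹ eq ⨾ left y)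
    (λ {y} Qy → φ⁻¹ y , back Qy , right y)

∑-⇔ : (E : Enumeration P) (F : Enumeration Q) → (∀ {x} → P x → Q x) → (∀ {x} → Q x → P x) →
  ∀ f → ∑ E f ≡ ∑ F f
∑-⇔ E F P⇒Q Q⇒P f = ∑-inverse E F id id P⇒Q Q⇒P (λ _ → refl) (λ _ → refl) (λ _ → refl)

gf : {P : ℕ → Pred A 0ℓ} → (∀ n → Enumeration (P n)) → (A → ℤ) → Series
gf E f n = ∑ (E n) f

Conv : (ℕ → Pred A 0ℓ) → (ℕ → Pred B 0ℓ) → ℕ → Pred (A × B) 0ℓ
Conv P Q n (a , b) = ∃₂ λ k l → k ℕ.+ l ≡ n × P k a × Q l b

-- Built along the recursion of `_⊛_`, which makes `gf-⊛` a direct induction. `functional` says that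
-- an element of the left family has only one degree; this keeps the blocks of different degrees
-- disjoint.
convolve : {P : ℕ → Pred A 0ℓ} {Q : ℕ → Pred B 0ℓ} →
  (∀ n → Enumeration (P n)) → (∀ {k l a} → P k a → P l a → k ≡ l) → (∀ n → Enumeration (Q n)) →
  ∀ n → Enumeration (Conv P Q n)
convolve E functional F zero = record
  { elements = cartesianProduct (elements (E 0)) (elements (F 0))
  ; unique   = Unique.cartesianProduct⁺ (unique (E 0)) (unique (F 0))
  ; sound    = λ p∈ → let a∈ , b∈ = ∈-cartesianProduct⁻ (elements (E 0)) (elements (F 0)) p∈
                      in 0 , 0 , refl , sound (E 0) a∈ , sound (F 0) b∈
  ; complete = λ { (zero , zero , refl , Pa , Qb) →
                   ∈-cartesianProduct⁺ (complete (E 0) Pa) (complete (F 0) Qb) }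
  }
convolve {P = P} {Q = Q} E functional F (suc n) = record
  { elements = first ++ elements rest
  ; unique   = Unique.++⁺ (Unique.cartesianProduct⁺ (unique (E 0)) (unique (F (suc n))))
                          (unique rest) disjoint
  ; sound    = sound′
  ; complete = complete′
  }
  where
  first = cartesianProduct (elements (E 0)) (elements (F (suc n)))
  rest  = convolve (E ∘ suc) (λ p q → ℕ.suc-injective (functional p q)) F n
  disjoint : ∀ {p} → ¬ (p ∈ first × p ∈ elements rest)
  disjoint (p∈ , p∈′) with sound rest p∈′
  ... | _ , _ , _ , Pa , _
    with () ← functional (sound (E 0) (proj₁ (∈-cartesianProduct⁻ (elements (E 0)) _ p∈))) Pa
  sound′ : ∀ {p} → p ∈ first ++ elements rest → Conv P Q (suc n) p
  sound′ p∈ with ∈-++⁻ first p∈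
  ... | inj₁ p∈ = let a∈ , b∈ = ∈-cartesianProduct⁻ (elements (E 0)) _ p∈
                  in 0 , suc n , refl , sound (E 0) a∈ , sound (F (suc n)) b∈
  ... | inj₂ p∈ = let k , l , k+l , Pa , Qb = sound rest p∈ in suc k , l , cong suc k+l , Pa , Qb
  complete′ : ∀ {p} → Conv P Q (suc n) p → p ∈ first ++ elements rest
  complete′ (zero  , l , refl , Pa , Qb) =
    ∈-++⁺ˡ (∈-cartesianProduct⁺ (complete (E 0) Pa) (complete (F (suc n)) Qb))
  complete′ (suc k , l , k+l , Pa , Qb) =
    ∈-++⁺ʳ first (complete rest (k , l , ℕ.suc-injective k+l , Pa , Qb))

gf-⊛ : {P : ℕ → Pred A 0ℓ} {Q : ℕ → Pred B 0ℓ} (E : ∀ n → Enumeration (P n))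
  (functional : ∀ {k l a} → P k a → P l a → k ≡ l) (F : ∀ n → Enumeration (Q n)) → ∀ f g →
  gf E f ⊛ gf F g ≋ gf (convolve E functional F) (λ p → f (proj₁ p) ℤ.* g (proj₂ p))
gf-⊛ E functional F f g zero    =
  sym (total-cartesianProduct f g (elements (E 0)) (elements (F 0)))
gf-⊛ E functional F f g (suc n) =
  cong₂ ℤ._+_ (sym (total-cartesianProduct f g (elements (E 0)) (elements (F (suc n)))))
              (gf-⊛ (E ∘ suc) _ F f g n) ⨾
  sym (total-++ _ (cartesianProduct (elements (E 0)) (elements (F (suc n)))) _)

-- Powers of the variable, the derivation q d/dq, and linear differential equations

-- Makes integers the coefficients of the ring solver for series, so that it can compute with
-- constants such as 35 or 2368.
const-homomorphism : CommutativeRing.rawRing ℤ.+-*-commutativeRing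
                     -Raw-AlmostCommutative⟶ fromCommutativeRing seriesRing
const-homomorphism = record
  { ⟦_⟧    = const
  ; +-homo = λ { a b zero → refl ; a b (suc n) → refl }
  ; *-homo = λ a b n → sym (const-⊛ a (const b) n ⨾ product a b n)
  ; -‿homo = λ { a zero → refl ; a (suc n) → refl }
  ; 0-homo = λ { zero → refl ; (suc n) → refl }
  ; 1-homo = λ _ → refl
  }
  where
  product : ∀ a b → a ∙ const b ≋ const (a ℤ.* b)
  product a b zero    = refl
  product a b (suc n) = ℤ.*-zeroʳ a

const≟ : ∀ a b → Maybe (const a ≋ const b)
const≟ a b with a ℤ.≟ b
... | yes refl = just (λ _ → refl)
... | no _     = nothing

open import Algebra.Solver.Ring _ _ const-homomorphism const≟
  using (solve; con; _:+_; _:*_; _:-_; :-_; _:^_; _:=_)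
open import Algebra.Properties.Semiring.Exp (CommutativeRing.semiring seriesRing)
  using (_^_; ^-congˡ; ^-homo-*)

≋-refl : ∀ {f} → f ≋ f
≋-refl _ = refl

module ≋-Reasoning where
  open import Relation.Binary.Reasoning.Setoid (CommutativeRing.setoid seriesRing) public

⊕-cong : ∀ {f f′ g g′} → f ≋ f′ → g ≋ g′ → f ⊕ g ≋ f′ ⊕ g′
⊕-cong p q n = cong₂ ℤ._+_ (p n) (q n)

X : Series
X zero    = 0ℤ
X (suc n) = const 1ℤ n

X-⊛ : ∀ f n → (X ⊛ f) (suc n) ≡ f n
X-⊛ f n = ℤ.+-identityˡ _ ⨾ ⊛-identityˡ f n

⊛-split : ∀ f g → f ⊛ g ≋ f 0 ∙ g ⊕ X ⊛ (tail f ⊛ g)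
⊛-split f g zero    = sym (ℤ.+-identityʳ _)
⊛-split f g (suc n) = +-congˡ (f 0 ℤ.* g (suc n)) (sym (X-⊛ (tail f ⊛ g) n))

split : ∀ f → f ≋ const (f 0) ⊕ X ⊛ tail f
split f zero    = sym (ℤ.+-identityʳ _)
split f (suc n) = sym (ℤ.+-identityˡ _ ⨾ X-⊛ (tail f) n)

X^-⊛-< : ∀ m f {n} → n ℕ.< m → (X ^ m ⊛ f) n ≡ 0ℤ
X^-⊛-< (suc m) f {zero}  _         = refl
X^-⊛-< (suc m) f {suc n} (s≤s n<m) =
  ⊛-assoc X (X ^ m) f (suc n) ⨾ X-⊛ (X ^ m ⊛ f) n ⨾ X^-⊛-< m f n<m

X^-⊛-+ : ∀ m f n → (X ^ m ⊛ f) (m ℕ.+ n) ≡ f n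
X^-⊛-+ zero    f n = ⊛-identityˡ f n
X^-⊛-+ (suc m) f n =
  ⊛-assoc X (X ^ m) f (suc m ℕ.+ n) ⨾ X-⊛ (X ^ m ⊛ f) (m ℕ.+ n) ⨾ X^-⊛-+ m f n

∂ : Series → Series
∂ f n = + n ℤ.* f n

∂-⊛ : ∀ f g → ∂ (f ⊛ g) ≋ ∂ f ⊛ g ⊕ f ⊛ ∂ g
∂-⊛ f g zero    = sym (trans (ℤ.+-identityˡ _) (ℤ.*-zeroʳ (f 0)))
∂-⊛ f g (suc n) = begin
  + suc n ℤ.* (f 0 ℤ.* g (suc n) ℤ.+ (tail f ⊛ g) n)
    ≡⟨ rearrange (+ n) (f 0) (g (suc n)) _ ⟩
  f 0 ℤ.* (+ suc n ℤ.* g (suc n)) ℤ.+ (tail f ⊛ g) n ℤ.+ ∂ (tail f ⊛ g) n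
    ≡⟨ +-congˡ (f 0 ℤ.* (+ suc n ℤ.* g (suc n)) ℤ.+ (tail f ⊛ g) n) (∂-⊛ (tail f) g n) ⟩
  f 0 ℤ.* (+ suc n ℤ.* g (suc n)) ℤ.+ (tail f ⊛ g) n ℤ.+ ((∂ (tail f) ⊛ g) n ℤ.+ (tail f ⊛ ∂ g) n)
    ≡⟨ regroup (f 0 ℤ.* (+ suc n ℤ.* g (suc n))) _ _ _ ⟩
  ((tail f ⊛ g) n ℤ.+ (∂ (tail f) ⊛ g) n) ℤ.+ (f ⊛ ∂ g) (suc n)
    ≡⟨ cong (ℤ._+ (f ⊛ ∂ g) (suc n)) (⊛-distribʳ g (tail f) (∂ (tail f)) n) ⟨
  ((tail f ⊕ ∂ (tail f)) ⊛ g) n ℤ.+ (f ⊛ ∂ g) (suc n)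
    ≡⟨ cong (ℤ._+ (f ⊛ ∂ g) (suc n)) (⊛-cong {g = g} tail-∂ ≋-refl n ⨾ sym (ℤ.+-identityˡ _)) ⟩
  (∂ f ⊛ g) (suc n) ℤ.+ (f ⊛ ∂ g) (suc n) ∎
  where
  open ≡-Reasoning
  rearrange : ∀ m a b c → (1ℤ ℤ.+ m) ℤ.* (a ℤ.* b ℤ.+ c) ≡
                          a ℤ.* ((1ℤ ℤ.+ m) ℤ.* b) ℤ.+ c ℤ.+ m ℤ.* c
  rearrange = solve-∀
  regroup : ∀ a b c d → a ℤ.+ b ℤ.+ (c ℤ.+ d) ≡ b ℤ.+ c ℤ.+ (a ℤ.+ d)
  regroup = solve-∀
  tail-∂ : tail f ⊕ ∂ (tail f) ≋ tail (∂ f)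
  tail-∂ m = distrib (+ m) (f (suc m))
    where
    distrib : ∀ m a → a ℤ.+ m ℤ.* a ≡ (1ℤ ℤ.+ m) ℤ.* a
    distrib = solve-∀

-- The power rule multiplied by f, which avoids the exponent n - 1. For n = 4 and f = ψ it is the
-- differential equation of ψ⁴.
∂-^ : ∀ f n → f ⊛ ∂ (f ^ n) ≋ const (+ n) ⊛ (∂ f ⊛ f ^ n)
∂-^ f zero    n = ⊛-comm f (∂ (const 1ℤ)) n ⨾ ⊛-vanishˡ f ∂-const n ⨾
  sym (⊛-vanishˡ (∂ f ⊛ const 1ℤ) (λ { zero → refl ; (suc _) → refl }) n)
  where
  ∂-const : ∀ m → ∂ (const 1ℤ) m ≡ 0ℤ
  ∂-const zero    = refl
  ∂-const (suc m) = ℤ.*-zeroʳ (+ suc m)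
∂-^ f (suc n) = begin
  f ⊛ ∂ (f ⊛ f ^ n)                                 ≈⟨ ⊛-cong {f = f} ≋-refl (∂-⊛ f (f ^ n)) ⟩
  f ⊛ (∂ f ⊛ f ^ n ⊕ f ⊛ ∂ (f ^ n))
    ≈⟨ ⊛-cong {f = f} ≋-refl (⊕-cong {f = ∂ f ⊛ f ^ n} ≋-refl (∂-^ f n)) ⟩
  f ⊛ (∂ f ⊛ f ^ n ⊕ const (+ n) ⊛ (∂ f ⊛ f ^ n))
    ≈⟨ solve 4 (λ f f′ g c → f :* (f′ :* g :+ c :* (f′ :* g)) :=
                             (con 1ℤ :+ c) :* (f′ :* (f :* g)))
             ≋-refl f (∂ f) (f ^ n) (const (+ n)) ⟩
  (const 1ℤ ⊕ const (+ n)) ⊛ (∂ f ⊛ f ^ suc n)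
    ≈⟨ ⊛-cong {g = ∂ f ⊛ f ^ suc n} (λ { zero → refl ; (suc _) → refl }) ≋-refl ⟩
  const (+ suc n) ⊛ (∂ f ⊛ f ^ suc n)               ∎
  where open ≋-Reasoning

prefix-induction : ∀ {f : Series} → f 0 ≡ 0ℤ →
  (∀ n → (∀ m → m ℕ.≤ n → f m ≡ 0ℤ) → f (suc n) ≡ 0ℤ) → ∀ n → f n ≡ 0ℤ
prefix-induction {f} base step n = go n n ℕ.≤-refl
  where
  go : ∀ n m → m ℕ.≤ n → f m ≡ 0ℤ
  go zero    zero    _   = base
  go (suc n) m       m≤n with ℕ.m≤n⇒m<n∨m≡n m≤n
  ... | inj₁ (s≤s m≤n) = go n m m≤n
  ... | inj₂ refl      = step n (go n)

-- Since u has constant term 1 and v has constant term 0, the coefficient of index n + 1 expresses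
-- (n + 1) f (n + 1) through earlier coefficients of f, and n + 1 can be cancelled in ℤ.
linear-ode-zero : ∀ u v {f} → u 0 ≡ 1ℤ → v 0 ≡ 0ℤ → f 0 ≡ 0ℤ → u ⊛ ∂ f ≋ v ⊛ f → ∀ n → f n ≡ 0ℤ
linear-ode-zero u v {f} u₀ v₀ f₀ ode = prefix-induction f₀ step
  where
  step : ∀ n → (∀ m → m ℕ.≤ n → f m ≡ 0ℤ) → f (suc n) ≡ 0ℤ
  step n below = ℤ.*-cancelˡ-≡ (+ suc n) (f (suc n)) 0ℤ (begin
    + suc n ℤ.* f (suc n)                            ≡⟨ ℤ.*-identityˡ _ ⟨
    1ℤ ℤ.* (+ suc n ℤ.* f (suc n))                   ≡⟨ cong (ℤ._* (+ suc n ℤ.* f (suc n))) u₀ ⟨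
    u 0 ℤ.* ∂ f (suc n)                              ≡⟨ ℤ.+-identityʳ _ ⟨
    u 0 ℤ.* ∂ f (suc n) ℤ.+ 0ℤ
      ≡⟨ +-congˡ (u 0 ℤ.* ∂ f (suc n)) (⊛-vanishʳ (tail u) n ∂below) ⟨
    (u ⊛ ∂ f) (suc n)                                ≡⟨ ode (suc n) ⟩
    v 0 ℤ.* f (suc n) ℤ.+ (tail v ⊛ f) n
      ≡⟨ cong₂ ℤ._+_ (cong (ℤ._* f (suc n)) v₀) (⊛-vanishʳ (tail v) n below) ⟩
    0ℤ                                               ≡⟨ ℤ.*-zeroʳ (+ suc n) ⟨
    + suc n ℤ.* 0ℤ                                   ∎)
    where
    open ≡-Reasoning
    ∂below : ∀ m → m ℕ.≤ n → ∂ f m ≡ 0ℤ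
    ∂below m m≤n = trans (cong (+ m ℤ.*_) (below m m≤n)) (ℤ.*-zeroʳ (+ m))

infixl 6 _⊖_
_⊖_ : Series → Series → Series
f ⊖ g = f ⊕ neg g

⊖-zero : ∀ f g → (∀ n → (f ⊖ g) n ≡ 0ℤ) → f ≋ g
⊖-zero f g z n = ℤ.i-j≡0⇒i≡j (f n) (g n) (z n)

linear-ode-unique : ∀ u v {f g} → u 0 ≡ 1ℤ → v 0 ≡ 0ℤ → f 0 ≡ g 0 →
  u ⊛ ∂ f ≋ v ⊛ f → u ⊛ ∂ g ≋ v ⊛ g → f ≋ g
linear-ode-unique u v {f} {g} u₀ v₀ f₀≡g₀ odef odeg =
  ⊖-zero f g (linear-ode-zero u v u₀ v₀ (ℤ.i≡j⇒i-j≡0 f₀≡g₀) ode)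
  where
  open ≋-Reasoning
  ∂-⊖ : ∂ (f ⊖ g) ≋ ∂ f ⊖ ∂ g
  ∂-⊖ n = distrib (+ n) (f n) (g n)
    where
    distrib : ∀ m a b → m ℤ.* (a ℤ.- b) ≡ m ℤ.* a ℤ.- m ℤ.* b
    distrib = solve-∀
  ode : u ⊛ ∂ (f ⊖ g) ≋ v ⊛ (f ⊖ g)
  ode = begin
    u ⊛ ∂ (f ⊖ g)            ≈⟨ ⊛-cong {f = u} ≋-refl ∂-⊖ ⟩
    u ⊛ (∂ f ⊖ ∂ g)          ≈⟨ solve 3 (λ u a b → u :* (a :- b) := u :* a :- u :* b) ≋-refl u (∂ f) (∂ g) ⟩
    (u ⊛ ∂ f) ⊖ (u ⊛ ∂ g)    ≈⟨ (λ n → cong₂ ℤ._-_ (odef n) (odeg n)) ⟩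
    (v ⊛ f) ⊖ (v ⊛ g)        ≈⟨ solve 3 (λ u a b → u :* a :- u :* b := u :* (a :- b)) ≋-refl v f g ⟩
    v ⊛ (f ⊖ g)              ∎

⊛-cancelˡ : ∀ u {f g} → u 0 ≡ 1ℤ → u ⊛ f ≋ u ⊛ g → f ≋ g
⊛-cancelˡ u {f} {g} u₀ eq = ⊖-zero f g (prefix-induction (unit 0 ⨾ difference 0) step)
  where
  difference : ∀ n → (u ⊛ (f ⊖ g)) n ≡ 0ℤ
  difference n = solve 3 (λ u a b → u :* (a :- b) := u :* a :- u :* b) ≋-refl u f g n ⨾
                 ℤ.i≡j⇒i-j≡0 (eq n)
  unit : ∀ n → (f ⊖ g) n ≡ u 0 ℤ.* (f ⊖ g) n
  unit n = sym (ℤ.*-identityˡ _) ⨾ cong (ℤ._* (f ⊖ g) n) (sym u₀)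
  step : ∀ n → (∀ m → m ℕ.≤ n → (f ⊖ g) m ≡ 0ℤ) → (f ⊖ g) (suc n) ≡ 0ℤ
  step n below = unit (suc n) ⨾ sym (ℤ.+-identityʳ _) ⨾
    +-congˡ (u 0 ℤ.* (f ⊖ g) (suc n)) (sym (⊛-vanishʳ (tail u) n below)) ⨾ difference (suc n)

-- The substitution q ↦ − q and dissection modulo 2

twist : Series → Series
twist f n = -1ℤ ℤ.^ n ℤ.* f n

twist-⊛ : ∀ f g → twist (f ⊛ g) ≋ twist f ⊛ twist g
twist-⊛ f g zero    = rearrange (f 0) (g 0)
  where
  rearrange : ∀ a b → 1ℤ ℤ.* (a ℤ.* b) ≡ (1ℤ ℤ.* a) ℤ.* (1ℤ ℤ.* b)
  rearrange = solve-∀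
twist-⊛ f g (suc n) = begin
  -1ℤ ℤ.* s ℤ.* (f 0 ℤ.* g (suc n) ℤ.+ (tail f ⊛ g) n)
    ≡⟨ rearrange s (f 0) (g (suc n)) _ ⟩
  (1ℤ ℤ.* f 0) ℤ.* (-1ℤ ℤ.* s ℤ.* g (suc n)) ℤ.+ -1ℤ ℤ.* (s ℤ.* (tail f ⊛ g) n)
    ≡⟨ +-congˡ ((1ℤ ℤ.* f 0) ℤ.* (-1ℤ ℤ.* s ℤ.* g (suc n)))
         (cong (-1ℤ ℤ.*_) (twist-⊛ (tail f) g n) ⨾ sym (∙-⊛ -1ℤ (twist (tail f)) (twist g) n) ⨾
          ⊛-cong {g = twist g} (λ m → sym (ℤ.*-assoc -1ℤ (-1ℤ ℤ.^ m) (f (suc m)))) ≋-refl n) ⟩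
  (twist f ⊛ twist g) (suc n) ∎
  where
  open ≡-Reasoning
  s = -1ℤ ℤ.^ n
  rearrange : ∀ s a b c → -1ℤ ℤ.* s ℤ.* (a ℤ.* b ℤ.+ c) ≡
                          (1ℤ ℤ.* a) ℤ.* (-1ℤ ℤ.* s ℤ.* b) ℤ.+ -1ℤ ℤ.* (s ℤ.* c)
  rearrange = solve-∀

twist-const : ∀ c → twist (const c) ≋ const c
twist-const c zero    = ℤ.*-identityˡ c
twist-const c (suc n) = ℤ.*-zeroʳ (-1ℤ ℤ.^ suc n)

twist-^ : ∀ f n → twist (f ^ n) ≋ twist f ^ n
twist-^ f zero    = twist-const 1ℤ
twist-^ f (suc n) m = twist-⊛ f (f ^ n) m ⨾ ⊛-cong {f = twist f} ≋-refl (twist-^ f n) m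

twist-⊕ : ∀ f g → twist (f ⊕ g) ≋ twist f ⊕ twist g
twist-⊕ f g n = ℤ.*-distribˡ-+ (-1ℤ ℤ.^ n) (f n) (g n)

twist-X : twist X ≋ neg X
twist-X zero          = refl
twist-X (suc zero)    = refl
twist-X (suc (suc n)) = ℤ.*-zeroʳ (-1ℤ ℤ.^ suc (suc n))

double : ℕ → ℕ
double zero    = zero
double (suc n) = suc (suc (double n))

parity : ∀ n → (∃ λ m → n ≡ double m) ⊎ (∃ λ m → n ≡ suc (double m))
parity zero    = inj₁ (zero , refl)
parity (suc n) with parity n
... | inj₁ (m , refl) = inj₂ (m , refl)
... | inj₂ (m , refl) = inj₁ (suc m , refl)

-- `D₂ f` is f(q²), and f(q) = `even f`(q²) + q · `odd f`(q²).
even odd D₂ : Series → Series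
even f n = f (double n)
odd  f n = f (suc (double n))
D₂ f zero          = f 0
D₂ f (suc zero)    = 0ℤ
D₂ f (suc (suc n)) = D₂ (tail f) n

even-D₂ : ∀ f → even (D₂ f) ≋ f
even-D₂ f zero    = refl
even-D₂ f (suc n) = even-D₂ (tail f) n

odd-D₂ : ∀ f n → odd (D₂ f) n ≡ 0ℤ
odd-D₂ f zero    = refl
odd-D₂ f (suc n) = odd-D₂ (tail f) n

bisect : ∀ {f g} → even f ≋ even g → odd f ≋ odd g → f ≋ g
bisect evens odds n with parity n
... | inj₁ (m , refl) = evens m
... | inj₂ (m , refl) = odds m

odd-X : ∀ f → odd (X ⊛ f) ≋ even f
odd-X f n = X-⊛ f (double n)

even-X : ∀ f → even (X ⊛ f) ≋ X ⊛ odd f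
even-X f zero    = refl
even-X f (suc n) = X-⊛ f (suc (double n)) ⨾ sym (X-⊛ (odd f) n)

mutual
  -- The two odd halves contribute q · q = q², which is `X` after halving exponents. Peeling one
  -- coefficient off f exchanges its halves, whence the mutual induction with `odd-⊛`.
  even-⊛ : ∀ f g → even (f ⊛ g) ≋ even f ⊛ even g ⊕ X ⊛ (odd f ⊛ odd g)
  even-⊛ f g zero    = sym (ℤ.+-identityʳ _)
  even-⊛ f g (suc n) = begin
    f 0 ℤ.* even g (suc n) ℤ.+ odd (tail f ⊛ g) n
      ≡⟨ +-congˡ (f 0 ℤ.* even g (suc n)) (odd-⊛ (tail f) g n) ⟩
    f 0 ℤ.* even g (suc n) ℤ.+ ((odd f ⊛ odd g) n ℤ.+ (tail (even f) ⊛ even g) n)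
      ≡⟨ rearrange (f 0 ℤ.* even g (suc n)) _ _ ⟩
    (even f ⊛ even g) (suc n) ℤ.+ (odd f ⊛ odd g) n
      ≡⟨ +-congˡ ((even f ⊛ even g) (suc n)) (X-⊛ (odd f ⊛ odd g) n) ⟨
    (even f ⊛ even g ⊕ X ⊛ (odd f ⊛ odd g)) (suc n) ∎
    where
    open ≡-Reasoning
    rearrange : ∀ a b c → a ℤ.+ (b ℤ.+ c) ≡ (a ℤ.+ c) ℤ.+ b
    rearrange = solve-∀

  odd-⊛ : ∀ f g → odd (f ⊛ g) ≋ even f ⊛ odd g ⊕ odd f ⊛ even g
  odd-⊛ f g zero    = refl
  odd-⊛ f g (suc n) = begin
    f 0 ℤ.* odd g (suc n) ℤ.+ even (tail f ⊛ g) (suc n)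
      ≡⟨ +-congˡ (f 0 ℤ.* odd g (suc n)) (even-⊛ (tail f) g (suc n)) ⟩
    f 0 ℤ.* odd g (suc n) ℤ.+
      ((odd f ⊛ even g) (suc n) ℤ.+ (X ⊛ (tail (even f) ⊛ odd g)) (suc n))
      ≡⟨ rearrange (f 0 ℤ.* odd g (suc n)) _ _ ⟩
    f 0 ℤ.* odd g (suc n) ℤ.+ (X ⊛ (tail (even f) ⊛ odd g)) (suc n) ℤ.+ (odd f ⊛ even g) (suc n)
      ≡⟨ cong (ℤ._+ (odd f ⊛ even g) (suc n)) (⊛-split (even f) (odd g) (suc n)) ⟨
    (even f ⊛ odd g) (suc n) ℤ.+ (odd f ⊛ even g) (suc n) ∎
    where
    open ≡-Reasoning
    rearrange : ∀ a b c → a ℤ.+ (b ℤ.+ c) ≡ a ℤ.+ c ℤ.+ b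
    rearrange = solve-∀

D₂-⊛ : ∀ f g → D₂ (f ⊛ g) ≋ D₂ f ⊛ D₂ g
D₂-⊛ f g = bisect evens odds
  where
  evens : even (D₂ (f ⊛ g)) ≋ even (D₂ f ⊛ D₂ g)
  evens n = even-D₂ (f ⊛ g) n ⨾ sym (even-⊛ (D₂ f) (D₂ g) n ⨾
    cong₂ ℤ._+_ (⊛-cong (even-D₂ f) (even-D₂ g) n)
                (⊛-comm X (odd (D₂ f) ⊛ odd (D₂ g)) n ⨾
                 ⊛-vanishˡ X (⊛-vanishˡ (odd (D₂ g)) (odd-D₂ f)) n) ⨾ ℤ.+-identityʳ _)
  odds : odd (D₂ (f ⊛ g)) ≋ odd (D₂ f ⊛ D₂ g)
  odds n = odd-D₂ (f ⊛ g) n ⨾ sym (odd-⊛ (D₂ f) (D₂ g) n ⨾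
    cong₂ ℤ._+_ (⊛-comm (even (D₂ f)) (odd (D₂ g)) n ⨾ ⊛-vanishˡ (even (D₂ f)) (odd-D₂ g) n)
                (⊛-vanishˡ (even (D₂ g)) (odd-D₂ f) n))

D₂-const : ∀ c → D₂ (const c) ≋ const c
D₂-const c zero          = refl
D₂-const c (suc zero)    = refl
D₂-const c (suc (suc n)) = zeros (λ _ → refl) n
  where
  zeros : ∀ {f} → (∀ m → f m ≡ 0ℤ) → ∀ n → D₂ f n ≡ 0ℤ
  zeros z zero          = z 0
  zeros z (suc zero)    = refl
  zeros z (suc (suc n)) = zeros (λ m → z (suc m)) n

D₂-cong : ∀ {f g} → f ≋ g → D₂ f ≋ D₂ g
D₂-cong p zero          = p 0
D₂-cong p (suc zero)    = refl
D₂-cong p (suc (suc n)) = D₂-cong (λ m → p (suc m)) n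

D₂-^ : ∀ f n → D₂ (f ^ n) ≋ D₂ f ^ n
D₂-^ f zero    = D₂-const 1ℤ
D₂-^ f (suc n) m = D₂-⊛ f (f ^ n) m ⨾ ⊛-cong {f = D₂ f} ≋-refl (D₂-^ f n) m

odd-⊛-D₂ : ∀ f g → odd (f ⊛ D₂ g) ≋ odd f ⊛ g
odd-⊛-D₂ f g n = odd-⊛ f (D₂ g) n ⨾
  cong₂ ℤ._+_ (⊛-comm (even f) (odd (D₂ g)) n ⨾ ⊛-vanishˡ (even f) (odd-D₂ g) n)
              (⊛-cong {f = odd f} ≋-refl (even-D₂ g) n) ⨾
  ℤ.+-identityˡ _

even-⊛-D₂ : ∀ f g → even (f ⊛ D₂ g) ≋ even f ⊛ g
even-⊛-D₂ f g n = even-⊛ f (D₂ g) n ⨾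
  cong₂ ℤ._+_ (⊛-cong {f = even f} ≋-refl (even-D₂ g) n)
              (⊛-comm X (odd f ⊛ odd (D₂ g)) n ⨾
                 ⊛-vanishˡ X (λ m → ⊛-comm (odd f) (odd (D₂ g)) m ⨾ ⊛-vanishˡ (odd f) (odd-D₂ g) m) n) ⨾
  ℤ.+-identityʳ _

⊛-congʳ : ∀ f {g h} → g ≋ h → f ⊛ g ≋ f ⊛ h
⊛-congʳ f = ⊛-cong {f = f} ≋-refl

const-⊛-cancel : ∀ c .{{_ : ℤ.NonZero c}} {f g} → const c ⊛ f ≋ const c ⊛ g → f ≋ g
const-⊛-cancel c {f} {g} eq n =
  ℤ.*-cancelˡ-≡ c (f n) (g n) (sym (const-⊛ c f n) ⨾ eq n ⨾ const-⊛ c g n)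

D₂-monomial : ∀ c f i g j → D₂ (const c ⊛ (f ^ i ⊛ g ^ j)) ≋ const c ⊛ (D₂ f ^ i ⊛ D₂ g ^ j)
D₂-monomial c f i g j = begin
  D₂ (const c ⊛ (f ^ i ⊛ g ^ j))            ≈⟨ D₂-⊛ (const c) (f ^ i ⊛ g ^ j) ⟩
  D₂ (const c) ⊛ D₂ (f ^ i ⊛ g ^ j)         ≈⟨ ⊛-cong (D₂-const c) (D₂-⊛ (f ^ i) (g ^ j)) ⟩
  const c ⊛ (D₂ (f ^ i) ⊛ D₂ (g ^ j))       ≈⟨ ⊛-congʳ (const c) (⊛-cong (D₂-^ f i) (D₂-^ g j)) ⟩
  const c ⊛ (D₂ f ^ i ⊛ D₂ g ^ j)           ∎
  where open ≋-Reasoning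

D₂-scale : ∀ c f → D₂ (const c ⊛ f) ≋ const c ⊛ D₂ f
D₂-scale c f n = D₂-⊛ (const c) f n ⨾ ⊛-cong {g = D₂ f} (D₂-const c) ≋-refl n

even-⊛′ : ∀ f g {fₑ fₒ gₑ gₒ} → even f ≋ fₑ → odd f ≋ fₒ → even g ≋ gₑ → odd g ≋ gₒ →
  even (f ⊛ g) ≋ fₑ ⊛ gₑ ⊕ X ⊛ (fₒ ⊛ gₒ)
even-⊛′ f g p q r s n = even-⊛ f g n ⨾ cong₂ ℤ._+_ (⊛-cong p r n) (⊛-congʳ X (⊛-cong q s) n)

odd-⊛′ : ∀ f g {fₑ fₒ gₑ gₒ} → even f ≋ fₑ → odd f ≋ fₒ → even g ≋ gₑ → odd g ≋ gₒ →
  odd (f ⊛ g) ≋ fₑ ⊛ gₒ ⊕ fₒ ⊛ gₑ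
odd-⊛′ f g p q r s n = odd-⊛ f g n ⨾ cong₂ ℤ._+_ (⊛-cong p s n) (⊛-cong q r n)

-- Dissections of θ², θ⁴ and θ⁷

module ThetaDissection (θ ψ : Series)
  (even-θ : even θ ≋ D₂ θ) (odd-θ : odd θ ≋ const (+ 2) ⊛ D₂ (D₂ ψ))
  (even-θ² : even (θ ⊛ θ) ≋ θ ⊛ θ) where

  private
    E O Ω ω q : Series
    E = D₂ θ
    O = const (+ 2) ⊛ D₂ (D₂ ψ)
    Ω = const (+ 2) ⊛ D₂ ψ
    ω = const (+ 2) ⊛ ψ
    q = θ ⊛ θ

    O≋D₂Ω : O ≋ D₂ Ω
    O≋D₂Ω n = sym (D₂-scale (+ 2) (D₂ ψ) n)

    Ω≋D₂ω : Ω ≋ D₂ ω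
    Ω≋D₂ω n = sym (D₂-scale (+ 2) ψ n)

    -- As θ² is its own even half, its odd half can be read off at the indices 2 (2 n + 1). There E²
    -- drops out, being a series in q², and X O² leaves the even half of O², which is Ω² because O =
    -- Ω(q²).
    odd-q : odd q ≋ const (+ 4) ⊛ (D₂ ψ ⊛ D₂ ψ)
    odd-q n = begin
      odd q n                                        ≡⟨ even-θ² (suc (double n)) ⟨
      odd (even q) n                                 ≡⟨ even-⊛′ θ θ even-θ odd-θ even-θ odd-θ (suc (double n)) ⟩
      odd (E ⊛ E) n ℤ.+ odd (X ⊛ (O ⊛ O)) n
        ≡⟨ cong₂ ℤ._+_ (odd-⊛-D₂ E θ n ⨾ ⊛-vanishˡ θ (odd-D₂ θ) n) (odd-X (O ⊛ O) n) ⟩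
      0ℤ ℤ.+ even (O ⊛ O) n                          ≡⟨ ℤ.+-identityˡ _ ⟩
      even (O ⊛ O) n                                 ≡⟨ ⊛-cong O≋D₂Ω O≋D₂Ω (double n) ⟩
      even (D₂ Ω ⊛ D₂ Ω) n                           ≡⟨ even-⊛-D₂ (D₂ Ω) Ω n ⟩
      (even (D₂ Ω) ⊛ Ω) n                            ≡⟨ ⊛-cong {g = Ω} (even-D₂ Ω) ≋-refl n ⟩
      (Ω ⊛ Ω) n
        ≡⟨ solve 1 (λ p → con (+ 2) :* p :* (con (+ 2) :* p) := con (+ 4) :* (p :* p)) ≋-refl (D₂ ψ) n ⟩
      (const (+ 4) ⊛ (D₂ ψ ⊛ D₂ ψ)) n                ∎
      where open ≡-Reasoning

  -- The odd half of θ² is 2 E O = 4 θ(q²) ψ(q⁴) by the product rule and 4 ψ(q²)² by `odd-q`.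
  -- Equating the two and undoing q ↦ q² gives the claim.
  θ⊛D₂ψ : θ ⊛ D₂ ψ ≋ ψ ⊛ ψ
  θ⊛D₂ψ = const-⊛-cancel (+ 4) (λ n → sym (even-D₂ _ n) ⨾ dilated (double n) ⨾ even-D₂ _ n)
    where
    open ≋-Reasoning
    dilated : D₂ (const (+ 4) ⊛ (θ ⊛ D₂ ψ)) ≋ D₂ (const (+ 4) ⊛ (ψ ⊛ ψ))
    dilated = begin
      D₂ (const (+ 4) ⊛ (θ ⊛ D₂ ψ))       ≈⟨ D₂-scale (+ 4) (θ ⊛ D₂ ψ) ⟩
      const (+ 4) ⊛ D₂ (θ ⊛ D₂ ψ)         ≈⟨ ⊛-congʳ (const (+ 4)) (D₂-⊛ θ (D₂ ψ)) ⟩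
      const (+ 4) ⊛ (E ⊛ D₂ (D₂ ψ))
        ≈⟨ solve 2 (λ e p → con (+ 4) :* (e :* p) := e :* (con (+ 2) :* p) :+ con (+ 2) :* p :* e)
                 ≋-refl E (D₂ (D₂ ψ)) ⟩
      E ⊛ O ⊕ O ⊛ E                       ≈⟨ odd-⊛′ θ θ even-θ odd-θ even-θ odd-θ ⟨
      odd q                               ≈⟨ odd-q ⟩
      const (+ 4) ⊛ (D₂ ψ ⊛ D₂ ψ)         ≈⟨ ⊛-congʳ (const (+ 4)) (D₂-⊛ ψ ψ) ⟨
      const (+ 4) ⊛ D₂ (ψ ⊛ ψ)            ≈⟨ D₂-scale (+ 4) (ψ ⊛ ψ) ⟨
      D₂ (const (+ 4) ⊛ (ψ ⊛ ψ))          ∎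

  -- With θ⁴ = θ² · θ² the odd half is 2 θ² · 4 ψ(q²)² = 8 (θ ψ(q²))².
  odd-θ⁴ : odd (θ ^ 4) ≋ const (+ 8) ⊛ ψ ^ 4
  odd-θ⁴ = begin
    odd (θ ^ 4)
      ≈⟨ (λ n → solve 1 (λ t → t :^ 4 := t :* t :* (t :* t)) ≋-refl θ (suc (double n))) ⟩
    odd (q ⊛ q)                                       ≈⟨ odd-⊛′ q q even-θ² odd-q even-θ² odd-q ⟩
    q ⊛ (const (+ 4) ⊛ (D₂ ψ ⊛ D₂ ψ)) ⊕ const (+ 4) ⊛ (D₂ ψ ⊛ D₂ ψ) ⊛ q
      ≈⟨ solve 2 (λ t p → t :* t :* (con (+ 4) :* (p :* p)) :+ con (+ 4) :* (p :* p) :* (t :* t)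
                       := con (+ 8) :* ((t :* p) :* (t :* p))) ≋-refl θ (D₂ ψ) ⟩
    const (+ 8) ⊛ ((θ ⊛ D₂ ψ) ⊛ (θ ⊛ D₂ ψ))           ≈⟨ ⊛-congʳ (const (+ 8)) (⊛-cong θ⊛D₂ψ θ⊛D₂ψ) ⟩
    const (+ 8) ⊛ ((ψ ⊛ ψ) ⊛ (ψ ⊛ ψ))
      ≈⟨ solve 1 (λ p → con (+ 8) :* ((p :* p) :* (p :* p)) := con (+ 8) :* p :^ 4) ≋-refl ψ ⟩
    const (+ 8) ⊛ ψ ^ 4                               ∎
    where open ≋-Reasoning

  private
    -- The terms of the seventh power of E(q²) + q O(q²) with odd powers of O; 7, 35, 21, 1 are the
    -- binomial coefficients of 7 over 1, 3, 5, 7. Since E = θ(q²) and O = Ω(q²), they are written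
    -- before the dilation, so that the next dissection can remove `D₂`.
    a₀ a₁ a₂ a₃ : Series
    a₀ = const (+ 7)  ⊛ (θ ^ 6 ⊛ Ω ^ 1)
    a₁ = const (+ 35) ⊛ (θ ^ 4 ⊛ Ω ^ 3)
    a₂ = const (+ 21) ⊛ (θ ^ 2 ⊛ Ω ^ 5)
    a₃ = const (+ 1)  ⊛ (θ ^ 0 ⊛ Ω ^ 7)

    odd-θ⁷ : odd (θ ^ 7) ≋ D₂ a₀ ⊕ X ⊛ D₂ a₁ ⊕ X ⊛ (X ⊛ D₂ a₂) ⊕ X ⊛ (X ⊛ (X ⊛ D₂ a₃))
    odd-θ⁷ = begin
      odd (θ ^ 7)
        ≈⟨ (λ n → solve 1 (λ t → t :^ 7 := (t :* t) :* (t :* t) :* (t :* t :* t)) ≋-refl θ (suc (double n))) ⟩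
      odd ((q ⊛ q) ⊛ (q ⊛ θ))                         ≈⟨ odd-⊛′ (q ⊛ q) (q ⊛ θ) e₄ o₄ e₃ o₃ ⟩
      (eq ⊛ eq ⊕ X ⊛ (oq ⊛ oq)) ⊛ (eq ⊛ O ⊕ oq ⊛ E) ⊕ (eq ⊛ oq ⊕ oq ⊛ eq) ⊛ (eq ⊛ E ⊕ X ⊛ (oq ⊛ O))
        ≈⟨ solve 3 (λ E O X → let
                       q  = E :* E :+ X :* (O :* O)
                       q′ = E :* O :+ O :* E
                     in (q :* q :+ X :* (q′ :* q′)) :* (q :* O :+ q′ :* E)
                        :+ (q :* q′ :+ q′ :* q) :* (q :* E :+ X :* (q′ :* O))
                     := con (+ 7) :* (E :^ 6 :* O :^ 1)
                        :+ X :* (con (+ 35) :* (E :^ 4 :* O :^ 3))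
                        :+ X :* (X :* (con (+ 21) :* (E :^ 2 :* O :^ 5)))
                        :+ X :* (X :* (X :* (con (+ 1) :* (E :^ 0 :* O :^ 7)))))
                 ≋-refl E O X ⟩
      const (+ 7) ⊛ (E ^ 6 ⊛ O ^ 1) ⊕ X ⊛ (const (+ 35) ⊛ (E ^ 4 ⊛ O ^ 3))
        ⊕ X ⊛ (X ⊛ (const (+ 21) ⊛ (E ^ 2 ⊛ O ^ 5)))
        ⊕ X ⊛ (X ⊛ (X ⊛ (const (+ 1) ⊛ (E ^ 0 ⊛ O ^ 7))))
        ≈⟨ ⊕-cong (⊕-cong (⊕-cong (term (+ 7) 6 1) (⊛-congʳ X (term (+ 35) 4 3)))
                          (⊛-congʳ X (⊛-congʳ X (term (+ 21) 2 5))))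
                  (⊛-congʳ X (⊛-congʳ X (⊛-congʳ X (term (+ 1) 0 7)))) ⟩
      D₂ a₀ ⊕ X ⊛ D₂ a₁ ⊕ X ⊛ (X ⊛ D₂ a₂) ⊕ X ⊛ (X ⊛ (X ⊛ D₂ a₃)) ∎
      where
      open ≋-Reasoning
      eq oq : Series
      eq = E ⊛ E ⊕ X ⊛ (O ⊛ O)
      oq = E ⊛ O ⊕ O ⊛ E
      e₂ : even q ≋ eq
      e₂ = even-⊛′ θ θ even-θ odd-θ even-θ odd-θ
      o₂ : odd q ≋ oq
      o₂ = odd-⊛′ θ θ even-θ odd-θ even-θ odd-θ
      e₄ = even-⊛′ q q e₂ o₂ e₂ o₂
      o₄ = odd-⊛′ q q e₂ o₂ e₂ o₂
      e₃ = even-⊛′ q θ e₂ o₂ even-θ odd-θ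
      o₃ = odd-⊛′ q θ e₂ o₂ even-θ odd-θ
      term : ∀ c i j → const c ⊛ (E ^ i ⊛ O ^ j) ≋ D₂ (const c ⊛ (θ ^ i ⊛ Ω ^ j))
      term c i j n = ⊛-congʳ (const c) (⊛-congʳ (E ^ i) (^-congˡ j O≋D₂Ω)) n ⨾
                     sym (D₂-monomial c θ i Ω j n)

    -- A dilated term survives in the odd half exactly when its power of `X` is odd, here 1 and 3.
    odd-odd-θ⁷ : odd (odd (θ ^ 7)) ≋ a₁ ⊕ X ⊛ a₃
    odd-odd-θ⁷ n = odd-θ⁷ (suc (double n)) ⨾
      cong₂ ℤ._+_
        (cong₂ ℤ._+_
          (cong₂ ℤ._+_ (odd-D₂ a₀ n) (odd-X (D₂ a₁) n ⨾ even-D₂ a₁ n) ⨾ ℤ.+-identityˡ (a₁ n))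
          (odd-X (X ⊛ D₂ a₂) n ⨾ even-X (D₂ a₂) n ⨾ ⊛-comm X (odd (D₂ a₂)) n ⨾
           ⊛-vanishˡ X (odd-D₂ a₂) n) ⨾ ℤ.+-identityʳ (a₁ n))
        (odd-X (X ⊛ (X ⊛ D₂ a₃)) n ⨾ even-X (X ⊛ D₂ a₃) n ⨾
         ⊛-congʳ X (λ m → odd-X (D₂ a₃) m ⨾ even-D₂ a₃ m) n)

  -- In `a₁` the factor Ω³ is a series in q² and passes out of the dissection, leaving `odd-θ⁴`: 8 ·
  -- 35 · 2³ = 2240. The term X `a₃` gives 2⁷ = 128.
  odd-odd-odd-θ⁷ : odd (odd (odd (θ ^ 7))) ≋ const (+ 2368) ⊛ ψ ^ 7
  odd-odd-odd-θ⁷ = begin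
    odd (odd (odd (θ ^ 7)))                ≈⟨ (λ n → odd-odd-θ⁷ (suc (double n))) ⟩
    odd (a₁ ⊕ X ⊛ a₃)                      ≈⟨ ⊕-cong odd-a₁ odd-X-a₃ ⟩
    const (+ 8) ⊛ ψ ^ 4 ⊛ (const (+ 35) ⊛ ω ^ 3) ⊕ ω ^ 7
      ≈⟨ solve 1 (λ p → con (+ 8) :* p :^ 4 :* (con (+ 35) :* (con (+ 2) :* p) :^ 3)
                          :+ (con (+ 2) :* p) :^ 7
                     := con (+ 2368) :* p :^ 7) ≋-refl ψ ⟩
    const (+ 2368) ⊛ ψ ^ 7                 ∎
    where
    open ≋-Reasoning
    odd-a₁ : odd a₁ ≋ const (+ 8) ⊛ ψ ^ 4 ⊛ (const (+ 35) ⊛ ω ^ 3)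
    odd-a₁ = begin
      odd a₁
        ≈⟨ (λ n → solve 3 (λ c t p → c :* (t :* p) := t :* (c :* p))
                        ≋-refl (const (+ 35)) (θ ^ 4) (Ω ^ 3) (suc (double n))) ⟩
      odd (θ ^ 4 ⊛ (const (+ 35) ⊛ Ω ^ 3))
        ≈⟨ (λ n → ⊛-congʳ (θ ^ 4) dilated (suc (double n))) ⟩
      odd (θ ^ 4 ⊛ D₂ (const (+ 35) ⊛ ω ^ 3))      ≈⟨ odd-⊛-D₂ (θ ^ 4) (const (+ 35) ⊛ ω ^ 3) ⟩
      odd (θ ^ 4) ⊛ (const (+ 35) ⊛ ω ^ 3)         ≈⟨ ⊛-cong {g = const (+ 35) ⊛ ω ^ 3} odd-θ⁴ ≋-refl ⟩
      const (+ 8) ⊛ ψ ^ 4 ⊛ (const (+ 35) ⊛ ω ^ 3) ∎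
      where
      dilated : const (+ 35) ⊛ Ω ^ 3 ≋ D₂ (const (+ 35) ⊛ ω ^ 3)
      dilated n = ⊛-congʳ (const (+ 35)) (λ m → ^-congˡ 3 Ω≋D₂ω m ⨾ sym (D₂-^ ω 3 m)) n ⨾
                  sym (D₂-scale (+ 35) (ω ^ 3) n)
    odd-X-a₃ : odd (X ⊛ a₃) ≋ ω ^ 7
    odd-X-a₃ n = odd-X a₃ n ⨾
      solve 1 (λ p → con (+ 1) :* (con (+ 1) :* p) := p) ≋-refl (Ω ^ 7) (double n) ⨾
      ^-congˡ 7 Ω≋D₂ω (double n) ⨾ sym (D₂-^ ω 7 (double n)) ⨾ even-D₂ (ω ^ 7) n

-- Congruences modulo 11

infix 4 _≅_ _≋₁₁_
infix 0 _by_
-- The quotient is explicit and the equation is solved for the left side: matching on `_ by refl`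
-- eliminates that side, and each congruence rule becomes a polynomial identity in the quotients.
record _≅_ (a b : ℤ) : Set where
  constructor _by_
  field
    quotient : ℤ
    eq       : a ≡ b ℤ.+ + 11 ℤ.* quotient

_≋₁₁_ : Series → Series → Set
f ≋₁₁ g = ∀ n → f n ≅ g n

≡⇒≅ : ∀ {a b} → a ≡ b → a ≅ b
≡⇒≅ {b = b} eq = 0ℤ by trans eq (sym (ℤ.+-identityʳ b))

≅-sym : ∀ {a b} → a ≅ b → b ≅ a
≅-sym {b = b} (q by refl) = ℤ.- q by rearrange b q
  where
  rearrange : ∀ b q → b ≡ b ℤ.+ + 11 ℤ.* q ℤ.+ + 11 ℤ.* ℤ.- q
  rearrange = solve-∀

≅-trans : ∀ {a b c} → a ≅ b → b ≅ c → a ≅ c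
≅-trans {c = c} (p by refl) (q by refl) = p ℤ.+ q by rearrange c p q
  where
  rearrange : ∀ c p q → c ℤ.+ + 11 ℤ.* q ℤ.+ + 11 ℤ.* p ≡ c ℤ.+ + 11 ℤ.* (p ℤ.+ q)
  rearrange = solve-∀

+-cong-≅ : ∀ {a b c d} → a ≅ b → c ≅ d → a ℤ.+ c ≅ b ℤ.+ d
+-cong-≅ {b = b} {d = d} (p by refl) (q by refl) = p ℤ.+ q by rearrange b d p q
  where
  rearrange : ∀ b d p q →
    b ℤ.+ + 11 ℤ.* p ℤ.+ (d ℤ.+ + 11 ℤ.* q) ≡ b ℤ.+ d ℤ.+ + 11 ℤ.* (p ℤ.+ q)
  rearrange = solve-∀

*-cong-≅ : ∀ {a b c d} → a ≅ b → c ≅ d → a ℤ.* c ≅ b ℤ.* d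
*-cong-≅ {b = b} {d = d} (p by refl) (q by refl) =
  p ℤ.* d ℤ.+ b ℤ.* q ℤ.+ + 11 ℤ.* (p ℤ.* q) by rearrange b d p q
  where
  rearrange : ∀ b d p q → (b ℤ.+ + 11 ℤ.* p) ℤ.* (d ℤ.+ + 11 ℤ.* q) ≡
    b ℤ.* d ℤ.+ + 11 ℤ.* (p ℤ.* d ℤ.+ b ℤ.* q ℤ.+ + 11 ℤ.* (p ℤ.* q))
  rearrange = solve-∀

⊛-cong₁₁ : ∀ {f f′ g g′} → f ≋₁₁ f′ → g ≋₁₁ g′ → f ⊛ g ≋₁₁ f′ ⊛ g′
⊛-cong₁₁ p q zero    = *-cong-≅ (p 0) (q 0)
⊛-cong₁₁ p q (suc n) =
  +-cong-≅ (*-cong-≅ (p 0) (q (suc n))) (⊛-cong₁₁ (λ m → p (suc m)) q n)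

-- The numbers 1, 5, 15, 30, 42 are the binomial coefficients of 11 over 1, ..., 5 divided by 11;
-- the rest follow by symmetry.
freshman : ∀ f g → (f ⊕ g) ^ 11 ≋₁₁ f ^ 11 ⊕ g ^ 11
freshman f g n = _ by
  (solve 2 (λ x y → (x :+ y) :^ 11 := x :^ 11 :+ y :^ 11 :+ con (+ 11) :* (
      x :* y :* (x :^ 9 :+ y :^ 9 :+ con (+ 5) :* (x :* y :^ 8 :+ x :^ 8 :* y)
                 :+ con (+ 15) :* (x :^ 2 :* y :^ 7 :+ x :^ 7 :* y :^ 2)
                 :+ con (+ 30) :* (x :^ 3 :* y :^ 6 :+ x :^ 6 :* y :^ 3)
                 :+ con (+ 42) :* (x :^ 4 :* y :^ 5 :+ x :^ 5 :* y :^ 4))))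
     ≋-refl f g n
   ⨾ +-congˡ ((f ^ 11 ⊕ g ^ 11) n) (const-⊛ (+ 11) _ n))

fermat : ∀ a → const (+ a) ^ 11 ≋₁₁ const (+ a)
fermat zero    n = ≡⇒≅ (solve 0 (con 0ℤ :^ 11 := con 0ℤ) ≋-refl n)
fermat (suc a) n = ≅-trans (≡⇒≅ (^-congˡ 11 1+a n)) (≅-trans (freshman (const 1ℤ) (const (+ a)) n)
  (≅-trans (+-cong-≅ (≡⇒≅ (solve 0 (con 1ℤ :^ 11 := con 1ℤ) ≋-refl n)) (fermat a n))
           (≡⇒≅ (sym (1+a n)))))
  where
  1+a : const (+ suc a) ≋ const 1ℤ ⊕ const (+ a)
  1+a zero    = refl
  1+a (suc _) = refl

-- The dilation q ↦ q¹¹ and the progression 11 n + 10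

mutual
  -- `D₁₁ f` is f(q¹¹). The counter of `gap` runs through the ten zeros between consecutive
  -- coefficients.
  D₁₁ : Series → Series
  D₁₁ f zero    = f 0
  D₁₁ f (suc n) = gap 10 f n

  gap : ℕ → Series → Series
  gap zero    f n       = D₁₁ (tail f) n
  gap (suc j) f zero    = 0ℤ
  gap (suc j) f (suc n) = gap j f n

gap≋ : ∀ j f → gap j f ≋ X ^ j ⊛ D₁₁ (tail f)
gap≋ zero    f n       = sym (⊛-identityˡ (D₁₁ (tail f)) n)
gap≋ (suc j) f zero    = refl
gap≋ (suc j) f (suc n) = gap≋ j f n ⨾ sym (X-⊛ (X ^ j ⊛ D₁₁ (tail f)) n) ⨾
  sym (⊛-assoc X (X ^ j) (D₁₁ (tail f)) (suc n))

D₁₁≋ : ∀ f → D₁₁ f ≋ const (f 0) ⊕ X ^ 11 ⊛ D₁₁ (tail f)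
D₁₁≋ f zero    = sym (ℤ.+-identityʳ _)
D₁₁≋ f (suc n) = gap≋ 10 f n ⨾ sym (X-⊛ (X ^ 10 ⊛ D₁₁ (tail f)) n) ⨾
  sym (⊛-assoc X (X ^ 10) (D₁₁ (tail f)) (suc n)) ⨾ sym (ℤ.+-identityˡ _)

D₁₁-⊛ : ∀ f g → D₁₁ f ⊛ g ≋ f 0 ∙ g ⊕ X ^ 11 ⊛ (D₁₁ (tail f) ⊛ g)
D₁₁-⊛ f g n = ⊛-cong {g = g} (D₁₁≋ f) ≋-refl n ⨾
  solve 4 (λ c x t g → (c :+ x :* t) :* g := c :* g :+ x :* (t :* g))
    ≋-refl (const (f 0)) (X ^ 11) (D₁₁ (tail f)) g n ⨾
  cong (ℤ._+ (X ^ 11 ⊛ (D₁₁ (tail f) ⊛ g)) n) (const-⊛ (f 0) g n)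

below-or-above : ∀ m n → n ℕ.< m ⊎ ∃ λ k → n ≡ m ℕ.+ k
below-or-above m n with ℕ.<-≤-connex n m
... | inj₁ n<m = inj₁ n<m
... | inj₂ m≤n = inj₂ (n ℕ.∸ m , sym (ℕ.m+[n∸m]≡n m≤n))

X^-⊛-cong₁₁ : ∀ m {f g} n → (∀ k → n ≡ m ℕ.+ k → f k ≅ g k) → (X ^ m ⊛ f) n ≅ (X ^ m ⊛ g) n
X^-⊛-cong₁₁ m {f} {g} n eq with below-or-above m n
... | inj₁ n<m        = ≡⇒≅ (X^-⊛-< m f n<m ⨾ sym (X^-⊛-< m g n<m))
... | inj₂ (k , refl) =
  ≅-trans (≡⇒≅ (X^-⊛-+ m f k)) (≅-trans (eq k refl) (≡⇒≅ (sym (X^-⊛-+ m g k))))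

+-X^-⊛-< : ∀ a m f {n} → n ℕ.< m → a ℤ.+ (X ^ m ⊛ f) n ≡ a
+-X^-⊛-< a m f n<m = +-congˡ a (X^-⊛-< m f n<m) ⨾ ℤ.+-identityʳ a

+-X^-⊛-+ : ∀ a m f n → a ℤ.+ (X ^ m ⊛ f) (m ℕ.+ n) ≡ a ℤ.+ f n
+-X^-⊛-+ a m f n = +-congˡ a (X^-⊛-+ m f n)

D₁₁-⊛-< : ∀ f g {n} → n ℕ.< 11 → (D₁₁ f ⊛ g) n ≡ f 0 ℤ.* g n
D₁₁-⊛-< f g {n} n<11 = D₁₁-⊛ f g n ⨾ +-X^-⊛-< (f 0 ℤ.* g n) 11 (D₁₁ (tail f) ⊛ g) n<11

D₁₁-⊛-+ : ∀ f g n → (D₁₁ f ⊛ g) (11 ℕ.+ n) ≡ f 0 ℤ.* g (11 ℕ.+ n) ℤ.+ (D₁₁ (tail f) ⊛ g) n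
D₁₁-⊛-+ f g n = D₁₁-⊛ f g (11 ℕ.+ n) ⨾ +-X^-⊛-+ (f 0 ℤ.* g (11 ℕ.+ n)) 11 (D₁₁ (tail f) ⊛ g) n

-- Apply `freshman` to f = f 0 + X · `tail f`: `fermat` settles the constant and induction the tail.
-- Natural coefficients are assumed because `fermat` is proved by induction on a natural number.
frobenius : ∀ f → (∀ n → ∃ λ c → f n ≡ + c) → f ^ 11 ≋₁₁ D₁₁ f
frobenius f natural n = go n f natural n ℕ.≤-refl
  where
  -- The tail is needed at index n - 11, which is not a structural descent; the bound b provides
  -- one.
  go : ∀ b f → (∀ n → ∃ λ c → f n ≡ + c) → ∀ n → n ℕ.≤ b → (f ^ 11) n ≅ D₁₁ f n
  go b f natural n n≤b =
    ≅-trans (≡⇒≅ (^-congˡ 11 (split f) n)) (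
    ≅-trans (freshman (const (f 0)) (X ⊛ tail f) n) (
    ≅-trans (+-cong-≅ head (≅-trans (≡⇒≅ (solve 2 (λ x t → (x :* t) :^ 11 := x :^ 11 :* t :^ 11)
                                       ≋-refl X (tail f) n)) shifted))
      (≡⇒≅ (sym (D₁₁≋ f n)))))
    where
    head : (const (f 0) ^ 11) n ≅ const (f 0) n
    head with f 0 | natural 0
    ... | _ | c , refl = fermat c n
    shifted : (X ^ 11 ⊛ tail f ^ 11) n ≅ (X ^ 11 ⊛ D₁₁ (tail f)) n
    shifted = X^-⊛-cong₁₁ 11 n λ { k refl → rest b k n≤b }
      where
      rest : ∀ b k → 11 ℕ.+ k ℕ.≤ b → (tail f ^ 11) k ≅ D₁₁ (tail f) k
      rest (suc b) k (s≤s 10+k≤b) =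
        go b (tail f) (λ m → natural (suc m)) k (ℕ.≤-trans (ℕ.m≤n+m k 10) 10+k≤b)

11n+10 : ℕ → ℕ
11n+10 zero    = 10
11n+10 (suc n) = 11 ℕ.+ 11n+10 n

section : Series → Series
section f n = f (11n+10 n)

-- A factor in q¹¹ shifts exponents by multiples of 11 only and so respects the residue class of 10.
-- In the base case, index 10 meets only the constant term of f.
section-D₁₁-⊛ : ∀ f g → section (D₁₁ f ⊛ g) ≋ f ⊛ section g
section-D₁₁-⊛ f g zero    = D₁₁-⊛-< f g ℕ.≤-refl
section-D₁₁-⊛ f g (suc n) =
  D₁₁-⊛-+ f g (11n+10 n) ⨾ +-congˡ (f 0 ℤ.* g (11n+10 (suc n))) (section-D₁₁-⊛ (tail f) g n)

-- P³ = P¹¹ φ⁸ because P φ = 1. Modulo 11 the factor P¹¹ is P(q¹¹), which leaves the section as P;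
-- periodicity of φ⁸ then gives P φ⁸ = φ⁷.
cube-section : ∀ {P φ} → (∀ n → ∃ λ c → P n ≡ + c) → P ⊛ φ ≋ const 1ℤ →
  section (φ ^ 8) ≋₁₁ φ ^ 8 → section (P ^ 3) ≋₁₁ φ ^ 7
cube-section {P} {φ} natural inverse periodic n =
  ≅-trans (≡⇒≅ (expand (11n+10 n))) (
  ≅-trans (⊛-cong₁₁ (frobenius P natural) (λ m → ≡⇒≅ {a = (φ ^ 8) m} refl) (11n+10 n)) (
  ≅-trans (≡⇒≅ (section-D₁₁-⊛ P (φ ^ 8) n)) (
  ≅-trans (⊛-cong₁₁ (λ m → ≡⇒≅ {a = P m} refl) periodic n) (≡⇒≅ (contract n)))))
  where
  open ≋-Reasoning
  expand : P ^ 3 ≋ P ^ 11 ⊛ φ ^ 8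
  expand = begin
    P ^ 3                         ≈⟨ solve 1 (λ p → p :^ 3 := p :^ 3 :* con 1ℤ :^ 8) ≋-refl P ⟩
    P ^ 3 ⊛ const 1ℤ ^ 8          ≈⟨ ⊛-congʳ (P ^ 3) (^-congˡ 8 inverse) ⟨
    P ^ 3 ⊛ (P ⊛ φ) ^ 8           ≈⟨ solve 2 (λ p f → p :^ 3 :* (p :* f) :^ 8 := p :^ 11 :* f :^ 8) ≋-refl P φ ⟩
    P ^ 11 ⊛ φ ^ 8                ∎
  contract : P ⊛ φ ^ 8 ≋ φ ^ 7
  contract = begin
    P ⊛ φ ^ 8           ≈⟨ solve 2 (λ p f → p :* f :^ 8 := (p :* f) :* f :^ 7) ≋-refl P φ ⟩
    (P ⊛ φ) ⊛ φ ^ 7     ≈⟨ ⊛-cong {g = φ ^ 7} inverse ≋-refl ⟩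
    const 1ℤ ⊛ φ ^ 7    ≈⟨ ⊛-identityˡ (φ ^ 7) ⟩
    φ ^ 7               ∎

-- Shanks' finite form of Gauss' identity for ψ

triangle : ℕ → ℕ
triangle zero    = zero
triangle (suc n) = suc n ℕ.+ triangle n

triangles : Series → ℕ → Series
triangles x zero    = const 0ℤ
triangles x (suc n) = triangles x n ⊕ x ^ triangle n

^-* : ∀ x y n → (x ⊛ y) ^ n ≋ x ^ n ⊛ y ^ n
^-* x y zero    = λ n → sym (⊛-identityˡ (const 1ℤ) n)
^-* x y (suc n) m = ⊛-congʳ (x ⊛ y) (^-* x y n) m ⨾
  solve 4 (λ a b c d → (a :* b) :* (c :* d) := (a :* c) :* (b :* d)) ≋-refl x y (x ^ n) (y ^ n) m

square^ : ∀ x n → (x ⊛ x) ^ n ≋ x ^ double n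
square^ x zero    = ≋-refl
square^ x (suc n) m = ⊛-congʳ (x ⊛ x) (square^ x n) m ⨾ ⊛-assoc x x (x ^ double n) m

-- The triangular number of index 2 n is n (2 n + 1).
triangle-double : ∀ x n → x ^ triangle (double n) ≋ (x ^ suc (double n)) ^ n
triangle-double x zero    = ≋-refl
triangle-double x (suc n) = begin
  x ^ (suc (suc (double n)) ℕ.+ (suc (double n) ℕ.+ triangle (double n)))
    ≈⟨ ^-homo-* x (suc (suc (double n))) _ ⟩
  x ^ suc (suc (double n)) ⊛ x ^ (suc (double n) ℕ.+ triangle (double n))
    ≈⟨ ⊛-congʳ (x ^ suc (suc (double n))) (^-homo-* x (suc (double n)) (triangle (double n))) ⟩
  x ⊛ w ⊛ (w ⊛ x ^ triangle (double n))
    ≈⟨ ⊛-congʳ (x ⊛ w) (⊛-congʳ w (triangle-double x n)) ⟩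
  x ⊛ w ⊛ (w ⊛ w ^ n)
    ≈⟨ solve 3 (λ x y wⁿ → x :* (x :* y) :* (x :* y :* wⁿ) := x :* (x :* (x :* y)) :* (y :* wⁿ))
             ≋-refl x (x ^ double n) (w ^ n) ⟩
  x ⊛ (x ⊛ w) ⊛ (x ^ double n ⊛ w ^ n)
    ≈⟨ ⊛-congʳ (x ⊛ (x ⊛ w)) (⊛-cong {g = w ^ n} (square^ x n) ≋-refl) ⟨
  x ⊛ (x ⊛ w) ⊛ ((x ⊛ x) ^ n ⊛ w ^ n)
    ≈⟨ ⊛-congʳ (x ⊛ (x ⊛ w)) (^-* (x ⊛ x) w n) ⟨
  x ⊛ (x ⊛ w) ⊛ (x ⊛ x ⊛ w) ^ n
    ≈⟨ ⊛-congʳ (x ⊛ (x ⊛ w)) (^-congˡ n (⊛-assoc x x w)) ⟩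
  (x ⊛ (x ⊛ w)) ^ suc n ∎
  where
  open ≋-Reasoning
  w = x ^ suc (double n)

-- `g n` is the product of (1 - x^(2k-1)) / (1 - x^(2k)) over 1 ≤ k ≤ n, given by its recursion with
-- denominators cleared, so that series are never divided.
module Shanks (x : Series) (x₀ : x 0 ≡ 0ℤ) (g : ℕ → Series) (g₀ : g 0 ≋ const 1ℤ)
  (g-suc : ∀ n → g (suc n) ⊛ (const 1ℤ ⊖ x ^ double (suc n)) ≋ g n ⊛ (const 1ℤ ⊖ x ^ suc (double n)))
  where

  partial : ℕ → Series → Series
  partial zero    w = const 0ℤ
  partial (suc n) w = partial n w ⊕ g n ⊛ w ^ n

  -- The q-binomial series F(w) = Σ `g s` w^s satisfies (1 - x w) F(x² w) = (1 - w) F(w). This is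
  -- the same equation for the truncated sum; the last term is the error of truncation.
  telescope : ∀ w n → partial (suc n) (x ⊛ (x ⊛ w)) ⊛ (const 1ℤ ⊖ x ⊛ w) ≋
    partial (suc n) w ⊛ (const 1ℤ ⊖ w) ⊕ g n ⊛ (const 1ℤ ⊖ x ^ suc (double n)) ⊛ w ^ suc n
  telescope w zero =
    solve 3 (λ g x w → (con 0ℤ :+ g :* con 1ℤ) :* (con 1ℤ :- x :* w) :=
                       (con 0ℤ :+ g :* con 1ℤ) :* (con 1ℤ :- w)
                       :+ g :* (con 1ℤ :- x :* con 1ℤ) :* (w :* con 1ℤ))
      ≋-refl (g 0) x w
  telescope w (suc n) = begin
    (p ⊕ g (suc n) ⊛ (x ⊛ (x ⊛ w)) ^ suc n) ⊛ (const 1ℤ ⊖ x ⊛ w)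
      ≈⟨ ⊛-distribʳ (const 1ℤ ⊖ x ⊛ w) p (g (suc n) ⊛ (x ⊛ (x ⊛ w)) ^ suc n) ⟩
    p ⊛ (const 1ℤ ⊖ x ⊛ w) ⊕ g (suc n) ⊛ (x ⊛ (x ⊛ w)) ^ suc n ⊛ (const 1ℤ ⊖ x ⊛ w)
      ≈⟨ ⊕-cong (telescope w n) (⊛-cong {g = const 1ℤ ⊖ x ⊛ w} (⊛-congʳ (g (suc n)) powers) ≋-refl) ⟩
    p′ ⊛ (const 1ℤ ⊖ w) ⊕ g n ⊛ (const 1ℤ ⊖ x ^ suc (double n)) ⊛ v
      ⊕ g (suc n) ⊛ (y ⊛ v) ⊛ (const 1ℤ ⊖ x ⊛ w)
      ≈⟨ ⊕-cong {g = g (suc n) ⊛ (y ⊛ v) ⊛ (const 1ℤ ⊖ x ⊛ w)}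
           (⊕-cong {f = p′ ⊛ (const 1ℤ ⊖ w)} ≋-refl (⊛-cong {g = v} (g-suc n) ≋-refl)) ≋-refl ⟨
    p′ ⊛ (const 1ℤ ⊖ w) ⊕ g (suc n) ⊛ (const 1ℤ ⊖ y) ⊛ v
      ⊕ g (suc n) ⊛ (y ⊛ v) ⊛ (const 1ℤ ⊖ x ⊛ w)
      ≈⟨ solve 6 (λ p g y v x w →
           p :* (con 1ℤ :- w) :+ g :* (con 1ℤ :- y) :* v :+ g :* (y :* v) :* (con 1ℤ :- x :* w) :=
           (p :+ g :* v) :* (con 1ℤ :- w) :+ g :* (con 1ℤ :- x :* y) :* (w :* v))
           ≋-refl p′ (g (suc n)) y v x w ⟩
    (p′ ⊕ g (suc n) ⊛ v) ⊛ (const 1ℤ ⊖ w) ⊕ g (suc n) ⊛ (const 1ℤ ⊖ x ⊛ y) ⊛ (w ⊛ v) ∎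
    where
    open ≋-Reasoning
    p p′ v y : Series
    p  = partial (suc n) (x ⊛ (x ⊛ w))
    p′ = partial (suc n) w
    v  = w ^ suc n
    y  = x ^ double (suc n)
    powers : (x ⊛ (x ⊛ w)) ^ suc n ≋ y ⊛ v
    powers m = ^-congˡ (suc n) (λ i → sym (⊛-assoc x x w i)) m ⨾ ^-* (x ⊛ x) w (suc n) m ⨾
               ⊛-cong {g = v} (square^ x (suc n)) ≋-refl m

  -- Induction on n. With w = x^(2n+1) the two new triangular powers are w^n and w^(n+1), and the
  -- argument of the right side moves from w to x² w, which is what `telescope` compares. The factor
  -- 1 - x w has constant term 1 and can be cancelled.
  shanks : ∀ n → g n ⊛ triangles x (double n) ≋ partial n (x ^ suc (double n))
  shanks zero m =
    ⊛-comm (g 0) (const 0ℤ) m ⨾ ⊛-vanishˡ (g 0) (λ { zero → refl ; (suc _) → refl }) m ⨾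
    sym (const-zero m)
    where
    const-zero : ∀ m → const 0ℤ m ≡ 0ℤ
    const-zero zero    = refl
    const-zero (suc _) = refl
  shanks (suc n) = ⊛-cancelˡ (const 1ℤ ⊖ x ⊛ w) constant (begin
    (const 1ℤ ⊖ x ⊛ w) ⊛ (g (suc n) ⊛ (a ⊕ x ^ triangle (double n) ⊕ x ^ triangle (suc (double n))))
      ≈⟨ ⊛-congʳ (const 1ℤ ⊖ x ⊛ w) (⊛-congʳ (g (suc n))
           (⊕-cong (⊕-cong {f = a} ≋-refl (triangle-double x n)) odd-triangle)) ⟩
    (const 1ℤ ⊖ x ⊛ w) ⊛ (g (suc n) ⊛ (a ⊕ w ^ n ⊕ w ⊛ w ^ n))
      ≈⟨ solve 5 (λ u g a v w → u :* (g :* (a :+ v :+ w :* v)) := g :* u :* (a :+ v :+ w :* v))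
           ≋-refl (const 1ℤ ⊖ x ⊛ w) (g (suc n)) a (w ^ n) w ⟩
    g (suc n) ⊛ (const 1ℤ ⊖ x ⊛ w) ⊛ (a ⊕ w ^ n ⊕ w ⊛ w ^ n)
      ≈⟨ ⊛-cong {g = a ⊕ w ^ n ⊕ w ⊛ w ^ n} (g-suc n) ≋-refl ⟩
    g n ⊛ (const 1ℤ ⊖ w) ⊛ (a ⊕ w ^ n ⊕ w ⊛ w ^ n)
      ≈⟨ solve 4 (λ g a v w → g :* (con 1ℤ :- w) :* (a :+ v :+ w :* v) :=
                              (g :* a) :* (con 1ℤ :- w) :+ g :* (con 1ℤ :- w) :* (v :+ w :* v))
           ≋-refl (g n) a (w ^ n) w ⟩
    (g n ⊛ a) ⊛ (const 1ℤ ⊖ w) ⊕ g n ⊛ (const 1ℤ ⊖ w) ⊛ (w ^ n ⊕ w ⊛ w ^ n)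
      ≈⟨ ⊕-cong {g = g n ⊛ (const 1ℤ ⊖ w) ⊛ (w ^ n ⊕ w ⊛ w ^ n)}
           (⊛-cong {g = const 1ℤ ⊖ w} (shanks n) ≋-refl) ≋-refl ⟩
    partial n w ⊛ (const 1ℤ ⊖ w) ⊕ g n ⊛ (const 1ℤ ⊖ w) ⊛ (w ^ n ⊕ w ⊛ w ^ n)
      ≈⟨ solve 4 (λ p g v w →
           p :* (con 1ℤ :- w) :+ g :* (con 1ℤ :- w) :* (v :+ w :* v) :=
           (p :+ g :* v) :* (con 1ℤ :- w) :+ g :* (con 1ℤ :- w) :* (w :* v))
           ≋-refl (partial n w) (g n) (w ^ n) w ⟩
    partial (suc n) w ⊛ (const 1ℤ ⊖ w) ⊕ g n ⊛ (const 1ℤ ⊖ w) ⊛ w ^ suc n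
      ≈⟨ telescope w n ⟨
    partial (suc n) (x ⊛ (x ⊛ w)) ⊛ (const 1ℤ ⊖ x ⊛ w)
      ≈⟨ ⊛-comm (partial (suc n) (x ⊛ (x ⊛ w))) (const 1ℤ ⊖ x ⊛ w) ⟩
    (const 1ℤ ⊖ x ⊛ w) ⊛ partial (suc n) (x ⊛ (x ⊛ w)) ∎)
    where
    open ≋-Reasoning
    w a : Series
    w = x ^ suc (double n)
    a = triangles x (double n)
    constant : (const 1ℤ ⊖ x ⊛ w) 0 ≡ 1ℤ
    constant = cong (λ z → 1ℤ ℤ.- z ℤ.* w 0) x₀
    odd-triangle : x ^ triangle (suc (double n)) ≋ w ⊛ w ^ n
    odd-triangle m = ^-homo-* x (suc (double n)) (triangle (double n)) m ⨾
                     ⊛-congʳ w (triangle-double x n) m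

  -- Modulo x ^ (2 n + 1) only the term g 0 of Shanks' sum survives.
  shanks-truncated : (∀ m f {k} → k ℕ.< m → (x ^ m ⊛ f) k ≡ 0ℤ) →
    ∀ n {k} → k ℕ.≤ double (suc n) → (g (suc n) ⊛ triangles x (double (suc n))) k ≡ const 1ℤ k
  shanks-truncated high n {k} k≤ = shanks (suc n) k ⨾ low n
    where
    w = x ^ suc (double (suc n))
    low : ∀ m → partial (suc m) w k ≡ const 1ℤ k
    low zero    = solve 1 (λ g → con 0ℤ :+ g :* con 1ℤ := g) ≋-refl (g 0) k ⨾ g₀ k
    low (suc m) = cong₂ ℤ._+_ (low m)
      (solve 3 (λ g w v → g :* (w :* v) := w :* (g :* v)) ≋-refl (g (suc m)) w (w ^ m) k ⨾
       high (suc (double (suc n))) (g (suc m) ⊛ w ^ m) (s≤s k≤)) ⨾ ℤ.+-identityʳ _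

-- Integers modulo 2 and squares modulo 8

+-double : ∀ n → + double n ≡ + 2 ℤ.* + n
+-double zero    = refl
+-double (suc n) = cong (λ z → + 2 ℤ.+ z) (+-double n) ⨾ distrib (+ n)
  where
  distrib : ∀ n → + 2 ℤ.+ + 2 ℤ.* n ≡ + 2 ℤ.* (1ℤ ℤ.+ n)
  distrib = solve-∀

+-suc-double : ∀ n → + suc (double n) ≡ 1ℤ ℤ.+ + 2 ℤ.* + n
+-suc-double n = +-congˡ 1ℤ (+-double n)

Oddℤ : ℤ → Set
Oddℤ x = ∃ λ y → x ≡ 1ℤ ℤ.+ + 2 ℤ.* y

Evenℤ : ℤ → Set
Evenℤ x = ∃ λ y → x ≡ + 2 ℤ.* y

parityℤ : ∀ x → Evenℤ x ⊎ ∃ λ t → x ≡ + suc (double t) ⊎ x ≡ -[1+ double t ]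
parityℤ (+ n) with parity n
... | inj₁ (m , refl) = inj₁ (+ m , +-double m)
... | inj₂ (m , refl) = inj₂ (m , inj₁ refl)
parityℤ -[1+ n ] with parity n
... | inj₁ (m , refl) = inj₂ (m , inj₂ refl)
... | inj₂ (m , refl) = inj₁ (-[1+ m ] , cong ℤ.-_ (+-double (suc m)) ⨾ ℤ.neg-distribʳ-* (+ 2) (+ suc m))

-[1+double] : ∀ t → -[1+ double t ] ≡ 1ℤ ℤ.+ + 2 ℤ.* -[1+ t ]
-[1+double] t = cong ℤ.-_ (+-suc-double t) ⨾ rearrange (+ t)
  where
  rearrange : ∀ t → ℤ.- (1ℤ ℤ.+ + 2 ℤ.* t) ≡ 1ℤ ℤ.+ + 2 ℤ.* ℤ.- (1ℤ ℤ.+ t)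
  rearrange = solve-∀

even-or-odd : ∀ x → Evenℤ x ⊎ Oddℤ x
even-or-odd x with parityℤ x
... | inj₁ e                   = inj₁ e
... | inj₂ (t , inj₁ refl) = inj₂ (+ t , +-suc-double t)
... | inj₂ (t , inj₂ refl) = inj₂ (-[1+ t ] , -[1+double] t)

even≢oddℤ : ∀ {a b} → + 2 ℤ.* a ≢ 1ℤ ℤ.+ + 2 ℤ.* b
even≢oddℤ {a} {b} eq = contra (ℕ.m*n≡1⇒m≡1 2 ∣ a ℤ.- b ∣ (sym (ℤ.abs-* (+ 2) (a ℤ.- b)) ⨾
  cong ∣_∣ (expand a b ⨾ cong (ℤ._- + 2 ℤ.* b) eq ⨾ collapse b)))
  where
  contra : 2 ≢ 1
  contra ()
  expand : ∀ a b → + 2 ℤ.* (a ℤ.- b) ≡ + 2 ℤ.* a ℤ.- + 2 ℤ.* b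
  expand = solve-∀
  collapse : ∀ b → 1ℤ ℤ.+ + 2 ℤ.* b ℤ.- + 2 ℤ.* b ≡ 1ℤ
  collapse = solve-∀

^2 : ∀ x → x ℤ.^ 2 ≡ x ℤ.* x
^2 x = cong (λ z → x ℤ.* z) (ℤ.*-identityʳ x)

triangle-formula : ∀ t → + 2 ℤ.* + triangle t ≡ + t ℤ.* (1ℤ ℤ.+ + t)
triangle-formula zero    = refl
triangle-formula (suc t) =
  ℤ.*-distribˡ-+ (+ 2) (+ suc t) (+ triangle t) ⨾
  +-congˡ (+ 2 ℤ.* + suc t) (triangle-formula t) ⨾ step (+ t)
  where
  step : ∀ t → + 2 ℤ.* (1ℤ ℤ.+ t) ℤ.+ t ℤ.* (1ℤ ℤ.+ t) ≡ (1ℤ ℤ.+ t) ℤ.* (1ℤ ℤ.+ (1ℤ ℤ.+ t))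
  step = solve-∀

odd-square⁺ : ∀ t → (+ suc (double t)) ℤ.^ 2 ≡ 1ℤ ℤ.+ + 8 ℤ.* + triangle t
odd-square⁺ t = ^2 (+ suc (double t)) ⨾ cong (λ z → z ℤ.* z) (+-suc-double t) ⨾ expand (+ t) ⨾
  cong (λ z → 1ℤ ℤ.+ + 4 ℤ.* z) (sym (triangle-formula t)) ⨾ collect (+ triangle t)
  where
  expand : ∀ t → (1ℤ ℤ.+ + 2 ℤ.* t) ℤ.* (1ℤ ℤ.+ + 2 ℤ.* t) ≡ 1ℤ ℤ.+ + 4 ℤ.* (t ℤ.* (1ℤ ℤ.+ t))
  expand = solve-∀
  collect : ∀ s → 1ℤ ℤ.+ + 4 ℤ.* (+ 2 ℤ.* s) ≡ 1ℤ ℤ.+ + 8 ℤ.* s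
  collect = solve-∀

odd-square⁻ : ∀ t → -[1+ double t ] ℤ.^ 2 ≡ 1ℤ ℤ.+ + 8 ℤ.* + triangle t
odd-square⁻ t = ^2 -[1+ double t ] ⨾ sym (^2 (+ suc (double t))) ⨾ odd-square⁺ t

-- The shape of x² together with the witness that the bijections need: half of x, or the t with x =
-- ± (2 t + 1).
data SquareClass (x : ℤ) : Set where
  even-square : ∀ y → x ≡ + 2 ℤ.* y → x ℤ.^ 2 ≡ + 4 ℤ.* y ℤ.^ 2 → SquareClass x
  odd-square  : ∀ t → x ≡ + suc (double t) ⊎ x ≡ -[1+ double t ] →
                x ℤ.^ 2 ≡ 1ℤ ℤ.+ + 8 ℤ.* + triangle t → SquareClass x

even-square≡ : ∀ y → (+ 2 ℤ.* y) ℤ.^ 2 ≡ + 4 ℤ.* y ℤ.^ 2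
even-square≡ y = ^2 (+ 2 ℤ.* y) ⨾ expand y ⨾ cong (λ z → + 4 ℤ.* z) (sym (^2 y))
  where
  expand : ∀ y → + 2 ℤ.* y ℤ.* (+ 2 ℤ.* y) ≡ + 4 ℤ.* (y ℤ.* y)
  expand = solve-∀

squareClass : ∀ x → SquareClass x
squareClass x with parityℤ x
... | inj₁ (y , refl)      = even-square y refl (even-square≡ y)
... | inj₂ (t , inj₁ refl) = odd-square t (inj₁ refl) (odd-square⁺ t)
... | inj₂ (t , inj₂ refl) = odd-square t (inj₂ refl) (odd-square⁻ t)

-- The theta functions θ(q) = Σ q^(x²) over x ∈ ℤ and ψ(q) = Σ q^(t(t+1)/2) over t ≥ 0

record IsRoot (n : ℕ) (x : ℤ) : Set where
  constructor root
  field square≡ : x ℤ.^ 2 ≡ + n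

squares : ∀ n → Enumeration (IsRoot n)
squares n = filterEnum (λ x → map′ root IsRoot.square≡ (x ℤ.^ 2 ℤ.≟ + n))
  (intsUpTo n) (intsUpTo-unique n) bounded
  where
  bounded : ∀ {x} → IsRoot n x → x ∈ intsUpTo n
  bounded {x} (root x²≡n) with square x
  ... | s , x²≡s , x≤s =
    intsUpTo-complete n (ℕ.≤-trans x≤s (ℕ.≤-reflexive (ℤ.+-injective (sym x²≡s ⨾ x²≡n))))

t≤triangle : ∀ t → t ℕ.≤ triangle t
t≤triangle zero    = z≤n
t≤triangle (suc t) = ℕ.m≤m+n (suc t) (triangle t)

triangulars : ∀ n → Enumeration (λ t → triangle t ≡ n)
triangulars n = filterEnum (λ t → triangle t ℕ.≟ n) (upTo (suc n)) (Unique.upTo⁺ (suc n))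
  (λ { {t} refl → ∈-upTo⁺ (s≤s (t≤triangle t)) })

θ ψ : Series
θ = gf squares (λ _ → 1ℤ)
ψ = gf triangulars (λ _ → 1ℤ)

+-double² : ∀ n → + double (double n) ≡ + 4 ℤ.* + n
+-double² n = +-double (double n) ⨾ cong (λ z → + 2 ℤ.* z) (+-double n) ⨾ sym (ℤ.*-assoc (+ 2) (+ 2) (+ n))

+-double³ : ∀ n → + double (double (double n)) ≡ + 8 ℤ.* + n
+-double³ n = +-double² (double n) ⨾ cong (λ z → + 4 ℤ.* z) (+-double n) ⨾ sym (ℤ.*-assoc (+ 4) (+ 2) (+ n))

even-even-θ : even (even θ) ≋ θ
even-even-θ n = sym (∑-bijection (squares n) (squares (double (double n))) (λ x → + 2 ℤ.* x)
  (λ {x} (root x²≡n) → root (even-square≡ x ⨾ cong (λ z → + 4 ℤ.* z) x²≡n ⨾ sym (+-double² n)))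
  (λ {x} {y} _ _ → ℤ.*-cancelˡ-≡ (+ 2) x y) onto (λ _ → refl))
  where
  onto : ∀ {x} → IsRoot (double (double n)) x → ∃ λ y → IsRoot n y × + 2 ℤ.* y ≡ x
  onto {x} (root eq) with squareClass x
  ... | even-square y refl x² =
    y , root (ℤ.*-cancelˡ-≡ (+ 4) (y ℤ.^ 2) (+ n) (sym x² ⨾ eq ⨾ +-double² n)) , refl
  ... | odd-square t _ x² =
    ⊥-elim (even≢oddℤ {+ double n} {+ 4 ℤ.* + triangle t} (sym (+-double (double n)) ⨾ sym eq ⨾ x² ⨾
      +-congˡ 1ℤ (ℤ.*-assoc (+ 2) (+ 4) (+ triangle t))))

-- The index is 4 n + 2. Here and for the indices 4 n + 3 and 8 n + 5 below, a square has the form 4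
-- y² or 1 + 8 `triangle t` and misses the residue class.
odd-even-θ : ∀ n → odd (even θ) n ≡ 0ℤ
odd-even-θ n = ∑-empty (squares (double (suc (double n)))) _ impossible
  where
  value : + double (suc (double n)) ≡ + 2 ℤ.* (1ℤ ℤ.+ + 2 ℤ.* + n)
  value = +-double (suc (double n)) ⨾ cong (λ z → + 2 ℤ.* z) (+-suc-double n)
  impossible : ∀ {x} → ¬ IsRoot (double (suc (double n))) x
  impossible {x} (root eq) with squareClass x
  ... | even-square y _ x² = even≢oddℤ {y ℤ.^ 2} {+ n}
    (ℤ.*-cancelˡ-≡ (+ 2) (+ 2 ℤ.* y ℤ.^ 2) (1ℤ ℤ.+ + 2 ℤ.* + n)
      (sym (ℤ.*-assoc (+ 2) (+ 2) (y ℤ.^ 2)) ⨾ sym x² ⨾ eq ⨾ value))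
  ... | odd-square t _ x² = even≢oddℤ {1ℤ ℤ.+ + 2 ℤ.* + n} {+ 4 ℤ.* + triangle t}
    (sym value ⨾ sym eq ⨾ x² ⨾ +-congˡ 1ℤ (ℤ.*-assoc (+ 2) (+ 4) (+ triangle t)))

even-θ : even θ ≋ D₂ θ
even-θ = bisect (λ n → even-even-θ n ⨾ sym (even-D₂ θ n)) (λ n → odd-even-θ n ⨾ sym (odd-D₂ θ n))

odd-odd-θ : ∀ n → odd (odd θ) n ≡ 0ℤ
odd-odd-θ n = ∑-empty (squares (suc (double (suc (double n))))) _ impossible
  where
  value : + suc (double (suc (double n))) ≡ 1ℤ ℤ.+ + 2 ℤ.* (1ℤ ℤ.+ + 2 ℤ.* + n)
  value = +-suc-double (suc (double n)) ⨾ cong (λ z → 1ℤ ℤ.+ + 2 ℤ.* z) (+-suc-double n)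
  impossible : ∀ {x} → ¬ IsRoot (suc (double (suc (double n)))) x
  impossible {x} (root eq) with squareClass x
  ... | even-square y _ x² = even≢oddℤ {+ 2 ℤ.* y ℤ.^ 2} {1ℤ ℤ.+ + 2 ℤ.* + n}
    (sym (ℤ.*-assoc (+ 2) (+ 2) (y ℤ.^ 2)) ⨾ sym x² ⨾ eq ⨾ value)
  ... | odd-square t _ x² = even≢oddℤ {+ 2 ℤ.* + triangle t} {+ n}
    (ℤ.*-cancelˡ-≡ (+ 2) (+ 2 ℤ.* (+ 2 ℤ.* + triangle t)) (1ℤ ℤ.+ + 2 ℤ.* + n)
      (+-cancelˡ 1ℤ (+ 2 ℤ.* (+ 2 ℤ.* (+ 2 ℤ.* + triangle t))) (+ 2 ℤ.* (1ℤ ℤ.+ + 2 ℤ.* + n))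
        (collect (+ triangle t) ⨾ sym x² ⨾ eq ⨾ value)))
    where
    collect : ∀ t → 1ℤ ℤ.+ + 2 ℤ.* (+ 2 ℤ.* (+ 2 ℤ.* t)) ≡ 1ℤ ℤ.+ + 8 ℤ.* t
    collect = solve-∀

odd-even-odd-θ : ∀ n → odd (even (odd θ)) n ≡ 0ℤ
odd-even-odd-θ n = ∑-empty (squares (suc (double (double (suc (double n)))))) _ impossible
  where
  value : + suc (double (double (suc (double n)))) ≡ 1ℤ ℤ.+ + 4 ℤ.* (1ℤ ℤ.+ + 2 ℤ.* + n)
  value = +-congˡ 1ℤ (+-double² (suc (double n))) ⨾ cong (λ z → 1ℤ ℤ.+ + 4 ℤ.* z) (+-suc-double n)
  impossible : ∀ {x} → ¬ IsRoot (suc (double (double (suc (double n))))) x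
  impossible {x} (root eq) with squareClass x
  ... | even-square y _ x² = even≢oddℤ {+ 2 ℤ.* y ℤ.^ 2} {+ 2 ℤ.* (1ℤ ℤ.+ + 2 ℤ.* + n)}
    (sym (ℤ.*-assoc (+ 2) (+ 2) (y ℤ.^ 2)) ⨾ sym x² ⨾ eq ⨾ value ⨾
     +-congˡ 1ℤ (ℤ.*-assoc (+ 2) (+ 2) (1ℤ ℤ.+ + 2 ℤ.* + n)))
  ... | odd-square t _ x² = even≢oddℤ {+ triangle t} {+ n}
    (ℤ.*-cancelˡ-≡ (+ 4) (+ 2 ℤ.* + triangle t) (1ℤ ℤ.+ + 2 ℤ.* + n)
      (+-cancelˡ 1ℤ (+ 4 ℤ.* (+ 2 ℤ.* + triangle t)) (+ 4 ℤ.* (1ℤ ℤ.+ + 2 ℤ.* + n))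
        (collect (+ triangle t) ⨾ sym x² ⨾ eq ⨾ value)))
    where
    collect : ∀ t → 1ℤ ℤ.+ + 4 ℤ.* (+ 2 ℤ.* t) ≡ 1ℤ ℤ.+ + 8 ℤ.* t
    collect = solve-∀

double-injective : ∀ {m n} → double m ≡ double n → m ≡ n
double-injective {zero}  {zero}  _  = refl
double-injective {suc m} {suc n} eq =
  cong suc (double-injective (ℕ.suc-injective (ℕ.suc-injective eq)))

-- The roots of 8 n + 1 are ± (2 t + 1) with `triangle t` equal to n; each sign contributes one copy
-- of ψ.
θ-8n+1 : ∀ n → θ (suc (double (double (double n)))) ≡ + 2 ℤ.* ψ n
θ-8n+1 n = ∑-split nonneg? E _ ⨾
  cong₂ ℤ._+_
    (sym (∑-bijection (triangulars n) (restrict nonneg? E)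
      (λ t → + suc (double t))
      (λ {t} t≡ → root (odd-square⁺ t ⨾ to t t≡) , ℤ.+≤+ z≤n)
      (λ _ _ eq → double-injective (ℕ.suc-injective (ℤ.+-injective eq))) onto⁺ (λ _ → refl)))
    (sym (∑-bijection (triangulars n) (restrict (¬? ∘ nonneg?) E)
      (λ t → -[1+ double t ])
      (λ {t} t≡ → root (odd-square⁻ t ⨾ to t t≡) , λ ())
      (λ _ _ eq → double-injective (ℤ.-[1+-injective eq)) onto⁻ (λ _ → refl))) ⨾
  twice (ψ n)
  where
  E = squares (suc (double (double (double n))))
  nonneg? = λ x → 0ℤ ℤ.≤? x
  twice : ∀ a → a ℤ.+ a ≡ + 2 ℤ.* a
  twice = solve-∀
  to : ∀ t → triangle t ≡ n → 1ℤ ℤ.+ + 8 ℤ.* + triangle t ≡ + suc (double (double (double n)))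
  to t refl = +-congˡ 1ℤ (sym (+-double³ n))
  from : ∀ x t → x ℤ.^ 2 ≡ 1ℤ ℤ.+ + 8 ℤ.* + triangle t →
         x ℤ.^ 2 ≡ + suc (double (double (double n))) → triangle t ≡ n
  from x t x² eq = ℤ.+-injective (ℤ.*-cancelˡ-≡ (+ 8) (+ triangle t) (+ n)
    (+-cancelˡ 1ℤ (+ 8 ℤ.* + triangle t) (+ 8 ℤ.* + n)
      (sym x² ⨾ eq ⨾ +-congˡ 1ℤ (+-double³ n))))
  not-even : ∀ x y → x ℤ.^ 2 ≡ + 4 ℤ.* y ℤ.^ 2 → x ℤ.^ 2 ≢ + suc (double (double (double n)))
  not-even x y x² eq = even≢oddℤ {+ 2 ℤ.* y ℤ.^ 2} {+ double (double n)}
    (sym (ℤ.*-assoc (+ 2) (+ 2) (y ℤ.^ 2)) ⨾ sym x² ⨾ eq ⨾ +-suc-double (double (double n)))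
  onto⁺ : ∀ {x} → IsRoot (suc (double (double (double n)))) x × 0ℤ ℤ.≤ x →
          ∃ λ t → triangle t ≡ n × + suc (double t) ≡ x
  onto⁺ {x} (root eq , 0≤x) with squareClass x
  ... | even-square y _ x²           = ⊥-elim (not-even x y x² eq)
  ... | odd-square t (inj₁ refl) x²  = t , from (+ suc (double t)) t x² eq , refl
  onto⁺ (_ , ()) | odd-square t (inj₂ refl) x²
  onto⁻ : ∀ {x} → IsRoot (suc (double (double (double n)))) x × ¬ (0ℤ ℤ.≤ x) →
          ∃ λ t → triangle t ≡ n × -[1+ double t ] ≡ x
  onto⁻ {x} (root eq , x<0) with squareClass x
  ... | even-square y _ x²           = ⊥-elim (not-even x y x² eq)
  ... | odd-square t (inj₁ refl) x²  = ⊥-elim (x<0 (ℤ.+≤+ z≤n))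
  ... | odd-square t (inj₂ refl) x²  = t , from -[1+ double t ] t x² eq , refl

odd-θ : odd θ ≋ const (+ 2) ⊛ D₂ (D₂ ψ)
odd-θ n = bisect {g = D₂ (D₂ 2ψ)}
  (λ n → bisect {g = D₂ 2ψ}
    (λ n → θ-8n+1 n ⨾ sym (even-D₂ 2ψ n ⨾ const-⊛ (+ 2) ψ n))
    (λ n → odd-even-odd-θ n ⨾ sym (odd-D₂ 2ψ n)) n ⨾ sym (even-D₂ (D₂ 2ψ) n))
  (λ n → odd-odd-θ n ⨾ sym (odd-D₂ (D₂ 2ψ) n)) n ⨾
  D₂-cong (D₂-scale (+ 2) ψ) n ⨾ D₂-scale (+ 2) (D₂ ψ) n
  where
  2ψ = const (+ 2) ⊛ ψ

squares-functional : ∀ {k l x} → IsRoot k x → IsRoot l x → k ≡ l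
squares-functional (root p) (root q) = ℤ.+-injective (sym p ⨾ q)

-- Representations as sums of squares

record IsSquarePair (n : ℕ) (p : ℤ × ℤ) : Set where
  constructor pair
  field sum≡ : proj₁ p ℤ.^ 2 ℤ.+ proj₂ p ℤ.^ 2 ≡ + n

squarePairs : ∀ n → Enumeration (IsSquarePair n)
squarePairs n = reindex
  (λ { (k , l , refl , root x² , root y²) → pair (cong₂ ℤ._+_ x² y²) })
  (λ { {p} (pair eq) → let k , x²≡k , _ = square (proj₁ p) ; l , y²≡l , _ = square (proj₂ p) in
     k , l , ℤ.+-injective (sym (cong₂ ℤ._+_ x²≡k y²≡l) ⨾ eq) , root x²≡k , root y²≡l })
  (convolve squares squares-functional squares n)

θ²-pairs : ∀ n → (θ ⊛ θ) n ≡ ∑ (squarePairs n) (λ _ → 1ℤ)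
θ²-pairs = gf-⊛ squares squares-functional squares (λ _ → 1ℤ) (λ _ → 1ℤ)

rotated-squares : ∀ u v → (u ℤ.+ v) ℤ.^ 2 ℤ.+ (u ℤ.- v) ℤ.^ 2 ≡ + 2 ℤ.* (u ℤ.^ 2 ℤ.+ v ℤ.^ 2)
rotated-squares u v = cong₂ ℤ._+_ (^2 (u ℤ.+ v)) (^2 (u ℤ.- v)) ⨾ expand u v ⨾
  cong (λ z → + 2 ℤ.* z) (sym (cong₂ ℤ._+_ (^2 u) (^2 v)))
  where
  expand : ∀ u v → (u ℤ.+ v) ℤ.* (u ℤ.+ v) ℤ.+ (u ℤ.- v) ℤ.* (u ℤ.- v) ≡
                   + 2 ℤ.* (u ℤ.* u ℤ.+ v ℤ.* v)
  expand = solve-∀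

-- The map (u , v) ↦ (u + v , u - v) doubles u² + v². It reaches every pair with even sum of
-- squares, because the two entries then have equal parity.
even-θ² : even (θ ⊛ θ) ≋ θ ⊛ θ
even-θ² n = θ²-pairs (double n) ⨾
  sym (∑-bijection (squarePairs n) (squarePairs (double n)) (λ (u , v) → u ℤ.+ v , u ℤ.- v)
    (λ { {u , v} (pair eq) → pair (rotated-squares u v ⨾ cong (λ z → + 2 ℤ.* z) eq ⨾ sym (+-double n)) })
    (λ _ _ → injective) onto (λ _ → refl)) ⨾
  sym (θ²-pairs n)
  where
  sum-difference : ∀ u v → (u ℤ.+ v) ℤ.+ (u ℤ.- v) ≡ + 2 ℤ.* u
  sum-difference = solve-∀
  difference-difference : ∀ u v → (u ℤ.+ v) ℤ.- (u ℤ.- v) ≡ + 2 ℤ.* v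
  difference-difference = solve-∀
  injective : ∀ {u v u′ v′} → (u ℤ.+ v , u ℤ.- v) ≡ (u′ ℤ.+ v′ , u′ ℤ.- v′) → (u , v) ≡ (u′ , v′)
  injective {u} {v} {u′} {v′} eq with ,-injective eq
  ... | s , d = cong₂ _,_
    (ℤ.*-cancelˡ-≡ (+ 2) u u′ (sym (sum-difference u v) ⨾ cong₂ ℤ._+_ s d ⨾ sum-difference u′ v′))
    (ℤ.*-cancelˡ-≡ (+ 2) v v′
      (sym (difference-difference u v) ⨾ cong₂ ℤ._-_ s d ⨾ difference-difference u′ v′))
  rotate : ∀ u v {x y} → u ℤ.+ v ≡ x → u ℤ.- v ≡ y → IsSquarePair (double n) (x , y) →
           ∃ λ p → IsSquarePair n p × (proj₁ p ℤ.+ proj₂ p , proj₁ p ℤ.- proj₂ p) ≡ (x , y)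
  rotate u v refl refl (pair eq) = (u , v) , pair
    (ℤ.*-cancelˡ-≡ (+ 2) (u ℤ.^ 2 ℤ.+ v ℤ.^ 2) (+ n) (sym (rotated-squares u v) ⨾ eq ⨾ +-double n)) , refl
  mixed : ∀ a b → (+ 2 ℤ.* a) ℤ.^ 2 ℤ.+ (1ℤ ℤ.+ + 2 ℤ.* b) ℤ.^ 2 ≢ + double n
  mixed a b eq = even≢oddℤ {+ n} {+ 2 ℤ.* a ℤ.* a ℤ.+ + 2 ℤ.* b ℤ.* b ℤ.+ + 2 ℤ.* b}
    (sym (+-double n) ⨾ sym eq ⨾ cong₂ ℤ._+_ (^2 (+ 2 ℤ.* a)) (^2 (1ℤ ℤ.+ + 2 ℤ.* b)) ⨾ expand a b)
    where
    expand : ∀ a b → + 2 ℤ.* a ℤ.* (+ 2 ℤ.* a) ℤ.+ (1ℤ ℤ.+ + 2 ℤ.* b) ℤ.* (1ℤ ℤ.+ + 2 ℤ.* b) ≡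
                     1ℤ ℤ.+ + 2 ℤ.* (+ 2 ℤ.* a ℤ.* a ℤ.+ + 2 ℤ.* b ℤ.* b ℤ.+ + 2 ℤ.* b)
    expand = solve-∀
  onto : ∀ {p} → IsSquarePair (double n) p →
         ∃ λ q → IsSquarePair n q × (proj₁ q ℤ.+ proj₂ q , proj₁ q ℤ.- proj₂ q) ≡ p
  onto {x , y} p@(pair eq) with even-or-odd x | even-or-odd y
  ... | inj₁ (a , refl) | inj₁ (b , refl) = rotate (a ℤ.+ b) (a ℤ.- b) (s a b) (d a b) p
    where
    s : ∀ a b → (a ℤ.+ b) ℤ.+ (a ℤ.- b) ≡ + 2 ℤ.* a
    s = solve-∀
    d : ∀ a b → (a ℤ.+ b) ℤ.- (a ℤ.- b) ≡ + 2 ℤ.* b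
    d = solve-∀
  ... | inj₂ (a , refl) | inj₂ (b , refl) = rotate (1ℤ ℤ.+ a ℤ.+ b) (a ℤ.- b) (s a b) (d a b) p
    where
    s : ∀ a b → (1ℤ ℤ.+ a ℤ.+ b) ℤ.+ (a ℤ.- b) ≡ 1ℤ ℤ.+ + 2 ℤ.* a
    s = solve-∀
    d : ∀ a b → (1ℤ ℤ.+ a ℤ.+ b) ℤ.- (a ℤ.- b) ≡ 1ℤ ℤ.+ + 2 ℤ.* b
    d = solve-∀
  ... | inj₁ (a , refl) | inj₂ (b , refl) = ⊥-elim (mixed a b eq)
  ... | inj₂ (a , refl) | inj₁ (b , refl) =
    ⊥-elim (mixed b a (ℤ.+-comm ((+ 2 ℤ.* b) ℤ.^ 2) ((1ℤ ℤ.+ + 2 ℤ.* a) ℤ.^ 2) ⨾ eq))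

θ^-representations : ∀ k n → (θ ^ k) n ≡ + r k n
θ^-representations zero    zero    = refl
θ^-representations zero    (suc n) =
  sym (sym (∑-count (representations 0 (suc n))) ⨾ ∑-empty (representations 0 (suc n)) (λ _ → 1ℤ) (λ { {[]} () }))
θ^-representations (suc k) n =
  ⊛-congʳ θ (λ m → θ^-representations k m ⨾ sym (∑-count (representations k m))) n ⨾
  gf-⊛ squares squares-functional (representations k) (λ _ → 1ℤ) (λ _ → 1ℤ) n ⨾
  ∑-bijection (convolve squares squares-functional (representations k) n) (representations (suc k) n)
    (λ (x , v) → x ∷ v)
    (λ { {x , v} (i , j , refl , root x² , v²) → cong₂ ℤ._+_ x² v² })
    (λ _ _ eq → cong₂ _,_ (Vec.∷-injectiveˡ eq) (Vec.∷-injectiveʳ eq))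
    (λ { {x ∷ v} eq → let i , x²≡i , _ = square x ; j , v²≡j , _ = sumOfSquares-complete v in
         (x , v) , (i , j , ℤ.+-injective (sym (cong₂ ℤ._+_ x²≡i v²≡j) ⨾ eq) , root x²≡i , v²≡j) , refl })
    (λ _ → refl) ⨾
  ∑-count (representations (suc k) n)

-- Partitions with distinct odd parts

pods : ∀ n → Enumeration (λ ps → IsPod ps × sum ps ≡ n)
pods n = filterEnum (λ ps → isPod? ps ×-dec (sum ps ℕ.≟ n)) (listsUpTo n n) (listsUpTo-unique n n)
  (λ { {ps} (((positive , _) , _) , refl) →
       listsUpTo-complete n n (length≤sum positive) (parts≤sum ps) })

podsBelow : ∀ m n → Enumeration (λ ps → (IsPod ps × sum ps ≡ n) × All (ℕ._≤ m) ps)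
podsBelow m n = restrict (all? (ℕ._≤? m)) (pods n)

pod : Series
pod = gf pods (λ _ → 1ℤ)

podBelow : ℕ → Series
podBelow m = gf (podsBelow m) (λ _ → 1ℤ)

podBelow-0 : podBelow 0 ≋ const 1ℤ
podBelow-0 zero    = refl
podBelow-0 (suc n) = ∑-empty (podsBelow 0 (suc n)) _ impossible
  where
  impossible : ∀ {ps} → ¬ ((IsPod ps × sum ps ≡ suc n) × All (ℕ._≤ 0) ps)
  impossible {[]}    ((_ , ()) , _)
  impossible {_ ∷ _} (((((0<p ∷ _) , _) , _) , _) , p≤0 ∷ _) = ℕ.<⇒≱ 0<p p≤0

podBelow-≥ : ∀ {m n} → n ℕ.≤ m → podBelow m n ≡ pod n
podBelow-≥ {m} {n} n≤m = ∑-⇔ (podsBelow m n) (pods n) proj₁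
  (λ { {ps} (isPod , refl) → (isPod , refl) , All.map (λ p≤ → ℕ.≤-trans p≤ n≤m) (parts≤sum ps) }) _

linked-cons : ∀ {m ps} → All (ℕ._≤ m) ps → Linked _≥_ ps → Linked _≥_ (m ∷ ps)
linked-cons []         []      = [-]
linked-cons (p≤m ∷ _)  linked  = p≤m ∷ linked

-- Either no part equals m + 1, or one such part is removed from the front. The bound m′ on what
-- remains is m + 1 when that part may recur and m when it may not; the last two hypotheses express
-- this choice.
podBelow-step : ∀ m m′ → m′ ℕ.≤ suc m →
  (∀ {ps} → Unique (filter odd? ps) → All (ℕ._≤ m′) ps → Unique (filter odd? (suc m ∷ ps))) →
  (∀ {ps} → Unique (filter odd? (suc m ∷ ps)) → All (ℕ._≤ suc m) ps →
            Unique (filter odd? ps) × All (ℕ._≤ m′) ps) →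
  podBelow (suc m) ≋ podBelow m ⊕ X ^ suc m ⊛ podBelow m′
podBelow-step m m′ m′≤ cons uncons n = ∑-split small? (podsBelow (suc m) n) _ ⨾
  cong₂ ℤ._+_
    (∑-⇔ (restrict small? (podsBelow (suc m) n)) (podsBelow m n)
      (λ ((isPod , _) , small) → isPod , small)
      (λ (isPod , small) → (isPod , All.map ℕ.m≤n⇒m≤1+n small) , small) _)
    largest
  where
  small? = all? (ℕ._≤? m)
  E = restrict (¬? ∘ small?) (podsBelow (suc m) n)
  largest : ∑ E (λ _ → 1ℤ) ≡ (X ^ suc m ⊛ podBelow m′) n
  largest with below-or-above (suc m) n
  ... | inj₁ (s≤s n≤m) = ∑-empty E _
      (λ { {ps} (((_ , refl) , _) , ¬small) →
           ¬small (All.map (λ p≤ → ℕ.≤-trans p≤ n≤m) (parts≤sum ps)) }) ⨾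
    sym (X^-⊛-< (suc m) (podBelow m′) (s≤s n≤m))
  ... | inj₂ (k , refl) = sym (X^-⊛-+ (suc m) (podBelow m′) k ⨾
    ∑-bijection (podsBelow m′ k) E (suc m ∷_) into (λ _ _ → ∷-injectiveʳ) onto (λ _ → refl))
    where
    into : ∀ {ps} → (IsPod ps × sum ps ≡ k) × All (ℕ._≤ m′) ps →
      ((IsPod (suc m ∷ ps) × suc m ℕ.+ sum ps ≡ suc m ℕ.+ k) × All (ℕ._≤ suc m) (suc m ∷ ps)) ×
      ¬ All (ℕ._≤ m) (suc m ∷ ps)
    into ((((positive , linked) , unique) , refl) , below) =
      ((((s≤s z≤n ∷ positive , linked-cons below′ linked) , cons unique below) , refl) ,
       ℕ.≤-refl ∷ below′) , λ { (1+m≤m ∷ _) → ℕ.1+n≰n 1+m≤m }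
      where below′ = All.map (λ p≤ → ℕ.≤-trans p≤ m′≤) below
    onto : ∀ {ps} → ((IsPod ps × sum ps ≡ suc m ℕ.+ k) × All (ℕ._≤ suc m) ps) × ¬ All (ℕ._≤ m) ps →
      ∃ λ qs → ((IsPod qs × sum qs ≡ k) × All (ℕ._≤ m′) qs) × suc m ∷ qs ≡ ps
    onto {[]} (_ , ¬small) = ⊥-elim (¬small [])
    onto {p ∷ qs} (((((_ ∷ positive , linked) , unique) , total≡) , p≤ ∷ below) , ¬small)
      with ℕ.m≤n⇒m<n∨m≡n p≤
    ... | inj₁ (s≤s p≤m) = ⊥-elim (¬small (p≤m ∷ All.map (λ q≤p → ℕ.≤-trans q≤p p≤m)
      (AllPairs.head (Linked⇒AllPairs (λ i≥j j≥k → ℕ.≤-trans j≥k i≥j) linked))))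
    ... | inj₂ refl = let unique′ , below′ = uncons unique below in
      qs , ((((positive , Linked.tail linked) , unique′) ,
        ℕ.+-cancelˡ-≡ (suc m) (sum qs) k total≡) , below′) , refl

double≡*2 : ∀ n → double n ≡ n ℕ.* 2
double≡*2 zero    = refl
double≡*2 (suc n) = cong (λ k → suc (suc k)) (double≡*2 n)

Odd-suc-double : ∀ n → Odd (suc (double n))
Odd-suc-double n 2∣ with () ← ∣1⇒≡1 (∣m+n∣m⇒∣n (subst (2 ∣_) (ℕ.+-comm 1 (double n)) 2∣)
  (divides n (double≡*2 n)))

podBelow-even : ∀ n → podBelow (double (suc n)) ≋
  podBelow (suc (double n)) ⊕ X ^ double (suc n) ⊛ podBelow (double (suc n))
podBelow-even n = podBelow-step (suc (double n)) (double (suc n)) ℕ.≤-refl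
  (λ {ps} unique _ → subst Unique (sym (skip ps)) unique)
  (λ {ps} unique below → subst Unique (skip ps) unique , below)
  where
  skip : ∀ ps → filter odd? (double (suc n) ∷ ps) ≡ filter odd? ps
  skip ps = filter-reject odd? (λ ¬even → ¬even (divides (suc n) (double≡*2 (suc n))))

podBelow-odd : ∀ n → podBelow (suc (double n)) ≋
  podBelow (double n) ⊕ X ^ suc (double n) ⊛ podBelow (double n)
podBelow-odd n = podBelow-step (double n) (double n) (ℕ.n≤1+n (double n))
  (λ {ps} unique below → subst Unique (sym (take ps))
    (All.tabulate (λ { q∈ refl → ℕ.1+n≰n (All.lookup below (proj₁ (∈-filter⁻ odd? {xs = ps} q∈))) }) ∷ unique))
  uncons
  where
  take : ∀ ps → filter odd? (suc (double n) ∷ ps) ≡ suc (double n) ∷ filter odd? ps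
  take ps = filter-accept odd? (Odd-suc-double n)
  uncons : ∀ {ps} → Unique (filter odd? (suc (double n) ∷ ps)) → All (ℕ._≤ suc (double n)) ps →
           Unique (filter odd? ps) × All (ℕ._≤ double n) ps
  uncons {ps} unique below with subst Unique (take ps) unique
  ... | fresh ∷ unique′ = unique′ , All.tabulate (λ q∈ → smaller q∈ (All.lookup below q∈))
    where
    smaller : ∀ {q} → q ∈ ps → q ℕ.≤ suc (double n) → q ℕ.≤ double n
    smaller q∈ q≤ with ℕ.m≤n⇒m<n∨m≡n q≤
    ... | inj₁ (s≤s q≤) = q≤
    ... | inj₂ refl     = ⊥-elim (All.lookup fresh (∈-filter⁺ odd? q∈ (Odd-suc-double n)) refl)

-- The generating function of pods is the inverse of ψ(- q)

φ : Series
φ = twist ψ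

-X : Series
-X = neg X

-X^double : ∀ n → -X ^ double n ≋ X ^ double n
-X^double zero    = ≋-refl
-X^double (suc n) m = solve 2 (λ x y → (:- x) :* ((:- x) :* y) := x :* (x :* y)) ≋-refl X (-X ^ double n) m ⨾
  ⊛-congʳ X (⊛-congʳ X (-X^double n)) m

podUpTo : ℕ → Series
podUpTo n = podBelow (double n)

-- An odd part contributes the factor 1 + q^(2n+1), an even one the inverse of 1 - q^(2n+2). At x =
-- - q these are the factors in the recursion that `Shanks` asks of g.
podUpTo-suc : ∀ n → podUpTo (suc n) ⊛ (const 1ℤ ⊖ -X ^ double (suc n)) ≋ podUpTo n ⊛ (const 1ℤ ⊖ -X ^ suc (double n))
podUpTo-suc n = begin
  podUpTo (suc n) ⊛ (const 1ℤ ⊖ -X ^ double (suc n))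
    ≈⟨ ⊛-congʳ (podUpTo (suc n)) (λ m → cong (λ z → const 1ℤ m ℤ.- z) (-X^double (suc n) m)) ⟩
  podUpTo (suc n) ⊛ (const 1ℤ ⊖ X ^ double (suc n))
    ≈⟨ solve 2 (λ g y → g :* (con 1ℤ :- y) := g :- y :* g) ≋-refl (podUpTo (suc n)) (X ^ double (suc n)) ⟩
  podUpTo (suc n) ⊖ X ^ double (suc n) ⊛ podUpTo (suc n)
    ≈⟨ (λ m → cong (λ z → z ℤ.- (X ^ double (suc n) ⊛ podUpTo (suc n)) m) (podBelow-even n m)) ⟩
  podBelow (suc (double n)) ⊕ X ^ double (suc n) ⊛ podUpTo (suc n) ⊖ X ^ double (suc n) ⊛ podUpTo (suc n)
    ≈⟨ solve 2 (λ a b → a :+ b :- b := a) ≋-refl (podBelow (suc (double n))) (X ^ double (suc n) ⊛ podUpTo (suc n)) ⟩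
  podBelow (suc (double n))
    ≈⟨ podBelow-odd n ⟩
  podUpTo n ⊕ X ⊛ X ^ double n ⊛ podUpTo n
    ≈⟨ solve 3 (λ g x y → g :+ x :* y :* g := g :* (con 1ℤ :- (:- x) :* y)) ≋-refl (podUpTo n) X (X ^ double n) ⟩
  podUpTo n ⊛ (const 1ℤ ⊖ -X ⊛ X ^ double n)
    ≈⟨ ⊛-congʳ (podUpTo n) (λ m → cong (λ z → const 1ℤ m ℤ.- z) (⊛-congʳ -X (-X^double n) m)) ⟨
  podUpTo n ⊛ (const 1ℤ ⊖ -X ^ suc (double n)) ∎
  where open ≋-Reasoning

X^-coefficient : ∀ t k → (X ^ triangle t) k ≡ total (λ _ → 1ℤ) (filter (λ t → triangle t ℕ.≟ k) [ t ])
X^-coefficient t k = sym (⊛-comm (X ^ m) (const 1ℤ) k ⨾ ⊛-identityˡ (X ^ m) k) ⨾ value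
  where
  m = triangle t
  P? = λ t → triangle t ℕ.≟ k
  reject : m ≢ k → 0ℤ ≡ total (λ _ → 1ℤ) (filter P? [ t ])
  reject m≢k = cong (total (λ _ → 1ℤ)) (sym (filter-reject P? {t} {[]} m≢k))
  value : (X ^ m ⊛ const 1ℤ) k ≡ total (λ _ → 1ℤ) (filter P? [ t ])
  value with below-or-above m k
  ... | inj₁ k<m            = X^-⊛-< m (const 1ℤ) k<m ⨾ reject (ℕ.<⇒≢ k<m ∘ sym)
  ... | inj₂ (zero , refl)  = X^-⊛-+ m (const 1ℤ) 0 ⨾
    cong (total (λ _ → 1ℤ)) (sym (filter-accept P? {t} {[]} (sym (ℕ.+-identityʳ m))))
  ... | inj₂ (suc j , refl) = X^-⊛-+ m (const 1ℤ) (suc j) ⨾ reject (ℕ.m≢1+m+n m ∘ (_⨾ ℕ.+-suc m j))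

triangles-coefficient : ∀ N k →
  triangles X N k ≡ total (λ _ → 1ℤ) (filter (λ t → triangle t ℕ.≟ k) (upTo N))
triangles-coefficient zero    zero    = refl
triangles-coefficient zero    (suc _) = refl
triangles-coefficient (suc N) k =
  cong₂ ℤ._+_ (triangles-coefficient N k) (X^-coefficient N k) ⨾
  sym (total-++ _ (filter P? (upTo N)) (filter P? [ N ])) ⨾
  cong (total (λ _ → 1ℤ)) (sym (filter-++ P? (upTo N) [ N ]) ⨾ cong (filter P?) (upTo-∷ʳ N))
  where
  P? = λ t → triangle t ℕ.≟ k

triangles-ψ : ∀ {N k} → k ℕ.< N → triangles X N k ≡ ψ k
triangles-ψ {N} {k} k<N = triangles-coefficient N k ⨾
  ∑-⇔ (filterEnum (λ t → triangle t ℕ.≟ k) (upTo N) (Unique.upTo⁺ N)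
        (λ { {t} refl → ∈-upTo⁺ (ℕ.≤-<-trans (t≤triangle t) k<N) }))
      (triangulars k) (λ t≡ → t≡) (λ t≡ → t≡) _

-X^ : ∀ n → -X ^ n ≋ twist (X ^ n)
-X^ n m = sym (^-congˡ n twist-X m) ⨾ sym (twist-^ X n m)

triangles-φ : ∀ {N k} → k ℕ.< N → triangles -X N k ≡ φ k
triangles-φ {N} {k} k<N = twisted N k ⨾ cong (λ z → -1ℤ ℤ.^ k ℤ.* z) (triangles-ψ k<N)
  where
  twisted : ∀ N → triangles -X N ≋ twist (triangles X N)
  twisted zero    m = sym (twist-const 0ℤ m)
  twisted (suc N) m = cong₂ ℤ._+_ (twisted N m) (-X^ (triangle N) m) ⨾
    sym (twist-⊕ (triangles X N) (X ^ triangle N) m)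

-X^-⊛-< : ∀ m f {k} → k ℕ.< m → (-X ^ m ⊛ f) k ≡ 0ℤ
-X^-⊛-< (suc m) f {k} k<1+m =
  solve 3 (λ x y f → (:- x) :* y :* f := x :* (:- (y :* f))) ≋-refl X (-X ^ m) f k ⨾ shifted k<1+m
  where
  shifted : ∀ {k} → k ℕ.< suc m → (X ⊛ neg (-X ^ m ⊛ f)) k ≡ 0ℤ
  shifted {zero}  _         = refl
  shifted {suc k} (s≤s k<m) = X-⊛ (neg (-X ^ m ⊛ f)) k ⨾ cong ℤ.-_ (-X^-⊛-< m f k<m)

⊛-cong-≤ : ∀ {f f′ g g′} n → (∀ {m} → m ℕ.≤ n → f m ≡ f′ m) → (∀ {m} → m ℕ.≤ n → g m ≡ g′ m) →
  (f ⊛ g) n ≡ (f′ ⊛ g′) n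
⊛-cong-≤ zero    p q = cong₂ ℤ._*_ (p z≤n) (q z≤n)
⊛-cong-≤ {f} {f′} (suc n) p q = cong₂ ℤ._+_ (cong₂ ℤ._*_ (p z≤n) (q ℕ.≤-refl))
  (⊛-cong-≤ {tail f} {tail f′} n (λ m≤n → p (s≤s m≤n)) (λ m≤n → q (ℕ.m≤n⇒m≤1+n m≤n)))

n≤double : ∀ n → n ℕ.≤ double n
n≤double zero    = z≤n
n≤double (suc n) = s≤s (ℕ.m≤n⇒m≤1+n (n≤double n))

-- The coefficient of index k is taken from Shanks' identity of order k + 1, where both factors
-- already agree with `pod` and φ up to index k.
pod⊛φ : pod ⊛ φ ≋ const 1ℤ
pod⊛φ k = ⊛-cong-≤ {pod} {podUpTo (suc k)} {φ} {triangles -X (double (suc k))} k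
  (λ m≤k → sym (podBelow-≥ (ℕ.≤-trans m≤k (ℕ.<⇒≤ k<))))
  (λ m≤k → sym (triangles-φ (ℕ.≤-<-trans m≤k k<))) ⨾
  shanks-truncated -X^-⊛-< k (ℕ.<⇒≤ k<)
  where
  open Shanks -X refl podUpTo podBelow-0 podUpTo-suc
  k< : k ℕ.< double (suc k)
  k< = s≤s (ℕ.m≤n⇒m≤1+n (n≤double k))

pod³-coefficient : ∀ n → (pod ^ 3) n ≡ + pod₋₃ n
pod³-coefficient n = solve 1 (λ p → p :^ 3 := p :* (p :* p)) ≋-refl pod n ⨾
  ⊛-congʳ pod (gf-⊛ pods functional pods (λ _ → 1ℤ) (λ _ → 1ℤ)) n ⨾
  gf-⊛ pods functional (convolve pods functional pods) (λ _ → 1ℤ) (λ _ → 1ℤ) n ⨾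
  ∑-⇔ (convolve pods functional (convolve pods functional pods) n) (podTriples n)
    (λ { (_ , _ , refl , (pa , refl) , (_ , _ , refl , (pb , refl) , (pc , refl))) → (pa , pb , pc) , refl })
    (λ { {a , b , c} ((pa , pb , pc) , refl) →
         _ , _ , refl , (pa , refl) , (_ , _ , refl , (pb , refl) , (pc , refl)) }) _ ⨾
  ∑-count (podTriples n)
  where
  functional : ∀ {k l ps} → IsPod ps × sum ps ≡ k → IsPod ps × sum ps ≡ l → k ≡ l
  functional (_ , p) (_ , q) = sym p ⨾ q

-- Sums of four triangular numbers

∑-involution : {A : Set} {P : Pred A 0ℓ} (E : Enumeration P) (ι : A → A) →
  (∀ {x} → P x → P (ι x)) → (∀ {x} → P x → ι (ι x) ≡ x) →
  ∀ {f g} → (∀ {x} → P x → f x ≡ g (ι x)) → ∑ E f ≡ ∑ E g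
∑-involution E ι closed involutive = ∑-bijection E E ι closed
  (λ Px Py eq → sym (involutive Px) ⨾ cong ι eq ⨾ involutive Py)
  (λ {y} Py → ι y , closed Py , involutive Py)

0<-* : ∀ {a b} → 0ℤ ℤ.< a → 0ℤ ℤ.< b → 0ℤ ℤ.< a ℤ.* b
0<-* (ℤ.+<+ (s≤s _)) (ℤ.+<+ (s≤s _)) = ℤ.+<+ (s≤s z≤n)

Oddℤ-* : ∀ {a b} → Oddℤ (a ℤ.* b) → Oddℤ a × Oddℤ b
Oddℤ-* {a} {b} (m , eq) with even-or-odd a | even-or-odd b
... | inj₂ a-odd      | inj₂ b-odd      = a-odd , b-odd
... | inj₁ (y , refl) | _               =
  ⊥-elim (even≢oddℤ {y ℤ.* b} {m} (sym (ℤ.*-assoc (+ 2) y b) ⨾ eq))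
... | inj₂ _          | inj₁ (y , refl) = ⊥-elim (even≢oddℤ {a ℤ.* y} {m} (rearrange a y ⨾ eq))
  where
  rearrange : ∀ a y → + 2 ℤ.* (a ℤ.* y) ≡ a ℤ.* (+ 2 ℤ.* y)
  rearrange = solve-∀

*-Oddℤ : ∀ {a b} → Oddℤ a → Oddℤ b → Oddℤ (a ℤ.* b)
*-Oddℤ (x , refl) (y , refl) = x ℤ.+ y ℤ.+ + 2 ℤ.* x ℤ.* y , expand x y
  where
  expand : ∀ x y → (1ℤ ℤ.+ + 2 ℤ.* x) ℤ.* (1ℤ ℤ.+ + 2 ℤ.* y) ≡
                   1ℤ ℤ.+ + 2 ℤ.* (x ℤ.+ y ℤ.+ + 2 ℤ.* x ℤ.* y)
  expand = solve-∀

odd-positive : ∀ {x} → 0ℤ ℤ.< x → Oddℤ x → ∃ λ t → x ≡ + suc (double t)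
odd-positive {x} 0<x (y , x≡) with parityℤ x
... | inj₁ (z , x≡′)      = ⊥-elim (even≢oddℤ {z} {y} (sym x≡′ ⨾ x≡))
... | inj₂ (t , inj₁ x≡′) = t , x≡′
odd-positive () _ | inj₂ (t , inj₂ refl)

record IsFactorisation (l : ℕ) (p : ℤ × ℤ) : Set where
  constructor factorisation
  field
    0<left   : 0ℤ ℤ.< proj₁ p
    0<right  : 0ℤ ℤ.< proj₂ p
    product≡ : proj₁ p ℤ.* proj₂ p ≡ + suc (double l)

factor≤product : ∀ a {c M} → 0ℤ ℤ.< c → a ℤ.* c ≡ + M → ∣ a ∣ ℕ.≤ M
factor≤product a {c} (ℤ.+<+ (s≤s {n = k} _)) eq =
  ℕ.≤-trans (ℕ.m≤m*n ∣ a ∣ (suc k)) (ℕ.≤-reflexive (sym (ℤ.abs-* a c) ⨾ cong ∣_∣ eq))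

factorisations : ∀ l → Enumeration (IsFactorisation l)
factorisations l = filterEnum
  (λ (a , c) → map′ (λ (0<a , 0<c , eq) → factorisation 0<a 0<c eq)
                    (λ (factorisation 0<a 0<c eq) → 0<a , 0<c , eq)
                    (0ℤ ℤ.<? a ×-dec 0ℤ ℤ.<? c ×-dec a ℤ.* c ℤ.≟ + M))
  (cartesianProduct box box) (Unique.cartesianProduct⁺ (intsUpTo-unique M) (intsUpTo-unique M))
  (λ { {a , c} (factorisation 0<a 0<c eq) → ∈-cartesianProduct⁺
         (intsUpTo-complete M (factor≤product a 0<c eq))
         (intsUpTo-complete M (factor≤product c 0<a (ℤ.*-comm c a ⨾ eq))) })
  where
  M = suc (double l)
  box = intsUpTo M

σ : Series
σ = gf factorisations proj₁

IsOddRoot : ℕ → ℤ → Set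
IsOddRoot k = IsRoot (suc (double (double (double k))))

oddSquares : ∀ k → Enumeration (IsOddRoot k)
oddSquares k = squares (suc (double (double (double k))))

oddSquares-functional : ∀ {k l x} → IsOddRoot k x → IsOddRoot l x → k ≡ l
oddSquares-functional p q = double-injective (double-injective (double-injective
  (ℕ.suc-injective (squares-functional p q))))

-- (b , a , c) encodes the binary quadratic form [a , b , − c] of discriminant 8 n + 5.
record IsForm (n : ℕ) (p : ℤ × ℤ × ℤ) : Set where
  constructor form
  b = proj₁ p
  a = proj₁ (proj₂ p)
  c = proj₂ (proj₂ p)
  field
    odd-b         : Oddℤ b
    odd-a         : Oddℤ a
    odd-c         : Oddℤ c
    0<a           : 0ℤ ℤ.< a
    0<c           : 0ℤ ℤ.< c
    discriminant≡ : b ℤ.* b ℤ.+ + 4 ℤ.* (a ℤ.* c) ≡ + 5 ℤ.+ + 8 ℤ.* + n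

-- If b² = 8 k + 1 and a c = 2 l + 1, then b² + 4 a c = 8 (k + l) + 5. Thus forms are pairs of an
-- odd root and a factorisation of total degree n, and products of the two kinds of generating
-- functions expand over forms.
forms : ∀ n → Enumeration (IsForm n)
forms n = reindex to from (convolve oddSquares oddSquares-functional factorisations n)
  where
  to : ∀ {p} → Conv IsOddRoot IsFactorisation n p → IsForm n p
  to {b , a , c} (k , l , refl , root b² , factorisation 0<a 0<c ac) =
    form odd-b (proj₁ odds) (proj₂ odds) 0<a 0<c
      (cong₂ (λ x y → x ℤ.+ + 4 ℤ.* y) (sym (^2 b) ⨾ b² ⨾ +-congˡ 1ℤ (+-double³ k))
                                      (ac ⨾ +-suc-double l) ⨾
       collect (+ k) (+ l) ⨾ cong (λ z → + 5 ℤ.+ + 8 ℤ.* z) (sym (ℤ.pos-+ k l)))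
    where
    odds = Oddℤ-* {a} {c} (+ l , (ac ⨾ +-suc-double l))
    collect : ∀ k l → (1ℤ ℤ.+ + 8 ℤ.* k) ℤ.+ + 4 ℤ.* (1ℤ ℤ.+ + 2 ℤ.* l) ≡ + 5 ℤ.+ + 8 ℤ.* (k ℤ.+ l)
    collect = solve-∀
    odd-b : Oddℤ b
    odd-b = proj₁ (Oddℤ-* {b} {b} (+ double (double k) ,
      (sym (^2 b) ⨾ b² ⨾ +-suc-double (double (double k)))))
  from : ∀ {p} → IsForm n p → Conv IsOddRoot IsFactorisation n p
  from {b , a , c} (form odd-b odd-a odd-c 0<a 0<c eq)
    with squareClass b | odd-positive (0<-* 0<a 0<c) (*-Oddℤ odd-a odd-c)
  ... | even-square y b≡ _ | _ = ⊥-elim (even≢oddℤ {y} {proj₁ odd-b} (sym b≡ ⨾ proj₂ odd-b))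
  ... | odd-square k _ b² | l , ac =
    triangle k , l , ℤ.+-injective (ℤ.*-cancelˡ-≡ (+ 8) (+ (triangle k ℕ.+ l)) (+ n)
      (+-cancelˡ (+ 5) (+ 8 ℤ.* + (triangle k ℕ.+ l)) (+ 8 ℤ.* + n)
        (cong (λ z → + 5 ℤ.+ + 8 ℤ.* z) (ℤ.pos-+ (triangle k) l) ⨾ collect (+ triangle k) (+ l) ⨾
         sym (cong₂ (λ x y → x ℤ.+ + 4 ℤ.* y) (sym (^2 b) ⨾ b²) (ac ⨾ +-suc-double l)) ⨾ eq))) ,
    root (b² ⨾ +-congˡ 1ℤ (sym (+-double³ (triangle k)))) , factorisation 0<a 0<c ac
    where
    collect : ∀ k l → + 5 ℤ.+ + 8 ℤ.* (k ℤ.+ l) ≡ (1ℤ ℤ.+ + 8 ℤ.* k) ℤ.+ + 4 ℤ.* (1ℤ ℤ.+ + 2 ℤ.* l)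
    collect = solve-∀

weight : ℤ × ℤ × ℤ → ℤ
weight (b , a , c) = (a ℤ.+ c) ℤ.* (c ℤ.- b) ℤ.* (a ℤ.+ b)

-- Exchanges the value a + b − c at (1 , 1) with a or − c, whichever has the same sign; weight changes
-- sign, being up to sign the Vandermonde product of the three values a, − c, a + b − c.
flip′ : (p : ℤ × ℤ × ℤ) → let (b , a , c) = p in Dec (0ℤ ℤ.< a ℤ.+ b ℤ.- c) → ℤ × ℤ × ℤ
flip′ (b , a , c) (yes _) = + 2 ℤ.* c ℤ.- b , a ℤ.+ b ℤ.- c , c
flip′ (b , a , c) (no _)  = ℤ.- (b ℤ.+ + 2 ℤ.* a) , a , c ℤ.- a ℤ.- b

flip : ℤ × ℤ × ℤ → ℤ × ℤ × ℤ
flip p@(b , a , c) = flip′ p (0ℤ ℤ.<? a ℤ.+ b ℤ.- c)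

flip-yes : ∀ b a c → 0ℤ ℤ.< a ℤ.+ b ℤ.- c → flip (b , a , c) ≡ (+ 2 ℤ.* c ℤ.- b , a ℤ.+ b ℤ.- c , c)
flip-yes b a c 0<s with 0ℤ ℤ.<? a ℤ.+ b ℤ.- c
... | yes _   = refl
... | no ¬0<s = ⊥-elim (¬0<s 0<s)

flip-no : ∀ b a c → ¬ 0ℤ ℤ.< a ℤ.+ b ℤ.- c →
          flip (b , a , c) ≡ (ℤ.- (b ℤ.+ + 2 ℤ.* a) , a , c ℤ.- a ℤ.- b)
flip-no b a c ¬0<s with 0ℤ ℤ.<? a ℤ.+ b ℤ.- c
... | yes 0<s = ⊥-elim (¬0<s 0<s)
... | no  _   = refl

module _ {n : ℕ} where

  -- The branches are the unimodular substitutions (u , v) ↦ (u , u - v) and (u , v) ↦ (u - v , -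
  -- v), so the discriminant is preserved. The value a + b - c is odd, hence nonzero, and in the
  -- second branch c - a - b is positive.
  flip-form : ∀ {p} → IsForm n p → IsForm n (flip p)
  flip-form {b , a , c} (form (y , refl) (x , refl) (z , refl) 0<a 0<c eq) with 0ℤ ℤ.<? a ℤ.+ b ℤ.- c
  ... | yes 0<s = form (+ 2 ℤ.* z ℤ.- y , odd₁ z y) (x ℤ.+ y ℤ.- z , odd₂ x y z) (z , refl) 0<s 0<c
                    (preserved a b c ⨾ eq)
    where
    odd₁ : ∀ z y → + 2 ℤ.* (1ℤ ℤ.+ + 2 ℤ.* z) ℤ.- (1ℤ ℤ.+ + 2 ℤ.* y) ≡ 1ℤ ℤ.+ + 2 ℤ.* (+ 2 ℤ.* z ℤ.- y)
    odd₁ = solve-∀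
    odd₂ : ∀ x y z → (1ℤ ℤ.+ + 2 ℤ.* x) ℤ.+ (1ℤ ℤ.+ + 2 ℤ.* y) ℤ.- (1ℤ ℤ.+ + 2 ℤ.* z) ≡
                     1ℤ ℤ.+ + 2 ℤ.* (x ℤ.+ y ℤ.- z)
    odd₂ = solve-∀
    preserved : ∀ a b c →
      (+ 2 ℤ.* c ℤ.- b) ℤ.* (+ 2 ℤ.* c ℤ.- b) ℤ.+ + 4 ℤ.* ((a ℤ.+ b ℤ.- c) ℤ.* c) ≡
      b ℤ.* b ℤ.+ + 4 ℤ.* (a ℤ.* c)
    preserved = solve-∀
  ... | no ¬0<s = form (ℤ.- (+ 2 ℤ.+ y ℤ.+ + 2 ℤ.* x) , odd₁ x y) (x , refl)
                    (z ℤ.- x ℤ.- y ℤ.- 1ℤ , odd₂ x y z) 0<a 0<s′ (preserved a b c ⨾ eq)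
    where
    odd₁ : ∀ x y → ℤ.- ((1ℤ ℤ.+ + 2 ℤ.* y) ℤ.+ + 2 ℤ.* (1ℤ ℤ.+ + 2 ℤ.* x)) ≡
                   1ℤ ℤ.+ + 2 ℤ.* ℤ.- (+ 2 ℤ.+ y ℤ.+ + 2 ℤ.* x)
    odd₁ = solve-∀
    odd₂ : ∀ x y z → (1ℤ ℤ.+ + 2 ℤ.* z) ℤ.- (1ℤ ℤ.+ + 2 ℤ.* x) ℤ.- (1ℤ ℤ.+ + 2 ℤ.* y) ≡
                     1ℤ ℤ.+ + 2 ℤ.* (z ℤ.- x ℤ.- y ℤ.- 1ℤ)
    odd₂ = solve-∀
    odd₃ : ∀ x y z → (1ℤ ℤ.+ + 2 ℤ.* x) ℤ.+ (1ℤ ℤ.+ + 2 ℤ.* y) ℤ.- (1ℤ ℤ.+ + 2 ℤ.* z) ≡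
                     1ℤ ℤ.+ + 2 ℤ.* (x ℤ.+ y ℤ.- z)
    odd₃ = solve-∀
    negated : ∀ a b c → ℤ.- (a ℤ.+ b ℤ.- c) ≡ c ℤ.- a ℤ.- b
    negated = solve-∀
    s≢0 : a ℤ.+ b ℤ.- c ≢ 0ℤ
    s≢0 s≡0 = even≢oddℤ {0ℤ} {x ℤ.+ y ℤ.- z} (sym s≡0 ⨾ odd₃ x y z)
    0<s′ : 0ℤ ℤ.< c ℤ.- a ℤ.- b
    0<s′ = subst (0ℤ ℤ.<_) (negated a b c)
      (ℤ.neg-mono-< (ℤ.≤∧≢⇒< (ℤ.≮⇒≥ ¬0<s) s≢0))
    preserved : ∀ a b c →
      ℤ.- (b ℤ.+ + 2 ℤ.* a) ℤ.* ℤ.- (b ℤ.+ + 2 ℤ.* a) ℤ.+ + 4 ℤ.* (a ℤ.* (c ℤ.- a ℤ.- b)) ≡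
      b ℤ.* b ℤ.+ + 4 ℤ.* (a ℤ.* c)
    preserved = solve-∀

  -- The image lands in the same branch: its value at (1 , 1) is the discarded one, a > 0 in the
  -- first branch and - c < 0 in the second.
  flip-involutive : ∀ {p} → IsForm n p → flip (flip p) ≡ p
  flip-involutive {b , a , c} (form _ _ _ 0<a 0<c _) with 0ℤ ℤ.<? a ℤ.+ b ℤ.- c
  ... | yes _ = flip-yes (+ 2 ℤ.* c ℤ.- b) (a ℤ.+ b ℤ.- c) c (subst (0ℤ ℤ.<_) (sym (restore a b c)) 0<a) ⨾
                cong₂ (λ x y → x , y , c) (middle b c) (restore a b c)
    where
    restore : ∀ a b c → (a ℤ.+ b ℤ.- c) ℤ.+ (+ 2 ℤ.* c ℤ.- b) ℤ.- c ≡ a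
    restore = solve-∀
    middle : ∀ b c → + 2 ℤ.* c ℤ.- (+ 2 ℤ.* c ℤ.- b) ≡ b
    middle = solve-∀
  ... | no _ = flip-no (ℤ.- (b ℤ.+ + 2 ℤ.* a)) a (c ℤ.- a ℤ.- b)
                 (λ 0<s → ℤ.<-asym (ℤ.neg-mono-< 0<c) (subst (0ℤ ℤ.<_) (value a b c) 0<s)) ⨾
               cong₂ (λ x y → x , a , y) (middle a b) (restore a b c)
    where
    value : ∀ a b c → a ℤ.+ ℤ.- (b ℤ.+ + 2 ℤ.* a) ℤ.- (c ℤ.- a ℤ.- b) ≡ ℤ.- c
    value = solve-∀
    middle : ∀ a b → ℤ.- (ℤ.- (b ℤ.+ + 2 ℤ.* a) ℤ.+ + 2 ℤ.* a) ≡ b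
    middle = solve-∀
    restore : ∀ a b c → (c ℤ.- a ℤ.- b) ℤ.- a ℤ.- ℤ.- (b ℤ.+ + 2 ℤ.* a) ≡ c
    restore = solve-∀

  flip-weight : ∀ p → weight p ≡ -1ℤ ℤ.* weight (flip p)
  flip-weight (b , a , c) with 0ℤ ℤ.<? a ℤ.+ b ℤ.- c
  ... | yes _ = identity a b c
    where
    identity : ∀ a b c → (a ℤ.+ c) ℤ.* (c ℤ.- b) ℤ.* (a ℤ.+ b) ≡
      -1ℤ ℤ.* ((a ℤ.+ b ℤ.- c ℤ.+ c) ℤ.* (c ℤ.- (+ 2 ℤ.* c ℤ.- b)) ℤ.* (a ℤ.+ b ℤ.- c ℤ.+ (+ 2 ℤ.* c ℤ.- b)))
    identity = solve-∀
  ... | no _ = identity a b c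
    where
    identity : ∀ a b c → (a ℤ.+ c) ℤ.* (c ℤ.- b) ℤ.* (a ℤ.+ b) ≡
      -1ℤ ℤ.* ((a ℤ.+ (c ℤ.- a ℤ.- b)) ℤ.* (c ℤ.- a ℤ.- b ℤ.- ℤ.- (b ℤ.+ + 2 ℤ.* a)) ℤ.*
               (a ℤ.+ ℤ.- (b ℤ.+ + 2 ℤ.* a)))
    identity = solve-∀

∑-weight : ∀ n → ∑ (forms n) weight ≡ 0ℤ
∑-weight n = self-negative (∑ (forms n) weight)
  (∑-involution (forms n) flip flip-form flip-involutive (λ {p} _ → flip-weight {n} p) ⨾
   ∑-* -1ℤ (forms n) weight)
  where
  self-negative : ∀ s → s ≡ -1ℤ ℤ.* s → s ≡ 0ℤ
  self-negative s eq = ℤ.*-cancelˡ-≡ (+ 2) s 0ℤ (twice s ⨾ cong (λ z → s ℤ.+ z) eq ⨾ cancel s)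
    where
    twice : ∀ s → + 2 ℤ.* s ≡ s ℤ.+ s
    twice = solve-∀
    cancel : ∀ s → s ℤ.+ -1ℤ ℤ.* s ≡ 0ℤ
    cancel = solve-∀

-- The difference of a (a c - 1) and (b² - 1) a, the summands to which the two sides of `σ-ode`
-- lead.
excess : ℤ × ℤ × ℤ → ℤ
excess (b , a , c) = a ℤ.* (a ℤ.* c ℤ.- b ℤ.* b)

-- Symmetrising `excess` under the exchange of a and c yields, up to a factor 2, `weight`
-- symmetrised under b ↦ - b. Both exchanges permute the forms, so `∑-weight` suffices.
∑-excess : ∀ n → ∑ (forms n) excess ≡ 0ℤ
∑-excess n = ℤ.*-cancelˡ-≡ (+ 4) (∑ E excess) 0ℤ (begin
  + 4 ℤ.* ∑ E excess                                     ≡⟨ quadruple (∑ E excess) ⟩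
  + 2 ℤ.* (∑ E excess ℤ.+ ∑ E excess)                    ≡⟨ cong (λ z → + 2 ℤ.* (∑ E excess ℤ.+ z)) swapped ⟩
  + 2 ℤ.* (∑ E excess ℤ.+ ∑ E (λ p → excess (reversal p)))   ≡⟨ cong (λ z → + 2 ℤ.* z) (∑-+ E excess _) ⟨
  + 2 ℤ.* ∑ E (λ p → excess p ℤ.+ excess (reversal p))       ≡⟨ ∑-* (+ 2) E _ ⟨
  ∑ E (λ p → + 2 ℤ.* (excess p ℤ.+ excess (reversal p)))     ≡⟨ ∑-cong E (λ {(b , a , c)} _ → identity a b c) ⟩
  ∑ E (λ p → weight p ℤ.+ weight (mirror p))             ≡⟨ ∑-+ E weight _ ⟩
  ∑ E weight ℤ.+ ∑ E (λ p → weight (mirror p))           ≡⟨ cong (λ z → ∑ E weight ℤ.+ z) mirrored ⟨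
  ∑ E weight ℤ.+ ∑ E weight                              ≡⟨ cong₂ ℤ._+_ (∑-weight n) (∑-weight n) ⟩
  0ℤ                                                     ∎)
  where
  open ≡-Reasoning
  E = forms n
  reversal mirror : ℤ × ℤ × ℤ → ℤ × ℤ × ℤ
  reversal   (b , a , c) = b , c , a
  mirror (b , a , c) = ℤ.- b , a , c
  quadruple : ∀ s → + 4 ℤ.* s ≡ + 2 ℤ.* (s ℤ.+ s)
  quadruple = solve-∀
  swapped : ∑ E excess ≡ ∑ E (λ p → excess (reversal p))
  swapped = ∑-involution E reversal
    (λ { {b , a , c} (form b′ a′ c′ 0<a 0<c eq) →
         form b′ c′ a′ 0<c 0<a (cong (λ z → b ℤ.* b ℤ.+ + 4 ℤ.* z) (ℤ.*-comm c a) ⨾ eq) })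
    (λ _ → refl) (λ _ → refl)
  mirrored : ∑ E weight ≡ ∑ E (λ p → weight (mirror p))
  mirrored = ∑-involution E mirror
    (λ { {b , a , c} (form (y , refl) a′ c′ 0<a 0<c eq) →
         form (-1ℤ ℤ.- y , odd-neg y) a′ c′ 0<a 0<c
           (cong (λ z → z ℤ.+ + 4 ℤ.* (a ℤ.* c)) (square-neg b) ⨾ eq) })
    (λ { {b , a , c} _ → cong (λ z → z , a , c) (ℤ.neg-involutive b) })
    (λ { {b , a , c} _ → cong (λ z → weight (z , a , c)) (sym (ℤ.neg-involutive b)) })
    where
    odd-neg : ∀ y → ℤ.- (1ℤ ℤ.+ + 2 ℤ.* y) ≡ 1ℤ ℤ.+ + 2 ℤ.* (-1ℤ ℤ.- y)
    odd-neg = solve-∀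
    square-neg : ∀ b → ℤ.- b ℤ.* ℤ.- b ≡ b ℤ.* b
    square-neg = solve-∀
  identity : ∀ a b c →
    + 2 ℤ.* (a ℤ.* (a ℤ.* c ℤ.- b ℤ.* b) ℤ.+ c ℤ.* (c ℤ.* a ℤ.- b ℤ.* b)) ≡
    (a ℤ.+ c) ℤ.* (c ℤ.- b) ℤ.* (a ℤ.+ b) ℤ.+ (a ℤ.+ c) ℤ.* (c ℤ.- ℤ.- b) ℤ.* (a ℤ.+ ℤ.- b)
  identity = solve-∀

-- The factor 4 prepares both sides for forms: 2 ψ counts the odd roots b, on which b² - 1 is 8
-- times the degree, while a c - 1 is twice the degree of a factorisation. The two sides then differ
-- by the sum of `excess`.
σ-ode : ψ ⊛ ∂ σ ≋ (const (+ 4) ⊛ ∂ ψ) ⊛ σ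
σ-ode = const-⊛-cancel (+ 4) (begin
  const (+ 4) ⊛ (ψ ⊛ ∂ σ)
    ≈⟨ solve 2 (λ p s → con (+ 4) :* (p :* s) := con (+ 2) :* p :* (con (+ 2) :* s)) ≋-refl ψ (∂ σ) ⟩
  const (+ 2) ⊛ ψ ⊛ (const (+ 2) ⊛ ∂ σ)
    ≈⟨ ⊛-cong ones products ⟨
  gf oddSquares (λ _ → 1ℤ) ⊛ gf factorisations (λ (a , c) → a ℤ.* (a ℤ.* c ℤ.- 1ℤ))
    ≈⟨ gf-⊛ oddSquares oddSquares-functional factorisations _ _ ⟩
  gf forms (λ (b , a , c) → 1ℤ ℤ.* (a ℤ.* (a ℤ.* c ℤ.- 1ℤ)))
    ≈⟨ (λ n → ∑-cong (forms n) (λ {(b , a , c)} _ → compare a b c) ⨾ ∑-+ (forms n) excess _ ⨾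
              cong (λ z → z ℤ.+ ∑ (forms n) (λ (b , a , c) → (b ℤ.* b ℤ.- 1ℤ) ℤ.* a)) (∑-excess n) ⨾
              ℤ.+-identityˡ _) ⟩
  gf forms (λ (b , a , c) → (b ℤ.* b ℤ.- 1ℤ) ℤ.* a)
    ≈⟨ gf-⊛ oddSquares oddSquares-functional factorisations _ _ ⟨
  gf oddSquares (λ b → b ℤ.* b ℤ.- 1ℤ) ⊛ σ
    ≈⟨ ⊛-cong {g = σ} roots ≋-refl ⟩
  (const (+ 16) ⊛ ∂ ψ) ⊛ σ
    ≈⟨ solve 2 (λ p s → con (+ 16) :* p :* s := con (+ 4) :* (con (+ 4) :* p :* s)) ≋-refl (∂ ψ) σ ⟩
  const (+ 4) ⊛ ((const (+ 4) ⊛ ∂ ψ) ⊛ σ) ∎)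
  where
  open ≋-Reasoning
  ones : gf oddSquares (λ _ → 1ℤ) ≋ const (+ 2) ⊛ ψ
  ones n = θ-8n+1 n ⨾ sym (const-⊛ (+ 2) ψ n)
  products : gf factorisations (λ (a , c) → a ℤ.* (a ℤ.* c ℤ.- 1ℤ)) ≋ const (+ 2) ⊛ ∂ σ
  products n =
    ∑-cong (factorisations n) (λ { {a , c} (factorisation _ _ ac) →
      cong (λ z → a ℤ.* (z ℤ.- 1ℤ)) (ac ⨾ +-suc-double n) ⨾ collect a (+ n) }) ⨾
    ∑-* (+ 2 ℤ.* + n) (factorisations n) proj₁ ⨾ ℤ.*-assoc (+ 2) (+ n) (σ n) ⨾
    sym (const-⊛ (+ 2) (∂ σ) n)
    where
    collect : ∀ a n → a ℤ.* (1ℤ ℤ.+ + 2 ℤ.* n ℤ.- 1ℤ) ≡ + 2 ℤ.* n ℤ.* a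
    collect = solve-∀
  roots : gf oddSquares (λ b → b ℤ.* b ℤ.- 1ℤ) ≋ const (+ 16) ⊛ ∂ ψ
  roots n =
    ∑-cong (oddSquares n) (λ { {b} (root b²) →
      cong (λ z → z ℤ.- 1ℤ) (sym (^2 b) ⨾ b² ⨾ +-congˡ 1ℤ (+-double³ n)) ⨾ collect (+ n) }) ⨾
    ∑-* (+ 8 ℤ.* + n) (oddSquares n) (λ _ → 1ℤ) ⨾ cong (λ z → + 8 ℤ.* + n ℤ.* z) (θ-8n+1 n) ⨾
    regroup (+ n) (ψ n) ⨾ sym (const-⊛ (+ 16) (∂ ψ) n)
    where
    collect : ∀ n → 1ℤ ℤ.+ + 8 ℤ.* n ℤ.- 1ℤ ≡ + 8 ℤ.* n ℤ.* 1ℤ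
    collect = solve-∀
    regroup : ∀ n p → + 8 ℤ.* n ℤ.* (+ 2 ℤ.* p) ≡ + 16 ℤ.* (n ℤ.* p)
    regroup = solve-∀
  compare : ∀ a b c → 1ℤ ℤ.* (a ℤ.* (a ℤ.* c ℤ.- 1ℤ)) ≡
    a ℤ.* (a ℤ.* c ℤ.- b ℤ.* b) ℤ.+ (b ℤ.* b ℤ.- 1ℤ) ℤ.* a
  compare = solve-∀

ψ⁴≋σ : ψ ^ 4 ≋ σ
ψ⁴≋σ = linear-ode-unique ψ (const (+ 4) ⊛ ∂ ψ) refl refl refl
  (λ n → ∂-^ ψ 4 n ⨾ sym (⊛-assoc (const (+ 4)) (∂ ψ) (ψ ^ 4) n)) σ-ode

-- Sums of eight triangular numbers

-- By asymmetry an element satisfies `R`, or its image under s does, or neither; s exchanges the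
-- first two classes and preserves f.
∑-swap-split : {A : Set} {P R : Pred A 0ℓ} (E : Enumeration P) (R? : Decidable R) (s : A → A) →
  (∀ {x} → P x → P (s x)) → (∀ x → s (s x) ≡ x) → (∀ {x} → R x → ¬ R (s x)) →
  ∀ f → (∀ x → f (s x) ≡ f x) →
  ∑ E f ≡ + 2 ℤ.* ∑ (restrict R? E) f ℤ.+ ∑ (restrict (¬? ∘ R? ∘ s) (restrict (¬? ∘ R?) E)) f
∑-swap-split {R = R} E R? s closed involutive asym f symmetric =
  ∑-split R? E f ⨾
  +-congˡ (∑ (restrict R? E) f) (∑-split (R? ∘ s) E′ f ⨾
    cong (λ z → z ℤ.+ rest) (sym
      (∑-inverse (restrict R? E) (restrict (R? ∘ s) E′) s s
        (λ {x} (Px , Rx) → (closed Px , asym Rx) , subst R (sym (involutive x)) Rx)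
        (λ ((Px , _) , Rsx) → closed Px , Rsx) involutive involutive (λ {x} _ → sym (symmetric x))))) ⨾
  rearrange (∑ (restrict R? E) f) rest
  where
  E′ = restrict (¬? ∘ R?) E
  rest = ∑ (restrict (¬? ∘ R? ∘ s) E′) f
  rearrange : ∀ a b → a ℤ.+ (a ℤ.+ b) ≡ + 2 ℤ.* a ℤ.+ b
  rearrange = solve-∀

-- Solutions of a x + b y = 2 N and Liouville's substitutions

Quad : Set
Quad = (ℤ × ℤ) × (ℤ × ℤ)

record IsQuad (N : ℕ) (p : Quad) : Set where
  constructor quad
  a = proj₁ (proj₁ p)
  x = proj₂ (proj₁ p)
  b = proj₁ (proj₂ p)
  y = proj₂ (proj₂ p)
  field
    0<a  : 0ℤ ℤ.< a
    0<x  : 0ℤ ℤ.< x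
    0<b  : 0ℤ ℤ.< b
    0<y  : 0ℤ ℤ.< y
    sum≡ : a ℤ.* x ℤ.+ b ℤ.* y ≡ + double N

quads : ∀ N → Enumeration (IsQuad N)
quads N = filterEnum
  (λ ((a , x) , (b , y)) →
    map′ (λ (0<a , 0<x , 0<b , 0<y , eq) → quad 0<a 0<x 0<b 0<y eq)
         (λ (quad 0<a 0<x 0<b 0<y eq) → 0<a , 0<x , 0<b , 0<y , eq)
         (0ℤ ℤ.<? a ×-dec 0ℤ ℤ.<? x ×-dec 0ℤ ℤ.<? b ×-dec 0ℤ ℤ.<? y ×-dec
          a ℤ.* x ℤ.+ b ℤ.* y ℤ.≟ + double N))
  (cartesianProduct (cartesianProduct box box) (cartesianProduct box box))
  (Unique.cartesianProduct⁺ box²-unique box²-unique)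
  (λ { (quad (ℤ.+<+ (s≤s {n = a} _)) (ℤ.+<+ (s≤s {n = x} _)) (ℤ.+<+ (s≤s {n = b} _))
             (ℤ.+<+ (s≤s {n = y} _)) eq) →
       let eq′ = ℤ.+-injective eq
           left≤  = ℕ.≤-trans (ℕ.m≤m+n (suc a ℕ.* suc x) (suc b ℕ.* suc y)) (ℕ.≤-reflexive eq′)
           right≤ = ℕ.≤-trans (ℕ.m≤n+m (suc b ℕ.* suc y) (suc a ℕ.* suc x)) (ℕ.≤-reflexive eq′)
       in ∈-cartesianProduct⁺
         (∈-cartesianProduct⁺ (inBox (ℕ.m≤m*n (suc a) (suc x)) left≤)
                              (inBox (ℕ.m≤n*m (suc x) (suc a)) left≤))
         (∈-cartesianProduct⁺ (inBox (ℕ.m≤m*n (suc b) (suc y)) right≤)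
                              (inBox (ℕ.m≤n*m (suc y) (suc b)) right≤)) })
  where
  box = intsUpTo (double N)
  inBox : ∀ {z m} → z ℕ.≤ m → m ℕ.≤ double N → + z ∈ box
  inBox z≤m m≤2N = intsUpTo-complete (double N) (ℕ.≤-trans z≤m m≤2N)
  box²-unique = Unique.cartesianProduct⁺ (intsUpTo-unique (double N)) (intsUpTo-unique (double N))

odd?ℤ : Decidable Oddℤ
odd?ℤ x with even-or-odd x
... | inj₁ (y , x≡2y) = no (λ (z , x≡) → even≢oddℤ {y} {z} (sym x≡2y ⨾ x≡))
... | inj₂ odd        = yes odd

even?ℤ : Decidable Evenℤ
even?ℤ x with even-or-odd x
... | inj₁ even       = yes even
... | inj₂ (y , x≡)   = no (λ (z , x≡2z) → even≢oddℤ {z} {y} (sym x≡2z ⨾ x≡))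

-- `Mixed` is the parity class to which `lower` and `raise` carry `AllOdd` and from which they lead
-- back.
AllOdd Mixed : Quad → Set
AllOdd ((a , x) , (b , y)) = Oddℤ a × Oddℤ x × Oddℤ b × Oddℤ y
Mixed  ((a , x) , (b , y)) = Evenℤ a × Oddℤ x × Oddℤ b × Evenℤ y

oddQuads : ∀ N → Enumeration (λ p → IsQuad N p × AllOdd p)
oddQuads N = restrict
  (λ ((a , x) , (b , y)) → odd?ℤ a ×-dec odd?ℤ x ×-dec odd?ℤ b ×-dec odd?ℤ y) (quads N)

mixedQuads : ∀ N → Enumeration (λ p → IsQuad N p × Mixed p)
mixedQuads N = restrict
  (λ ((a , x) , (b , y)) → even?ℤ a ×-dec odd?ℤ x ×-dec odd?ℤ b ×-dec even?ℤ y) (quads N)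

σ²-quads : ∀ n → (σ ⊛ σ) n ≡ ∑ (oddQuads (suc n)) (λ ((a , _) , (b , _)) → a ℤ.* b)
σ²-quads n = gf-⊛ factorisations functional factorisations proj₁ proj₁ n ⨾
  ∑-⇔ (convolve factorisations functional factorisations n) (oddQuads (suc n)) to from _
  where
  functional : ∀ {k l p} → IsFactorisation k p → IsFactorisation l p → k ≡ l
  functional (factorisation _ _ p) (factorisation _ _ q) =
    double-injective (ℕ.suc-injective (ℤ.+-injective (sym p ⨾ q)))
  to : ∀ {p} → Conv IsFactorisation IsFactorisation n p → IsQuad (suc n) p × AllOdd p
  to {(a , x) , (b , y)} (k , l , refl , factorisation 0<a 0<x ax , factorisation 0<b 0<y by≡) =
    quad 0<a 0<x 0<b 0<y
      (cong₂ ℤ._+_ (ax ⨾ +-suc-double k) (by≡ ⨾ +-suc-double l) ⨾ collect (+ k) (+ l) ⨾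
       cong (λ z → + 2 ℤ.* (1ℤ ℤ.+ z)) (sym (ℤ.pos-+ k l)) ⨾ sym (+-double (suc (k ℕ.+ l)))) ,
    proj₁ odds₁ , proj₂ odds₁ , proj₁ odds₂ , proj₂ odds₂
    where
    odds₁ = Oddℤ-* {a} {x} (+ k , (ax ⨾ +-suc-double k))
    odds₂ = Oddℤ-* {b} {y} (+ l , (by≡ ⨾ +-suc-double l))
    collect : ∀ k l → (1ℤ ℤ.+ + 2 ℤ.* k) ℤ.+ (1ℤ ℤ.+ + 2 ℤ.* l) ≡ + 2 ℤ.* (1ℤ ℤ.+ (k ℤ.+ l))
    collect = solve-∀
  from : ∀ {p} → IsQuad (suc n) p × AllOdd p → Conv IsFactorisation IsFactorisation n p
  from {(a , x) , (b , y)} (quad 0<a 0<x 0<b 0<y eq , odd-a , odd-x , odd-b , odd-y)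
    with odd-positive (0<-* 0<a 0<x) (*-Oddℤ odd-a odd-x)
       | odd-positive (0<-* 0<b 0<y) (*-Oddℤ odd-b odd-y)
  ... | k , ax | l , by≡ =
    k , l , ℕ.suc-injective (double-injective (ℤ.+-injective
      (+-double (suc (k ℕ.+ l)) ⨾ cong (λ z → + 2 ℤ.* (1ℤ ℤ.+ z)) (ℤ.pos-+ k l) ⨾
       collect (+ k) (+ l) ⨾ sym (cong₂ ℤ._+_ (ax ⨾ +-suc-double k) (by≡ ⨾ +-suc-double l)) ⨾ eq))) ,
    factorisation 0<a 0<x ax , factorisation 0<b 0<y by≡
    where
    collect : ∀ k l → + 2 ℤ.* (1ℤ ℤ.+ (k ℤ.+ l)) ≡ (1ℤ ℤ.+ + 2 ℤ.* k) ℤ.+ (1ℤ ℤ.+ + 2 ℤ.* l)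
    collect = solve-∀

0<-difference : ∀ {i j} → i ℤ.< j → 0ℤ ℤ.< j ℤ.- i
0<-difference {i} {j} i<j = subst (ℤ._< j ℤ.- i) (ℤ.+-inverseʳ i) (ℤ.+-monoˡ-< (ℤ.- i) i<j)

difference-0< : ∀ {i j} → 0ℤ ℤ.< j ℤ.- i → i ℤ.< j
difference-0< {i} {j} 0<j-i = subst₂ ℤ._<_ (ℤ.+-identityˡ i) (cancel i j) (ℤ.+-monoˡ-< i 0<j-i)
  where
  cancel : ∀ i j → j ℤ.- i ℤ.+ i ≡ j
  cancel = solve-∀

0<-+ : ∀ {i j} → 0ℤ ℤ.< i → 0ℤ ℤ.< j → 0ℤ ℤ.< i ℤ.+ j
0<-+ = ℤ.+-mono-<

<-+ˡ : ∀ {i j} → 0ℤ ℤ.< j → i ℤ.< i ℤ.+ j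
<-+ˡ {i} {j} 0<j = difference-0< (subst (0ℤ ℤ.<_) (cancel i j) 0<j)
  where
  cancel : ∀ i j → j ≡ i ℤ.+ j ℤ.- i
  cancel = solve-∀

<-+ʳ : ∀ {i j} → 0ℤ ℤ.< j → i ℤ.< j ℤ.+ i
<-+ʳ {i} {j} 0<j = subst (i ℤ.<_) (ℤ.+-comm i j) (<-+ˡ 0<j)

odd-odd : ∀ {i j} → Oddℤ i → Oddℤ j → Evenℤ (i ℤ.+ j) × Evenℤ (i ℤ.- j)
odd-odd (y , refl) (z , refl) = (1ℤ ℤ.+ y ℤ.+ z , s y z) , (y ℤ.- z , d y z)
  where
  s : ∀ y z → (1ℤ ℤ.+ + 2 ℤ.* y) ℤ.+ (1ℤ ℤ.+ + 2 ℤ.* z) ≡ + 2 ℤ.* (1ℤ ℤ.+ y ℤ.+ z)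
  s = solve-∀
  d : ∀ y z → (1ℤ ℤ.+ + 2 ℤ.* y) ℤ.- (1ℤ ℤ.+ + 2 ℤ.* z) ≡ + 2 ℤ.* (y ℤ.- z)
  d = solve-∀

odd-even : ∀ {i j} → Oddℤ i → Evenℤ j → Oddℤ (i ℤ.+ j) × Oddℤ (i ℤ.- j)
odd-even (y , refl) (z , refl) = (y ℤ.+ z , s y z) , (y ℤ.- z , d y z)
  where
  s : ∀ y z → (1ℤ ℤ.+ + 2 ℤ.* y) ℤ.+ + 2 ℤ.* z ≡ 1ℤ ℤ.+ + 2 ℤ.* (y ℤ.+ z)
  s = solve-∀
  d : ∀ y z → (1ℤ ℤ.+ + 2 ℤ.* y) ℤ.- + 2 ℤ.* z ≡ 1ℤ ℤ.+ + 2 ℤ.* (y ℤ.- z)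
  d = solve-∀

even-odd : ∀ {i j} → Evenℤ i → Oddℤ j → Oddℤ (i ℤ.+ j)
even-odd {i} {j} e o = subst Oddℤ (ℤ.+-comm j i) (proj₁ (odd-even o e))

even-minus-odd : ∀ {i j} → Evenℤ i → Oddℤ j → Oddℤ (i ℤ.- j)
even-minus-odd (y , refl) (z , refl) = y ℤ.- z ℤ.- 1ℤ , identity y z
  where
  identity : ∀ y z → + 2 ℤ.* y ℤ.- (1ℤ ℤ.+ + 2 ℤ.* z) ≡ 1ℤ ℤ.+ + 2 ℤ.* (y ℤ.- z ℤ.- 1ℤ)
  identity = solve-∀

even-odd-differ : ∀ {i j} → Evenℤ i → Oddℤ j → i ≢ j
even-odd-differ (y , i≡) (z , j≡) i≡j = even≢oddℤ {y} {z} (sym i≡ ⨾ i≡j ⨾ j≡)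

≮⇒> : ∀ {i j} → ¬ i ℤ.< j → i ≢ j → j ℤ.< i
≮⇒> i≮j i≢j = ℤ.≤∧≢⇒< (ℤ.≮⇒≥ i≮j) (i≢j ∘ sym)

-+-cancel : ∀ i j → i ℤ.- j ℤ.+ j ≡ i
-+-cancel = solve-∀

+--cancel : ∀ i j → i ℤ.+ j ℤ.- j ≡ i
+--cancel = solve-∀

+--cancelˡ : ∀ i j → i ℤ.+ j ℤ.- i ≡ j
+--cancelˡ = solve-∀

+-cancel-- : ∀ i j → i ℤ.+ (j ℤ.- i) ≡ j
+-cancel-- = solve-∀

-- All preserve a x + b y, since (a , b) and (x , y) undergo contragredient substitutions. The first
-- entry of the image is a - b under `lower` and a + b under `raise`, which turns `difference²` and
-- `sum²` into `a²`; `shear` and `unshear` keep a.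
lower raise shear unshear transpose : Quad → Quad
lower     ((a , x) , (b , y)) = (a ℤ.- b , x) , (b , x ℤ.+ y)
raise     ((a , x) , (b , y)) = (a ℤ.+ b , x) , (b , y ℤ.- x)
shear     ((a , x) , (b , y)) = (a , x ℤ.+ y) , (b ℤ.- a , y)
unshear   ((a , x) , (b , y)) = (a , x ℤ.- y) , (b ℤ.+ a , y)
transpose (p , q) = q , p

raise-lower : ∀ p → raise (lower p) ≡ p
raise-lower ((a , x) , (b , y)) = cong₂ (λ s t → (s , x) , (b , t)) (-+-cancel a b) (+--cancelˡ x y)

lower-raise : ∀ p → lower (raise p) ≡ p
lower-raise ((a , x) , (b , y)) = cong₂ (λ s t → (s , x) , (b , t)) (+--cancel a b) (+-cancel-- x y)

unshear-shear : ∀ p → unshear (shear p) ≡ p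
unshear-shear ((a , x) , (b , y)) = cong₂ (λ s t → (a , s) , (t , y)) (+--cancel x y) (-+-cancel b a)

shear-unshear : ∀ p → shear (unshear p) ≡ p
shear-unshear ((a , x) , (b , y)) = cong₂ (λ s t → (a , s) , (t , y)) (-+-cancel x y) (+--cancel b a)

module _ {N : ℕ} where

  lower-quad : ∀ {a x b y} → IsQuad N ((a , x) , (b , y)) → b ℤ.< a → IsQuad N (lower ((a , x) , (b , y)))
  lower-quad {a} {x} {b} {y} (quad 0<a 0<x 0<b 0<y eq) b<a =
    quad (0<-difference b<a) 0<x 0<b (0<-+ 0<x 0<y) (preserved a x b y ⨾ eq)
    where
    preserved : ∀ a x b y → (a ℤ.- b) ℤ.* x ℤ.+ b ℤ.* (x ℤ.+ y) ≡ a ℤ.* x ℤ.+ b ℤ.* y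
    preserved = solve-∀

  raise-quad : ∀ {a x b y} → IsQuad N ((a , x) , (b , y)) → x ℤ.< y → IsQuad N (raise ((a , x) , (b , y)))
  raise-quad {a} {x} {b} {y} (quad 0<a 0<x 0<b 0<y eq) x<y =
    quad (0<-+ 0<a 0<b) 0<x 0<b (0<-difference x<y) (preserved a x b y ⨾ eq)
    where
    preserved : ∀ a x b y → (a ℤ.+ b) ℤ.* x ℤ.+ b ℤ.* (y ℤ.- x) ≡ a ℤ.* x ℤ.+ b ℤ.* y
    preserved = solve-∀

  shear-quad : ∀ {a x b y} → IsQuad N ((a , x) , (b , y)) → a ℤ.< b → IsQuad N (shear ((a , x) , (b , y)))
  shear-quad {a} {x} {b} {y} (quad 0<a 0<x 0<b 0<y eq) a<b =
    quad 0<a (0<-+ 0<x 0<y) (0<-difference a<b) 0<y (preserved a x b y ⨾ eq)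
    where
    preserved : ∀ a x b y → a ℤ.* (x ℤ.+ y) ℤ.+ (b ℤ.- a) ℤ.* y ≡ a ℤ.* x ℤ.+ b ℤ.* y
    preserved = solve-∀

  unshear-quad : ∀ {a x b y} → IsQuad N ((a , x) , (b , y)) → y ℤ.< x → IsQuad N (unshear ((a , x) , (b , y)))
  unshear-quad {a} {x} {b} {y} (quad 0<a 0<x 0<b 0<y eq) y<x =
    quad 0<a (0<-difference y<x) (0<-+ 0<b 0<a) 0<y (preserved a x b y ⨾ eq)
    where
    preserved : ∀ a x b y → a ℤ.* (x ℤ.- y) ℤ.+ (b ℤ.+ a) ℤ.* y ≡ a ℤ.* x ℤ.+ b ℤ.* y
    preserved = solve-∀

  transpose-quad : ∀ {a x b y} → IsQuad N ((a , x) , (b , y)) → IsQuad N ((b , y) , (a , x))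
  transpose-quad {a} {x} {b} {y} (quad 0<a 0<x 0<b 0<y eq) =
    quad 0<b 0<y 0<a 0<x (ℤ.+-comm (b ℤ.* y) (a ℤ.* x) ⨾ eq)

  transpose-odd : ∀ {p} → IsQuad N p × AllOdd p → IsQuad N (transpose p) × AllOdd (transpose p)
  transpose-odd (q , odd-a , odd-x , odd-b , odd-y) = transpose-quad q , odd-b , odd-y , odd-a , odd-x

b<a? : (p : Quad) → Dec (proj₁ (proj₂ p) ℤ.< proj₁ (proj₁ p))
b<a? ((a , _) , (b , _)) = b ℤ.<? a

x<y? : (p : Quad) → Dec (proj₂ (proj₁ p) ℤ.< proj₂ (proj₂ p))
x<y? ((_ , x) , (_ , y)) = x ℤ.<? y

a² difference² sum² : Quad → ℤ
a²          ((a , _) , _)       = a ℤ.* a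
difference² ((a , _) , (b , _)) = (a ℤ.- b) ℤ.* (a ℤ.- b)
sum²        ((a , _) , (b , _)) = (a ℤ.+ b) ℤ.* (a ℤ.+ b)

diagonalQuads : ∀ N → Enumeration (λ p → (IsQuad N p × AllOdd p) × proj₂ (proj₁ p) ≡ proj₂ (proj₂ p))
diagonalQuads N = restrict (λ ((_ , x) , (_ , y)) → x ℤ.≟ y) (oddQuads N)

-- The solutions with b < a are carried by `lower` onto the mixed ones with x < y; those with a < b
-- are their transposes.
∑-difference² : ∀ N → ∑ (oddQuads N) difference² ≡ + 2 ℤ.* ∑ (restrict x<y? (mixedQuads N)) a²
∑-difference² N =
  ∑-swap-split (oddQuads N) b<a? transpose transpose-odd (λ _ → refl) (λ b<a → ℤ.<-asym b<a)
    difference² (λ ((a , _) , (b , _)) → symmetric a b) ⨾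
  cong₂ (λ s t → + 2 ℤ.* s ℤ.+ t)
    (∑-inverse (restrict b<a? (oddQuads N)) (restrict x<y? (mixedQuads N)) lower raise
      (λ { ((q , odd-a , odd-x , odd-b , odd-y) , b<a) →
           (lower-quad q b<a , proj₂ (odd-odd odd-a odd-b) , odd-x , odd-b , proj₁ (odd-odd odd-x odd-y)) ,
           <-+ˡ (IsQuad.0<y q) })
      (λ { ((q , even-a , odd-x , odd-b , even-y) , x<y) →
           (raise-quad q x<y , even-odd even-a odd-b , odd-x , odd-b , even-minus-odd even-y odd-x) ,
           <-+ʳ (IsQuad.0<a q) })
      raise-lower lower-raise (λ _ → refl))
    -- Here a = b. The vanishing summand is kept as a product so that `∑-*` can pull out the factor
    -- 0.
    (∑-cong E {g = λ _ → 0ℤ ℤ.* 0ℤ} (λ { {(a , _) , (b , _)} ((_ , b≮a) , a≮b) →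
         cong (λ z → z ℤ.* z) (ℤ.i≡j⇒i-j≡0 (ℤ.≤-antisym (ℤ.≮⇒≥ b≮a) (ℤ.≮⇒≥ a≮b))) }) ⨾
     ∑-* 0ℤ E (λ _ → 0ℤ)) ⨾
  ℤ.+-identityʳ _
  where
  E = restrict (¬? ∘ b<a? ∘ transpose) (restrict (¬? ∘ b<a?) (oddQuads N))
  symmetric : ∀ a b → (b ℤ.- a) ℤ.* (b ℤ.- a) ≡ (a ℤ.- b) ℤ.* (a ℤ.- b)
  symmetric = solve-∀

-- `raise` carries the solutions with x < y onto the mixed ones with b < a. In contrast to the case
-- a = b for differences, the solutions with x = y contribute.
∑-sum² : ∀ N → ∑ (oddQuads N) sum² ≡
  + 2 ℤ.* ∑ (restrict b<a? (mixedQuads N)) a² ℤ.+ ∑ (diagonalQuads N) sum²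
∑-sum² N =
  ∑-swap-split (oddQuads N) x<y? transpose transpose-odd (λ _ → refl) (λ x<y → ℤ.<-asym x<y)
    sum² (λ ((a , _) , (b , _)) → symmetric a b) ⨾
  cong₂ (λ s t → + 2 ℤ.* s ℤ.+ t)
    (∑-inverse (restrict x<y? (oddQuads N)) (restrict b<a? (mixedQuads N)) raise lower
      (λ { ((q , odd-a , odd-x , odd-b , odd-y) , x<y) →
           (raise-quad q x<y , proj₁ (odd-odd odd-a odd-b) , odd-x , odd-b , proj₂ (odd-odd odd-y odd-x)) ,
           <-+ʳ (IsQuad.0<a q) })
      (λ { ((q , even-a , odd-x , odd-b , even-y) , b<a) →
           (lower-quad q b<a , even-minus-odd even-a odd-b , odd-x , odd-b , proj₁ (odd-even odd-x even-y)) ,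
           <-+ˡ (IsQuad.0<y q) })
      lower-raise raise-lower (λ _ → refl))
    (∑-⇔ (restrict (¬? ∘ x<y? ∘ transpose) (restrict (¬? ∘ x<y?) (oddQuads N))) (diagonalQuads N)
      (λ ((q , x≮y) , y≮x) → q , ℤ.≤-antisym (ℤ.≮⇒≥ y≮x) (ℤ.≮⇒≥ x≮y))
      (λ { (q , refl) → (q , ℤ.<-irrefl refl) , ℤ.<-irrefl refl }) sum²)
  where
  symmetric : ∀ a b → (b ℤ.+ a) ℤ.* (b ℤ.+ a) ≡ (a ℤ.+ b) ℤ.* (a ℤ.+ b)
  symmetric = solve-∀

-- The complements are compared instead. Parity excludes equality, so they are given by a < b and by
-- y < x, and `shear` matches them without changing a.
∑-a² : ∀ N → ∑ (restrict x<y? (mixedQuads N)) a² ≡ ∑ (restrict b<a? (mixedQuads N)) a²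
∑-a² N = +-cancelʳ
  (∑ (restrict (¬? ∘ x<y?) V) a²) (∑ (restrict x<y? V) a²) (∑ (restrict b<a? V) a²)
  (sym (∑-split x<y? V a²) ⨾ ∑-split b<a? V a² ⨾
  +-congˡ (∑ (restrict b<a? V) a²)
    (∑-inverse (restrict (¬? ∘ b<a?) V) (restrict (¬? ∘ x<y?) V) shear unshear
      (λ { ((q , even-a , odd-x , odd-b , even-y) , b≮a) →
           let a<b = ≮⇒> b≮a (even-odd-differ even-a odd-b ∘ sym) in
           (shear-quad q a<b , even-a , proj₁ (odd-even odd-x even-y) , proj₂ (odd-even odd-b even-a) , even-y) ,
           ℤ.<-asym (<-+ʳ (IsQuad.0<x q)) })
      (λ { ((q , even-a , odd-x , odd-b , even-y) , x≮y) →
           let y<x = ≮⇒> x≮y (even-odd-differ even-y odd-x ∘ sym) in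
           (unshear-quad q y<x , even-a , proj₂ (odd-even odd-x even-y) , proj₁ (odd-even odd-b even-a) , even-y) ,
           ℤ.<-asym (<-+ʳ (IsQuad.0<b q)) })
      unshear-shear shear-unshear (λ _ → refl)))
  where
  V = mixedQuads N

-- Polarise 4 a b = (a + b)² - (a - b)²; the mixed sums cancel. On the diagonal (a + b) x = 2 (n +
-- 1), and an even s is a sum of two positive odd numbers in s / 2 ways. The right side is therefore
-- four times the sum of ((n + 1) / x)³ over the odd divisors x of n + 1.
ψ⁸-diagonal : ∀ n → + 4 ℤ.* (ψ ^ 8) n ≡ ∑ (diagonalQuads (suc n)) sum²
ψ⁸-diagonal n = begin
  + 4 ℤ.* (ψ ^ 8) n
    ≡⟨ cong (λ z → + 4 ℤ.* z) (solve 1 (λ p → p :^ 8 := p :^ 4 :* p :^ 4) ≋-refl ψ n ⨾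
         ⊛-cong ψ⁴≋σ ψ⁴≋σ n ⨾ σ²-quads n) ⟩
  + 4 ℤ.* ∑ O product                                ≡⟨ ∑-* (+ 4) O product ⟨
  ∑ O (λ p → + 4 ℤ.* product p)                      ≡⟨ ∑-cong O (λ {((a , _) , (b , _))} _ → polarise a b) ⟩
  ∑ O (λ p → sum² p ℤ.+ -1ℤ ℤ.* difference² p)       ≡⟨ ∑-+ O sum² _ ⟩
  ∑ O sum² ℤ.+ ∑ O (λ p → -1ℤ ℤ.* difference² p)     ≡⟨ +-congˡ (∑ O sum²) (∑-* -1ℤ O difference²) ⟩
  ∑ O sum² ℤ.+ -1ℤ ℤ.* ∑ O difference²
    ≡⟨ cong₂ (λ s t → s ℤ.+ -1ℤ ℤ.* t) (∑-sum² N) (∑-difference² N ⨾ cong (λ z → + 2 ℤ.* z) (∑-a² N)) ⟩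
  (+ 2 ℤ.* ∑ (restrict b<a? (mixedQuads N)) a² ℤ.+ ∑ (diagonalQuads N) sum²)
    ℤ.+ -1ℤ ℤ.* (+ 2 ℤ.* ∑ (restrict b<a? (mixedQuads N)) a²)
    ≡⟨ cancel (∑ (restrict b<a? (mixedQuads N)) a²) (∑ (diagonalQuads N) sum²) ⟩
  ∑ (diagonalQuads N) sum²                           ∎
  where
  open ≡-Reasoning
  N = suc n
  O = oddQuads N
  product : Quad → ℤ
  product ((a , _) , (b , _)) = a ℤ.* b
  polarise : ∀ a b → + 4 ℤ.* (a ℤ.* b) ≡ (a ℤ.+ b) ℤ.* (a ℤ.+ b) ℤ.+ -1ℤ ℤ.* ((a ℤ.- b) ℤ.* (a ℤ.- b))
  polarise = solve-∀
  cancel : ∀ v d → (+ 2 ℤ.* v ℤ.+ d) ℤ.+ -1ℤ ℤ.* (+ 2 ℤ.* v) ≡ d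
  cancel = solve-∀

-- The congruence

total-≅0 : ∀ {A : Set} {f : A → ℤ} xs → (∀ {x} → x ∈ xs → f x ≅ 0ℤ) → total f xs ≅ 0ℤ
total-≅0 []       _  = ≡⇒≅ refl
total-≅0 (x ∷ xs) f≅ = +-cong-≅ (f≅ (here refl)) (total-≅0 xs (f≅ ∘ there))

11∣a+b? : Decidable (λ ((( a , _) , (b , _)) : Quad) → + 11 Signed.∣ a ℤ.+ b)
11∣a+b? ((a , _) , (b , _)) = + 11 Signed.∣? a ℤ.+ b

Diagonal : ℕ → Quad → Set
Diagonal N p = (IsQuad N p × AllOdd p) × proj₂ (proj₁ p) ≡ proj₂ (proj₂ p)

diagonal-multiples : ∀ N → ∑ (restrict 11∣a+b? (diagonalQuads N)) sum² ≅ 0ℤ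
diagonal-multiples N = total-≅0 (Enumeration.elements E) (λ {p} → vanish p ∘ Enumeration.sound E)
  where
  E = restrict 11∣a+b? (diagonalQuads N)
  vanish : ∀ (p : Quad) → Diagonal N p × + 11 Signed.∣ proj₁ (proj₁ p) ℤ.+ proj₁ (proj₂ p) → sum² p ≅ 0ℤ
  vanish ((a , _) , (b , _)) (_ , 11∣) with 11∣
  ... | Signed.divides q eq = q ℤ.* q ℤ.* + 11 by (cong (λ z → z ℤ.* z) eq ⨾ square-multiple q)
    where
    square-multiple : ∀ q → q ℤ.* + 11 ℤ.* (q ℤ.* + 11) ≡ 0ℤ ℤ.+ + 11 ℤ.* (q ℤ.* q ℤ.* + 11)
    square-multiple = solve-∀

double-11* : ∀ N → + double (11 * N) ≡ + 11 ℤ.* + double N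
double-11* N = +-double (11 * N) ⨾ cong (λ z → + 2 ℤ.* z) (ℤ.pos-* 11 N) ⨾ exchange (+ N) ⨾
  cong (λ z → + 11 ℤ.* z) (sym (+-double N))
  where
  exchange : ∀ N → + 2 ℤ.* (+ 11 ℤ.* N) ≡ + 11 ℤ.* (+ 2 ℤ.* N)
  exchange = solve-∀

11-prime : Prime 11
11-prime = from-yes (prime? 11)

-- The map x ↦ 11 x. It is onto because (a + b) x = 2 · 11 N and 11 does not divide a + b, so by
-- primality it divides x.
diagonal-nonmultiples : ∀ N →
  ∑ (restrict (¬? ∘ 11∣a+b?) (diagonalQuads N)) sum² ≡
  ∑ (restrict (¬? ∘ 11∣a+b?) (diagonalQuads (11 * N))) sum²
diagonal-nonmultiples N =
  ∑-bijection (restrict (¬? ∘ 11∣a+b?) (diagonalQuads N)) (restrict (¬? ∘ 11∣a+b?) (diagonalQuads (11 * N)))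
    scale into (λ {p} {q} _ _ → scale-injective p q) onto (λ _ → refl)
  where
  scale : Quad → Quad
  scale ((a , x) , (b , y)) = (a , + 11 ℤ.* x) , (b , + 11 ℤ.* y)
  11-odd : Oddℤ (+ 11)
  11-odd = + 5 , refl
  0<11 : 0ℤ ℤ.< + 11
  0<11 = ℤ.+<+ (s≤s z≤n)
  factor : ∀ a x b y → a ℤ.* (+ 11 ℤ.* x) ℤ.+ b ℤ.* (+ 11 ℤ.* y) ≡ + 11 ℤ.* (a ℤ.* x ℤ.+ b ℤ.* y)
  factor = solve-∀
  into : ∀ {p} → Diagonal N p × ¬ (+ 11 Signed.∣ proj₁ (proj₁ p) ℤ.+ proj₁ (proj₂ p)) →
    Diagonal (11 * N) (scale p) × ¬ (+ 11 Signed.∣ proj₁ (proj₁ p) ℤ.+ proj₁ (proj₂ p))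
  into {(a , x) , (b , y)} (((quad 0<a 0<x 0<b 0<y eq , odd-a , odd-x , odd-b , odd-y) , x≡y) , 11∤) =
    ((quad 0<a (0<-* 0<11 0<x) 0<b (0<-* 0<11 0<y)
        (factor a x b y ⨾ cong (λ z → + 11 ℤ.* z) eq ⨾ sym (double-11* N)) ,
      odd-a , *-Oddℤ 11-odd odd-x , odd-b , *-Oddℤ 11-odd odd-y) , cong (λ z → + 11 ℤ.* z) x≡y) , 11∤
  scale-injective : ∀ p q → scale p ≡ scale q → p ≡ q
  scale-injective ((a , x) , (b , y)) ((a′ , x′) , (b′ , y′)) eq = cong₂ _,_
    (cong₂ _,_ (cong (proj₁ ∘ proj₁) eq) (ℤ.*-cancelˡ-≡ (+ 11) x x′ (cong (proj₂ ∘ proj₁) eq)))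
    (cong₂ _,_ (cong (proj₁ ∘ proj₂) eq) (ℤ.*-cancelˡ-≡ (+ 11) y y′ (cong (proj₂ ∘ proj₂) eq)))
  0<-cancel : ∀ x → 0ℤ ℤ.< + 11 ℤ.* x → 0ℤ ℤ.< x
  0<-cancel x 0<11x = ℤ.*-cancelˡ-<-nonNeg (+ 11) 0<11x
  onto : ∀ {p} → Diagonal (11 * N) p × ¬ (+ 11 Signed.∣ proj₁ (proj₁ p) ℤ.+ proj₁ (proj₂ p)) →
    ∃ λ q → (Diagonal N q × ¬ (+ 11 Signed.∣ proj₁ (proj₁ q) ℤ.+ proj₁ (proj₂ q))) × scale q ≡ p
  onto {(a , x) , (b , _)} (((quad 0<a 0<x 0<b 0<y eq , odd-a , odd-x , odd-b , odd-y) , refl) , 11∤)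
    with euclidsLemma ∣ a ℤ.+ b ∣ ∣ x ∣ 11-prime (divides (double N) product)
    where
    product : ∣ a ℤ.+ b ∣ * ∣ x ∣ ≡ double N * 11
    product = sym (ℤ.abs-* (a ℤ.+ b) x) ⨾
      cong ∣_∣ (ℤ.*-distribʳ-+ x a b ⨾ eq ⨾ double-11* N ⨾ sym (ℤ.pos-* 11 (double N))) ⨾
      ℕ.*-comm 11 (double N)
  ... | inj₁ 11∣a+b = ⊥-elim (11∤ (Signed.∣ᵤ⇒∣ 11∣a+b))
  ... | inj₂ 11∣x with Signed.∣ᵤ⇒∣ {+ 11} {x} 11∣x
  ...   | Signed.divides z x≡ with x≡ ⨾ ℤ.*-comm z (+ 11)
  ...     | refl = ((a , z) , (b , z)) ,
    (((quad 0<a (0<-cancel z 0<x) 0<b (0<-cancel z 0<y)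
        (ℤ.*-cancelˡ-≡ (+ 11) (a ℤ.* z ℤ.+ b ℤ.* z) (+ double N) (sym (factor a z b z) ⨾ eq ⨾ double-11* N)) ,
       odd-a , odd-z , odd-b , odd-z) , refl) , 11∤) , refl
    where
    odd-z = proj₂ (Oddℤ-* {+ 11} {z} odd-x)

diagonal-11* : ∀ N → ∑ (diagonalQuads (11 * N)) sum² ≅ ∑ (diagonalQuads N) sum²
diagonal-11* N =
  ≅-trans (≡⇒≅ (∑-split 11∣a+b? (diagonalQuads (11 * N)) sum²)) (
  ≅-trans (+-cong-≅ (≅-trans (diagonal-multiples (11 * N)) (≅-sym (diagonal-multiples N)))
                    (≡⇒≅ (sym (diagonal-nonmultiples N))))
  (≡⇒≅ (sym (∑-split 11∣a+b? (diagonalQuads N) sum²))))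

suc-11n+10 : ∀ n → suc (11n+10 n) ≡ 11 * suc n
suc-11n+10 zero    = refl
suc-11n+10 (suc n) = cong (λ m → 11 + m) (suc-11n+10 n) ⨾ sym (ℕ.*-suc 11 (suc n))

ψ⁸-periodic : section (ψ ^ 8) ≋₁₁ ψ ^ 8
ψ⁸-periodic n = cancel-4 ((ψ ^ 8) (11n+10 n)) ((ψ ^ 8) n)
  (≅-trans (≡⇒≅ (ψ⁸-diagonal (11n+10 n) ⨾ cong (λ N → ∑ (diagonalQuads N) sum²) (suc-11n+10 n)))
  (≅-trans (diagonal-11* (suc n)) (≡⇒≅ (sym (ψ⁸-diagonal n)))))
  where
  cancel-4 : ∀ a b → + 4 ℤ.* a ≅ + 4 ℤ.* b → a ≅ b
  -- 3 inverts 4 modulo 11, as 3 · 4 = 1 + 11.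
  cancel-4 a b (q by eq) = (+ 3 ℤ.* q ℤ.+ b ℤ.- a) by
    (expand a ⨾ cong (λ z → + 3 ℤ.* z ℤ.- + 11 ℤ.* a) eq ⨾ collect a b q)
    where
    expand : ∀ a → a ≡ + 3 ℤ.* (+ 4 ℤ.* a) ℤ.- + 11 ℤ.* a
    expand = solve-∀
    collect : ∀ a b q → + 3 ℤ.* (+ 4 ℤ.* b ℤ.+ + 11 ℤ.* q) ℤ.- + 11 ℤ.* a ≡
                        b ℤ.+ + 11 ℤ.* (+ 3 ℤ.* q ℤ.+ b ℤ.- a)
    collect = solve-∀

sign-11n+10 : ∀ n → -1ℤ ℤ.^ 11n+10 n ≡ -1ℤ ℤ.^ n
sign-11n+10 zero    = refl
sign-11n+10 (suc n) = eleven (-1ℤ ℤ.^ 11n+10 n) ⨾ cong (λ z → -1ℤ ℤ.* z) (sign-11n+10 n)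
  where
  m = -1ℤ
  eleven : ∀ s → m ℤ.* (m ℤ.* (m ℤ.* (m ℤ.* (m ℤ.* (m ℤ.* (m ℤ.* (m ℤ.* (m ℤ.* (m ℤ.* (m ℤ.* s)))))))))) ≡ m ℤ.* s
  eleven = solve-∀

-- 11 n + 10 and n have the same parity, so the sign of q ↦ - q agrees on both sides.
φ⁸-periodic : section (φ ^ 8) ≋₁₁ φ ^ 8
φ⁸-periodic n = ≅-trans (≡⇒≅ (sym (twist-^ ψ 8 (11n+10 n))))
  (≅-trans (*-cong-≅ (≡⇒≅ (sign-11n+10 n)) (ψ⁸-periodic n)) (≡⇒≅ (twist-^ ψ 8 n)))

11n+10≡ : ∀ n → 11n+10 n ≡ 11 * n + 10
11n+10≡ zero    = refl
11n+10≡ (suc n) = cong (λ m → 11 + m) (11n+10≡ n) ⨾ sym (ℕ.+-assoc 11 (11 * n) 10) ⨾ cong (_+ 10) (sym (ℕ.*-suc 11 n))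

pod₋₃-section : ∀ n → + pod₋₃ (11 * n + 10) ≅ -1ℤ ℤ.^ n ℤ.* (ψ ^ 7) n
pod₋₃-section n =
  ≅-trans (≡⇒≅ (cong (λ k → + pod₋₃ k) (sym (11n+10≡ n)) ⨾ sym (pod³-coefficient (11n+10 n))))
  (≅-trans (cube-section (λ k → _ , ∑-count (pods k)) pod⊛φ φ⁸-periodic n)
           (≡⇒≅ (sym (twist-^ ψ 7 n))))

8n+7 : ∀ n → suc (double (suc (double (suc (double n))))) ≡ 8 * n + 7
8n+7 zero    = refl
8n+7 (suc n) = cong (λ m → 8 + m) (8n+7 n) ⨾ sym (ℕ.+-assoc 8 (8 * n) 7) ⨾ cong (_+ 7) (sym (ℕ.*-suc 8 n))

odd-odd-odd : ∀ f n → odd (odd (odd f)) n ≡ f (8 * n + 7)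
odd-odd-odd f n = cong f (8n+7 n)

r₇-coefficient : ∀ n → + r 7 (8 * n + 7) ≡ + 2368 ℤ.* (ψ ^ 7) n
r₇-coefficient n = sym (θ^-representations 7 (8 * n + 7)) ⨾ sym (odd-odd-odd (θ ^ 7) n) ⨾
  ThetaDissection.odd-odd-odd-θ⁷ θ ψ even-θ odd-θ even-θ² n ⨾ const-⊛ (+ 2368) (ψ ^ 7) n

-- 4 · 2368 = 1 + 11 · 861
combine : ∀ {a b s t} → a ≅ s ℤ.* t → b ≡ + 2368 ℤ.* t → a ≡ + 4 ℤ.* s ℤ.* b [mod + 11 ]
combine {s = s} {t} (q by refl) refl =
  Signed.∣⇒∣ᵤ (Signed.divides (q ℤ.- + 861 ℤ.* (s ℤ.* t)) (collect s t q))
  where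
  collect : ∀ s t q → s ℤ.* t ℤ.+ + 11 ℤ.* q ℤ.- + 4 ℤ.* s ℤ.* (+ 2368 ℤ.* t) ≡
                      (q ℤ.- + 861 ℤ.* (s ℤ.* t)) ℤ.* + 11
  collect = solve-∀

theorem4p5 : ∀ (n : ℕ) →
    + pod₋₃ (11 * n + 10) ≡ + 4 ℤ.* (-1ℤ ℤ.^ n) ℤ.* + r 7 (8 * n + 7) [mod + 11 ]
theorem4p5 n = combine {s = -1ℤ ℤ.^ n} (pod₋₃-section n) (r₇-coefficient n)
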